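{- Let $p\ge5$ be a prime, $e\ge1$, and let $\mathcal M$ be an orientably-regular embedding of $K_{p[p^e]}$ with $G=\mathrm{Aut}^+(\mathcal M)$. Let $H$ be the subgroup of $G$ preserving each part setwise and $P$ a Sylow $p$-subgroup of $G$. Suppose $H$ is abelian and $P$ has exponent $p^e$. Then $\mathcal M$ is isomorphic to one of the maps $\mathcal M_2(p,j)$, $j\in\mathbb Z_{p-1}^*$ (in particular $e=1$), and these maps are pairwise non-isomorphic for distinct $j$. Moreover, all maps $\mathcal M_2(p,j)$ are orientably-regular embeddings of $K_{p[p]}$, they are chiral, and they have type $\{p(p-1),p(p-1)\}$ if $p\equiv1\pmod4$ and $\{\frac{p(p-1)}2,p(p-1)\}$ if $p\equiv3\pmod4$.
   Context: $K_{m[n]}$ is the complete multipartite graph with $m$ parts of $n$ vertices each. An orientably-regular embedding of a graph is a 2-cell embedding in an orientable surface whose group $\mathrm{Aut}^+(\mathcal M)$ of orientation-preserving automorphisms acts regularly on arcs. For $G=\langle a,b\rangle$ with $b$ an involution and $\langle a\rangle$ core-free, $\mathcal M(G;a,b)$ is the orientably-regular map on the coset graph with vertices $\{\langle a\rangle g\}$, arcs $\{(\langle a\rangle g,\langle a\rangle bg)\}$, local rotation $(\langle a\rangle g,\langle a\rangle bg)\mapsto(\langle a\rangle g,\langle a\rangle bag)$; $\mathcal M(G;a,b)\cong\mathcal M(G;a',b')$ iff an automorphism of $G$ maps $a\mapsto a'$, $b\mapsto b'$; its type is $\{s,t\}$ with $s=|ab|$, $t=|a|$; it is reflexible if $\mathcal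 M(G;a,b)\cong\mathcal M(G;a^{ -1},b)$, chiral otherwise. $G_2(p)=\langle w,z,c,g\mid w^p=z^p=c^p=g^{p-1}=1,[w,z]=1,c^g=c^t,w^c=wz,z^c=z,w^g=w,z^g=z^t\rangle$ with $t$ a fixed generator of $\mathbb Z_p^*$ (conventions $u^v=v^{ -1}uv$, $[u,v]=u^{ -1}v^{ -1}uv$), and $\mathcal M_2(p,j)=\mathcal M(G_2(p);wg^j,cg^{(p-1)/2})$. -}

module Defs where

open import Level using (0ℓ)
open import Data.Nat using (ℕ; zero; suc; _+_; _*_; _∸_; _^_; _≤_; _<_; _%_; _/_)
open import Data.Nat.Divisibility using (_∣_)
open import Data.Nat.Coprimality using (Coprime)
open import Data.Nat.Primality using (Prime)
open import Data.Fin using (Fin)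
open import Data.List using (List; length; filter)
open import Data.List.Relation.Unary.Any using (Any)
open import Data.List.Relation.Unary.AllPairs using (AllPairs)
open import Data.Product using (Σ; ∃; _×_; _,_; proj₁; proj₂)
open import Data.Sum using (_⊎_)
open import Relation.Nullary using (¬_)
open import Relation.Unary using (Pred; Decidable)
open import Relation.Binary.PropositionalEquality using (_≡_; _≢_)
open import Function.Bundles using (_⇔_)
open import Algebra.Bundles using (Group)
open import Algebra.Morphism.Structures using (module GroupMorphisms)
import Relation.Binary as B

module _ (G : Group 0ℓ 0ℓ) where
  open Group G

  pow : Carrier → ℕ → Carrier
  pow x zero    = ε
  pow x (suc n) = x ∙ pow x n

  conj : Carrier → Carrier → Carrier
  conj u v = ((v ⁻¹) ∙ u) ∙ v

  comm : Carrier → Carrier → Carrier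
  comm u v = (((u ⁻¹) ∙ (v ⁻¹)) ∙ u) ∙ v

  InCyclic : Carrier → Carrier → Set
  InCyclic a y = ∃ λ (k : ℕ) → (y ≈ pow a k) ⊎ (y ≈ (pow a k) ⁻¹)

  data InGen (S : Carrier → Set) : Carrier → Set where
    gen  : ∀ {x} → S x → InGen S x
    unit : InGen S ε
    mul  : ∀ {x y} → InGen S x → InGen S y → InGen S (x ∙ y)
    inv  : ∀ {x} → InGen S x → InGen S (x ⁻¹)
    resp : ∀ {x y} → x ≈ y → InGen S x → InGen S y

  GeneratedBy₂ : Carrier → Carrier → Set
  GeneratedBy₂ a b = ∀ x → InGen (λ y → (y ≈ a) ⊎ (y ≈ b)) x

  GeneratedBy₄ : Carrier → Carrier → Carrier → Carrier → Set
  GeneratedBy₄ w z c g =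
    ∀ x → InGen (λ y → (y ≈ w) ⊎ ((y ≈ z) ⊎ ((y ≈ c) ⊎ (y ≈ g)))) x

  HasOrder : Carrier → ℕ → Set
  HasOrder x n = (1 ≤ n) × (pow x n ≈ ε) ×
                 (∀ m → 1 ≤ m → pow x m ≈ ε → n ≤ m)

  CoreFree : Carrier → Set
  CoreFree a = ∀ x → (∀ g → InCyclic a (conj x g)) → x ≈ ε

  Involution : Carrier → Set
  Involution b = (b ∙ b ≈ ε) × ¬ (b ≈ ε)

  record MapData (a b : Carrier) : Set where
    field
      generated : GeneratedBy₂ a b
      b-inv     : Involution b
      core-free : CoreFree a

  record IsSubgroup (P : Carrier → Set) : Set where
    field
      P-resp : ∀ {x y} → x ≈ y → P x → P y
      P-ε    : P ε
      P-∙    : ∀ {x y} → P x → P y → P (x ∙ y)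
      P-⁻¹   : ∀ {x} → P x → P (x ⁻¹)

  HasExponent : (Carrier → Set) → ℕ → Set
  HasExponent P n = (1 ≤ n) × (∀ x → P x → pow x n ≈ ε) ×
                    (∀ m → 1 ≤ m → (∀ x → P x → pow x m ≈ ε) → n ≤ m)

  -- The underlying graph of M(G;a,b) is (isomorphic to) K_{m[n]}.
  -- Vertices of M(G;a,b) are right cosets ⟨a⟩g, darts are the arcs
  -- (⟨a⟩g, ⟨a⟩bg), g ∈ G.  The vertex set of K_{m[n]} is Fin m × Fin n,
  -- the part of a vertex being its first component.  ν g is the image of
  -- the vertex ⟨a⟩g under a graph isomorphism; the conditions say that ν
  -- is a bijection from cosets to vertices of K_{m[n]} and that the darts
  -- are sent bijectively onto the arcs of K_{m[n]} (so the underlying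
  -- graph is simple and equal to K_{m[n]}).
  record EmbeddingOfK (a b : Carrier) (m n : ℕ) : Set where
    field
      ν        : Carrier → Fin m × Fin n
      ν-coset  : ∀ g h → (ν g ≡ ν h) ⇔ InCyclic a (h ∙ (g ⁻¹))
      ν-surj   : ∀ v → ∃ λ g → ν g ≡ v
      arc-ok   : ∀ g → proj₁ (ν g) ≢ proj₁ (ν (b ∙ g))
      arc-inj  : ∀ g h → ν g ≡ ν h → ν (b ∙ g) ≡ ν (b ∙ h) → g ≈ h
      arc-surj : ∀ u v → proj₁ u ≢ proj₁ v →
                 ∃ λ g → (ν g ≡ u) × (ν (b ∙ g) ≡ v)

    -- Aut⁺(M(G;a,b)) ≅ G acts on vertices by ⟨a⟩g ↦ ⟨a⟩gx.
    -- H = elements preserving every part setwise.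
    InH : Carrier → Set
    InH x = ∀ g → proj₁ (ν (g ∙ x)) ≡ proj₁ (ν g)

  IsORMapOfK : Carrier → Carrier → ℕ → ℕ → Set
  IsORMapOfK a b m n = MapData a b × EmbeddingOfK a b m n

MapIso : (G : Group 0ℓ 0ℓ) → Group.Carrier G → Group.Carrier G →
         (G' : Group 0ℓ 0ℓ) → Group.Carrier G' → Group.Carrier G' → Set
MapIso G a b G' a' b' =
  ∃ λ (f : Group.Carrier G → Group.Carrier G') →
    GroupMorphisms.IsGroupIsomorphism (Group.rawGroup G) (Group.rawGroup G') f
    × Group._≈_ G' (f a) a' × Group._≈_ G' (f b) b'

Chiral : (G : Group 0ℓ 0ℓ) → Group.Carrier G → Group.Carrier G → Set
Chiral G a b = ¬ MapIso G a b G (Group._⁻¹ G a) b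

record FiniteGroup : Set₁ where
  field
    group    : Group 0ℓ 0ℓ
  open Group group
  field
    _≟_      : B.Decidable _≈_
    elems    : List Carrier
    complete : ∀ x → Any (x ≈_) elems
    distinct : AllPairs (λ x y → ¬ (x ≈ y)) elems

  order : ℕ
  order = length elems

  card : (P : Carrier → Set) → Decidable P → ℕ
  card P P? = length (filter P? elems)

  record IsSylow (p : ℕ) (P : Carrier → Set) : Set where
    field
      subgroup : IsSubgroup group P
      P?       : Decidable P
      k m      : ℕ
      card≡    : card P P? ≡ p ^ k
      order≡   : order ≡ (p ^ k) * m
      coprime  : ¬ (p ∣ m)

IsPrimitiveRoot : ℕ → ℕ → Set
IsPrimitiveRoot p t = (1 ≤ t) × (t < p) ×
  (∀ k → 1 ≤ k → k < p ∸ 1 → ¬ (p ∣ ((t ^ k) ∸ 1)))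

module _ (K : Group 0ℓ 0ℓ) where
  open Group K
  G₂Relations : ℕ → ℕ → Carrier → Carrier → Carrier → Carrier → Set
  G₂Relations p t w z c g =
    (pow K w p ≈ ε) × (pow K z p ≈ ε) × (pow K c p ≈ ε) ×
    (pow K g (p ∸ 1) ≈ ε) × (comm K w z ≈ ε) ×
    (conj K c g ≈ pow K c t) × (conj K w c ≈ w ∙ z) ×
    (conj K z c ≈ z) × (conj K w g ≈ w) × (conj K z g ≈ pow K z t)

record IsG₂Presentation (p t : ℕ) (Γ : Group 0ℓ 0ℓ)
         (w z c g : Group.Carrier Γ) : Set₁ where
  field
    generated : GeneratedBy₄ Γ w z c g
    relations : G₂Relations Γ p t w z c g
    universal : (K : Group 0ℓ 0ℓ) (w' z' c' g' : Group.Carrier K) →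
      G₂Relations K p t w' z' c' g' →
      ∃ λ (f : Group.Carrier Γ → Group.Carrier K) →
        GroupMorphisms.IsGroupHomomorphism (Group.rawGroup Γ) (Group.rawGroup K) f
        × Group._≈_ K (f w) w' × Group._≈_ K (f z) z'
        × Group._≈_ K (f c) c' × Group._≈_ K (f g) g'

-- generators of M₂(p,j) = M(G₂(p); w g^j, c g^{(p-1)/2})
module _ (Γ : Group 0ℓ 0ℓ) (p : ℕ) (w c g : Group.Carrier Γ) where
  open Group Γ
  M₂a : ℕ → Carrier
  M₂a j = w ∙ pow Γ g j
  M₂b : Carrier
  M₂b = c ∙ pow Γ g ((p ∸ 1) / 2)

UnitMod : ℕ → ℕ → Set
UnitMod n j = (j < n) × Coprime j n

{-# OPTIONS --safe #-}

-- Let part x be the part of the vertex ⟨ a ⟩ x. Then G acts on the parts on the right, with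
-- kernel H, and an element fixing two parts lies in H. The stabilizers in H of two adjacent
-- vertices are cyclic of order q = pᵉ and H is their product. An element of a Sylow subgroup outside
-- H permutes the p parts cyclically; on the basis of H given by w ∈ ⟨ a ⟩ and z = [ w , c ] it acts by
-- a 2 × 2 matrix 1 + N over ℤ/q with (1 + N)ᵖ = 1, and since p ≥ 5 this forces q = p and N² = 0.
-- For s the involution of ⟨ a ⟩ put c = b s. It moves every part, and any such element is, modulo
-- H, a power of a given p-cycle; hence c and a power g of a satisfy the relations of G₂(p) modulo H.
-- They hold on the nose because s inverts c and g has order p - 1. Conversely G₂(p) is modelled
-- on quadruples of exponents, where the claims about M₂(p , j) become congruences.
-- In the code the prime is suc p, so that p is the order of g.
module Submission where

open import Defs
open import Level using (0ℓ)
open import Data.Nat using (ℕ; zero; suc; _+_; _*_; _∸_; _^_; _≤_; _<_; _%_; _/_; _≤?_; z≤n; s≤s; NonZero; NonTrivial; >-nonZero; >-nonZero⁻¹; ≢-nonZero⁻¹)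
open import Data.Nat.Properties using (*-assoc; *-cancelˡ-≡; *-comm; *-distribʳ-+; *-distribˡ-+; *-distribˡ-∸; *-identityʳ; *-monoʳ-≤; *-zeroʳ; +-assoc; +-cancelˡ-≡; +-comm; +-identityʳ; +-suc; <⇒≤; <⇒≱; ^-*-assoc; ^-distribˡ-+-*; ^-monoʳ-<; ^-zeroˡ; m*n≢0; m+[n∸m]≡n; m<m+n; m<n⇒0<n∸m; m^n>0; m^n≢0; m∸n+n≡m; m∸n≡0⇒m≤n; m∸n≤m; n<1+n; ≤-<-trans; ≤-antisym; ≤-pred; ≤-total; ≤-trans; ≰⇒>)
open import Data.Nat.Divisibility using (_∣_; _∣0; *-cancelˡ-∣; *-monoʳ-∣; *-pres-∣; m∣m*n; n∣m*n; ∣-antisym; ∣-refl; ∣-trans; ∣1⇒≡1; ∣m+n∣m⇒∣n; ∣m⇒∣m*n; ∣m∣n⇒∣m+n; ∣n⇒∣m*n; ∣⇒≤; divides)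
open import Data.Nat.DivMod using (m≡m%n+[m/n]*n; m%n<n; m*n/n≡m; [m+kn]%n≡m%n)
open import Data.Nat.GCD using (module Bézout)
import Data.Nat.Coprimality as Coprimality
open Coprimality using (Coprime; coprime-Bézout; coprime-divisor; prime⇒coprime)
open import Data.Nat.Primality using (Prime; euclidsLemma; prime⇒nonTrivial; prime⇒irreducible)
open import Data.Nat.Combinatorics using (_C_; nCk+nC[k+1]≡[n+1]C[k+1]; k>n⇒nCk≡0; nC1≡n; nCn≡1)
open import Data.Nat.Tactic.RingSolver using (solve-∀; solve)
open import Data.Fin as Fin using (Fin; toℕ; fromℕ<; punchIn; punchOut; combine)
import Data.Fin.Properties as Finₚ
open Finₚ using (toℕ<n; toℕ-injective; toℕ-fromℕ<; any?; pigeonhole; punchOut-injective; punchOut-punchIn; punchInᵢ≢i; injective⇒≤; combine-injectiveˡ; combine-injectiveʳ; combine-surjective)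
open import Data.List using ([]; _∷_; length; lookup)
open import Data.List.Relation.Unary.All as All using (All)
open import Data.List.Relation.Unary.Any as Any using (Any)
open import Data.List.Relation.Unary.Any.Properties using (lookup-index)
open import Data.List.Relation.Unary.AllPairs using (AllPairs; []; _∷_)
open import Data.Product using (∃; ∃₂; _×_; _,_; proj₁; proj₂)
open import Data.Sum using (_⊎_; inj₁; inj₂; [_,_]′)
open import Function using (_∘_)
open import Function.Bundles using (_⇔_; mk⇔; Equivalence)
open import Relation.Nullary using (¬_; Dec; yes; no; contradiction)
open import Relation.Nullary.Decidable using (decidable-stable; _×-dec_; ¬?)
open import Relation.Binary.Bundles using (Setoid)
open import Algebra.Bundles using (Group)
open import Algebra.Morphism.Structures using (module GroupMorphisms)
import Data.List.Relation.Unary.All.Properties as Allₚ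
import Data.List.Relation.Unary.AllPairs.Properties as AllPairsₚ
import Data.List.Membership.Propositional.Properties as ∈ₚ
import Relation.Unary
import Relation.Binary.PropositionalEquality as ≡
open ≡ using (_≡_; _≢_)
import Relation.Binary.Reasoning.Setoid as SetoidReasoning
import Algebra.Properties.Group as GroupProperties
open import Tactic.MonoidSolver renaming (solve to solveᴹ)

-- Write `P = suc p`. Counting arcs gives |G| = P p q², whereas a Sylow subgroup inside `H` would
-- have at most q² elements, too few for the power of P in |G|. So it contains some y outside `H`,
-- and the exponent hypothesis gives y^q = 1. The bound on P enters through N² ≡ 0 mod P and N⁴ ≡ 0
-- mod P²: for P ≥ 5 the last binomial term N^P is negligible modulo P², so the z-exponent of (1 +
-- N)^P w is P modulo P². It can vanish modulo q only if q = P. The choice c = b s makes b = c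
-- g^(p/2) automatic but hides the order of c. Hence there are two bases of `H`: the one from y
-- shows that H⟨ y ⟩ has exponent P, which yields c^P = 1, and the basis is then rebuilt from c.
-- Lifting c^g = c^t from G/H introduces a factor w^x z^v. As s inverts c and c^g but centralizes w,
-- x = -x; and g^p = 1 gives p t^(p-1) v = 0. Both corrections therefore vanish modulo P.

infix 4 _≋_mod_

-- Multiples are added on both sides, which makes the relation symmetric by construction and avoids
-- truncated subtraction. Negation modulo n is expressed throughout as multiplication by n - 1.
record _≋_mod_ (x y n : ℕ) : Set where
  constructor shifts
  field
    l r : ℕ
    eq  : x + l * n ≡ y + r * n

module _ {n : ℕ} where

  ≋-reflexive : ∀ {x y} → x ≡ y → x ≋ y mod n
  ≋-reflexive e = shifts 0 0 (≡.cong (_+ 0) e)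

  ≋-refl : ∀ {x} → x ≋ x mod n
  ≋-refl = ≋-reflexive ≡.refl

  ≋-sym : ∀ {x y} → x ≋ y mod n → y ≋ x mod n
  ≋-sym (shifts l r e) = shifts r l (≡.sym e)

  ≋-trans : ∀ {x y z} → x ≋ y mod n → y ≋ z mod n → x ≋ z mod n
  ≋-trans {x} {y} {z} (shifts l r e) (shifts l′ r′ e′) = shifts (l + l′) (r + r′) (begin
    x + (l + l′) * n    ≡⟨ solve (x ∷ l ∷ l′ ∷ n ∷ []) ⟩
    (x + l * n) + l′ * n ≡⟨ ≡.cong (_+ l′ * n) e ⟩
    (y + r * n) + l′ * n ≡⟨ solve (y ∷ r ∷ l′ ∷ n ∷ []) ⟩
    (y + l′ * n) + r * n ≡⟨ ≡.cong (_+ r * n) e′ ⟩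
    (z + r′ * n) + r * n ≡⟨ solve (z ∷ r ∷ r′ ∷ n ∷ []) ⟩
    z + (r + r′) * n    ∎)
    where open ≡.≡-Reasoning

  ≋-+ : ∀ {x y u v} → x ≋ y mod n → u ≋ v mod n → x + u ≋ y + v mod n
  ≋-+ {x} {y} {u} {v} (shifts l r e) (shifts l′ r′ e′) = shifts (l + l′) (r + r′) (begin
    x + u + (l + l′) * n      ≡⟨ solve (x ∷ u ∷ l ∷ l′ ∷ n ∷ []) ⟩
    (x + l * n) + (u + l′ * n) ≡⟨ ≡.cong₂ _+_ e e′ ⟩
    (y + r * n) + (v + r′ * n) ≡⟨ solve (y ∷ v ∷ r ∷ r′ ∷ n ∷ []) ⟩
    y + v + (r + r′) * n      ∎)
    where open ≡.≡-Reasoning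

  ≋-* : ∀ {x y u v} → x ≋ y mod n → u ≋ v mod n → x * u ≋ y * v mod n
  ≋-* {x} {y} {u} {v} (shifts l r e) (shifts l′ r′ e′) =
    shifts (l * u + x * l′ + l * l′ * n) (r * v + y * r′ + r * r′ * n) (begin
    x * u + (l * u + x * l′ + l * l′ * n) * n ≡⟨ solve (x ∷ u ∷ l ∷ l′ ∷ n ∷ []) ⟩
    (x + l * n) * (u + l′ * n)                ≡⟨ ≡.cong₂ _*_ e e′ ⟩
    (y + r * n) * (v + r′ * n)                ≡⟨ solve (y ∷ v ∷ r ∷ r′ ∷ n ∷ []) ⟩
    y * v + (r * v + y * r′ + r * r′ * n) * n ∎)
    where open ≡.≡-Reasoning

  ≋-^ : ∀ {x y} k → x ≋ y mod n → x ^ k ≋ y ^ k mod n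
  ≋-^ zero    e = ≋-refl
  ≋-^ (suc k) e = ≋-* e (≋-^ k e)

  ≋-+-cancelˡ : ∀ {x y} z → z + x ≋ z + y mod n → x ≋ y mod n
  ≋-+-cancelˡ {x} {y} z (shifts l r e) = shifts l r (+-cancelˡ-≡ z _ _
    (≡.trans (≡.sym (+-assoc z x (l * n))) (≡.trans e (+-assoc z y (r * n)))))

  ≋-+-cancelʳ : ∀ {x y} z → x + z ≋ y + z mod n → x ≋ y mod n
  ≋-+-cancelʳ {x} {y} z e = ≋-+-cancelˡ z
    (≋-trans (≋-reflexive (+-comm z x)) (≋-trans e (≋-reflexive (+-comm y z))))

  *n≋0 : ∀ k → k * n ≋ 0 mod n
  *n≋0 k = shifts 0 k (+-identityʳ (k * n))

  n*≋0 : ∀ k → n * k ≋ 0 mod n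
  n*≋0 k = ≋-trans (≋-reflexive (*-comm n k)) (*n≋0 k)

  ∣⇒≋0 : ∀ {x} → n ∣ x → x ≋ 0 mod n
  ∣⇒≋0 (divides k ≡.refl) = *n≋0 k

  ≋0⇒∣ : ∀ {x} → x ≋ 0 mod n → n ∣ x
  ≋0⇒∣ {x} (shifts l r e) =
    ∣m+n∣m⇒∣n (≡.subst (n ∣_) (≡.trans (≡.sym e) (+-comm x _)) (n∣m*n r)) (n∣m*n l)

  ≋-weaken : ∀ {x y d} → d ∣ n → x ≋ y mod n → x ≋ y mod d
  ≋-weaken {x} {y} {d} (divides k ≡.refl) (shifts l r e) = shifts (l * k) (r * k)
    (≡.trans (≡.cong (x +_) (*-assoc l k d)) (≡.trans e (≡.cong (y +_) (≡.sym (*-assoc r k d)))))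

  ≋-% : ∀ x .{{_ : NonZero n}} → x % n ≋ x mod n
  ≋-% x = shifts (x / n) 0 (≡.trans (≡.sym (m≡m%n+[m/n]*n x n)) (≡.sym (+-identityʳ x)))

  ≋⇒∣∸ : ∀ {x y} → x ≤ y → x ≋ y mod n → n ∣ y ∸ x
  ≋⇒∣∸ {x} {y} x≤y e = ≋0⇒∣ (≋-sym (≋-+-cancelˡ x (≋-trans (≋-reflexive (+-identityʳ x))
    (≋-trans e (≋-reflexive (≡.sym (m+[n∸m]≡n x≤y)))))))

  -- Differences exist in ℕ only one way round; symmetric statements about congruences are reduced
  -- to the ordered case here.
  ≤-wlog : ∀ {P : ℕ → ℕ → Set} → (∀ {x y} → P y x → P x y) →
           (∀ x y → x ≤ y → P x y) → ∀ x y → P x y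
  ≤-wlog s f x y with ≤-total x y
  ... | inj₁ x≤y = f x y x≤y
  ... | inj₂ y≤x = s (f y x y≤x)

  ≋⇒≡ : ∀ {x y} → x < n → y < n → x ≋ y mod n → x ≡ y
  ≋⇒≡ {x} {y} = ≤-wlog {λ x y → x < n → y < n → x ≋ y mod n → x ≡ y}
    (λ h a b e → ≡.sym (h b a (≋-sym e))) go x y
    where
    small : ∀ {y} d → d ≤ y → y < n → n ∣ d → d ≡ 0
    small zero    _   _   _ = ≡.refl
    small (suc d) d≤y y<n h = contradiction (≤-trans (∣⇒≤ h) d≤y) (<⇒≱ y<n)
    go : ∀ x y → x ≤ y → x < n → y < n → x ≋ y mod n → x ≡ y
    go x y x≤y _ y<n e = ≤-antisym x≤y
      (m∸n≡0⇒m≤n (small (y ∸ x) (m∸n≤m y x) y<n (≋⇒∣∸ x≤y e)))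

  ≋-setoid : Setoid _ _
  ≋-setoid = record { Carrier = ℕ ; _≈_ = λ x y → x ≋ y mod n
    ; isEquivalence = record { refl = ≋-refl ; sym = ≋-sym ; trans = ≋-trans } }

module ≋-Reasoning (n : ℕ) = SetoidReasoning (≋-setoid {n})

≋-*-cancelˡ : ∀ {p x y} a → Prime p → ¬ (p ∣ a) → a * x ≋ a * y mod p → x ≋ y mod p
≋-*-cancelˡ {p} {x} {y} a pr p∤a = ≤-wlog {p} {λ x y → a * x ≋ a * y mod p → x ≋ y mod p}
  (λ h e → ≋-sym (h (≋-sym e))) go x y
  where
  go : ∀ x y → x ≤ y → a * x ≋ a * y mod p → x ≋ y mod p
  go x y x≤y e =
    [ (λ h → contradiction h p∤a)
    , (λ h → ≋-sym (≡.subst₂ (_≋_mod p) (m∸n+n≡m x≤y) ≡.refl (≋-+ (∣⇒≋0 h) ≋-refl))) ]′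
    (euclidsLemma a (y ∸ x) pr
      (≡.subst (p ∣_) (≡.sym (*-distribˡ-∸ a y x)) (≋⇒∣∸ (*-monoʳ-≤ a x≤y) e)))

∤1 : ∀ {p} → Prime p → ¬ (p ∣ 1)
∤1 pr d = contradiction (∣1⇒≡1 d) (λ { ≡.refl → case-1 (prime⇒nonTrivial pr) })
  where case-1 : ¬ (NonTrivial 1)
        case-1 ()

∤^ : ∀ {p t} → Prime p → ¬ (p ∣ t) → ∀ k → ¬ (p ∣ t ^ k)
∤^ pr p∤t zero    d = ∤1 pr d
∤^ {t = t} pr p∤t (suc k) d = [ p∤t , ∤^ pr p∤t k ]′ (euclidsLemma t (t ^ k) pr d)

-- Binomial expansions

Σ< : ℕ → (ℕ → ℕ) → ℕ
Σ< zero    f = 0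
Σ< (suc n) f = f 0 + Σ< n (f ∘ suc)

Σ<-last : ∀ n f → Σ< (suc n) f ≡ Σ< n f + f n
Σ<-last zero    f = +-identityʳ (f 0)
Σ<-last (suc n) f = ≡.trans (≡.cong (f 0 +_) (Σ<-last n (f ∘ suc))) (≡.sym (+-assoc (f 0) _ _))

Σ<-cong : ∀ n {f g : ℕ → ℕ} → (∀ i → f i ≡ g i) → Σ< n f ≡ Σ< n g
Σ<-cong zero    h = ≡.refl
Σ<-cong (suc n) h = ≡.cong₂ _+_ (h 0) (Σ<-cong n (h ∘ suc))

Σ<-+ : ∀ n (f g : ℕ → ℕ) → Σ< n (λ i → f i + g i) ≡ Σ< n f + Σ< n g
Σ<-+ zero    f g = ≡.refl
Σ<-+ (suc n) f g = ≡.trans (≡.cong (f 0 + g 0 +_) (Σ<-+ n (f ∘ suc) (g ∘ suc)))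
  (interchange (f 0) (g 0) _ _)
  where interchange : ∀ a b c d → a + b + (c + d) ≡ a + c + (b + d)
        interchange = solve-∀

Σ<-∣ : ∀ {d} n {f : ℕ → ℕ} → (∀ i → i < n → d ∣ f i) → d ∣ Σ< n f
Σ<-∣ zero    h = _ ∣0
Σ<-∣ (suc n) h = ∣m∣n⇒∣m+n (h 0 (s≤s z≤n)) (Σ<-∣ n (λ i i<n → h (suc i) (s≤s i<n)))

-- Applying (1 + shift)ⁿ to the sequence s.
Δ : ℕ → (ℕ → ℕ) → ℕ → ℕ
Δ zero    s k = s k
Δ (suc n) s k = Δ n s k + Δ n s (suc k)

-- The binomial theorem for 1 + shift, by Pascal's rule; one of the two sums is padded with a
-- vanishing top term so that both have the same length.
Δ-expand : ∀ n s k → Δ n s k ≡ Σ< (suc n) (λ i → (n C i) * s (k + i))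
Δ-expand zero    s k = ≡.trans (≡.cong s (≡.sym (+-identityʳ k))) (≡.sym (≡.trans (+-identityʳ _) (+-identityʳ _)))
Δ-expand (suc n) s k = begin
  Δ n s k + Δ n s (suc k)
    ≡⟨ ≡.cong₂ _+_ (Δ-expand n s k) (Δ-expand n s (suc k)) ⟩
  (c₀ 0 + Σ< n (c₀ ∘ suc)) + Σ< (suc n) c₁
    ≡⟨ ≡.cong (λ x → (c₀ 0 + x) + Σ< (suc n) c₁) (≡.sym last-zero) ⟩
  (c₀ 0 + Σ< (suc n) (c₀ ∘ suc)) + Σ< (suc n) c₁
    ≡⟨ swap (c₀ 0) (Σ< (suc n) (c₀ ∘ suc)) (Σ< (suc n) c₁) ⟩
  c₀ 0 + (Σ< (suc n) c₁ + Σ< (suc n) (c₀ ∘ suc))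
    ≡⟨ ≡.cong (c₀ 0 +_) (≡.sym (Σ<-+ (suc n) c₁ (c₀ ∘ suc))) ⟩
  c₀ 0 + Σ< (suc n) (λ i → c₁ i + c₀ (suc i))
    ≡⟨ ≡.cong (c₀ 0 +_) (Σ<-cong (suc n) pascal) ⟩
  Σ< (suc (suc n)) (λ i → (suc n C i) * s (k + i)) ∎
  where
  open ≡.≡-Reasoning
  swap : ∀ a b c → (a + b) + c ≡ a + (c + b)
  swap = solve-∀
  c₀ c₁ : ℕ → ℕ
  c₀ i = (n C i) * s (k + i)
  c₁ i = (n C i) * s (suc k + i)
  last-zero : Σ< (suc n) (c₀ ∘ suc) ≡ Σ< n (c₀ ∘ suc)
  last-zero = ≡.trans (Σ<-last n (c₀ ∘ suc)) (≡.trans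
    (≡.cong (λ x → Σ< n (c₀ ∘ suc) + x * s (k + suc n)) (k>n⇒nCk≡0 (n<1+n n)))
    (+-identityʳ _))
  pascal : ∀ i → c₁ i + c₀ (suc i) ≡ (suc n C suc i) * s (k + suc i)
  pascal i = ≡.trans (≡.cong (λ x → (n C i) * s x + c₀ (suc i)) (≡.sym (+-suc k i)))
    (≡.trans (≡.sym (*-distribʳ-+ (s (k + suc i)) (n C i) (n C suc i)))
           (≡.cong (_* s (k + suc i)) (nCk+nC[k+1]≡[n+1]C[k+1] n i)))

-- The absorption identity. With a prime on the right it shows that the prime divides the inner
-- binomial coefficients.
C-absorb : ∀ n k → suc k * (suc n C suc k) ≡ suc n * (n C k)
C-absorb zero    zero    = ≡.refl
C-absorb zero    (suc k) = ≡.trans (≡.cong (suc (suc k) *_) (k>n⇒nCk≡0 {1} {suc (suc k)} (s≤s (s≤s z≤n))))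
  (≡.trans (*-zeroʳ (suc (suc k))) (≡.sym (≡.trans (+-identityʳ _) (k>n⇒nCk≡0 {0} {suc k} (s≤s z≤n)))))
C-absorb (suc n) zero    = ≡.trans (+-identityʳ _) (≡.trans (nC1≡n (suc (suc n))) (≡.sym (*-identityʳ (suc (suc n)))))
C-absorb (suc n) (suc k) = begin
  suc (suc k) * (suc (suc n) C suc (suc k))
    ≡⟨ ≡.cong (suc (suc k) *_) (≡.sym (nCk+nC[k+1]≡[n+1]C[k+1] (suc n) (suc k))) ⟩
  suc (suc k) * (A + B)
    ≡⟨ distr (suc k) A B ⟩
  A + suc k * A + suc (suc k) * B
    ≡⟨ ≡.cong₂ (λ x y → A + x + y) (C-absorb n k) (C-absorb n (suc k)) ⟩
  A + suc n * (n C k) + suc n * (n C suc k)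
    ≡⟨ collect A (suc n) (n C k) (n C suc k) ⟩
  A + suc n * ((n C k) + (n C suc k))
    ≡⟨ ≡.cong (λ x → A + suc n * x) (nCk+nC[k+1]≡[n+1]C[k+1] n k) ⟩
  suc (suc n) * A ∎
  where
  open ≡.≡-Reasoning
  A = suc n C suc k
  B = suc n C suc (suc k)
  distr : ∀ m a b → suc m * (a + b) ≡ a + m * a + suc m * b
  distr = solve-∀
  collect : ∀ a m x y → a + m * x + m * y ≡ a + m * (x + y)
  collect = solve-∀

p∣pC : ∀ {p} → Prime (suc p) → ∀ i → i < p → suc p ∣ (suc p C suc i)
p∣pC {p} pr i i<p with euclidsLemma (suc i) (suc p C suc i) pr
    (≡.subst (suc p ∣_) (≡.sym (C-absorb p i)) (m∣m*n (p C i)))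
... | inj₁ d = contradiction (∣⇒≤ d) (<⇒≱ (s≤s i<p))
... | inj₂ d = d

-- The two end terms are isolated because only their coefficients are prime to `suc p`.
Δ-prime : ∀ p s → Δ (suc p) s 0 ≡ s 0 + Σ< p (λ i → (suc p C suc i) * s (suc i)) + s (suc p)
Δ-prime p s = begin
  Δ (suc p) s 0                          ≡⟨ Δ-expand (suc p) s 0 ⟩
  1 * s 0 + Σ< (suc p) f                 ≡⟨ ≡.cong (1 * s 0 +_) (Σ<-last p f) ⟩
  1 * s 0 + (Σ< p f + (suc p C suc p) * s (suc p))
    ≡⟨ ≡.cong (λ x → 1 * s 0 + (Σ< p f + x * s (suc p))) (nCn≡1 (suc p)) ⟩
  1 * s 0 + (Σ< p f + 1 * s (suc p))     ≡⟨ assoc (s 0) _ _ ⟩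
  s 0 + Σ< p f + s (suc p)               ∎
  where
  open ≡.≡-Reasoning
  f = λ i → (suc p C suc i) * s (suc i)
  assoc : ∀ a b c → 1 * a + (b + 1 * c) ≡ a + b + c
  assoc = solve-∀

frobenius : ∀ {p} → Prime (suc p) → ∀ s → Δ (suc p) s 0 ≋ s 0 + s (suc p) mod suc p
frobenius {p} pr s = begin
  Δ (suc p) s 0              ≡⟨ Δ-prime p s ⟩
  s 0 + Σ< p _ + s (suc p)   ≈⟨ ≋-+ (≋-+ (≋-refl {x = s 0}) (∣⇒≋0 (Σ<-∣ p λ i i<p → ∣m⇒∣m*n (s (suc i)) (p∣pC pr i i<p)))) ≋-refl ⟩
  s 0 + 0 + s (suc p)        ≡⟨ ≡.cong (_+ s (suc p)) (+-identityʳ (s 0)) ⟩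
  s 0 + s (suc p)            ∎
  where open ≋-Reasoning (suc p)

-- On a geometric sequence the shift is multiplication by n, which turns `frobenius` into the
-- inductive step of Fermat's theorem.
Δ-geometric : ∀ n k i → Δ k (n ^_) i ≡ (1 + n) ^ k * n ^ i
Δ-geometric n zero    i = ≡.sym (+-identityʳ (n ^ i))
Δ-geometric n (suc k) i = ≡.trans (≡.cong₂ _+_ (Δ-geometric n k i) (Δ-geometric n k (suc i)))
  (factor n ((1 + n) ^ k) (n ^ i))
  where factor : ∀ n a b → a * b + a * (n * b) ≡ (1 + n) * a * b
        factor = solve-∀

fermat : ∀ {p} → Prime (suc p) → ∀ n → n ^ suc p ≋ n mod suc p
fermat pr zero    = ≋-refl
fermat {p} pr (suc n) = begin
  (1 + n) ^ suc p            ≡⟨ ≡.sym (≡.trans (Δ-geometric n (suc p) 0) (*-identityʳ _)) ⟩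
  Δ (suc p) (n ^_) 0         ≈⟨ frobenius pr (n ^_) ⟩
  1 + n ^ suc p              ≈⟨ ≋-+ (≋-refl {x = 1}) (fermat pr n) ⟩
  1 + n                      ∎
  where open ≋-Reasoning (suc p)

fermat′ : ∀ {p} → Prime (suc p) → ∀ {n} → ¬ (suc p ∣ n) → n ^ p ≋ 1 mod suc p
fermat′ pr {n} p∤n = ≋-*-cancelˡ n pr p∤n
  (≋-trans (fermat pr n) (≋-reflexive (≡.sym (*-identityʳ n))))

-- Iterates Nᵏ(1 , 0) of N (x , y) = (u y , x + v y), the matrix of a - 1 for an
-- automorphism a of H in the basis w , z = w⁻¹ wᵃ.
module Iterates (u v : ℕ) where

  xs ys : ℕ → ℕ
  xs zero    = 1
  xs (suc k) = u * ys k
  ys zero    = 0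
  ys (suc k) = xs k + v * ys k

  -- Together with `Δ-ys` this says that `Δ n xs k` and `Δ n ys k` are the coordinates of (1 + N)ⁿ
  -- Nᵏ (1 , 0), since 1 + N commutes with N.
  Δ-xs : ∀ n k → Δ n xs (suc k) ≡ u * Δ n ys k
  Δ-xs zero    k = ≡.refl
  Δ-xs (suc n) k = ≡.trans (≡.cong₂ _+_ (Δ-xs n k) (Δ-xs n (suc k)))
    (≡.sym (*-distribˡ-+ u (Δ n ys k) (Δ n ys (suc k))))

  Δ-ys : ∀ n k → Δ n ys (suc k) ≡ Δ n xs k + v * Δ n ys k
  Δ-ys zero    k = ≡.refl
  Δ-ys (suc n) k = ≡.trans (≡.cong₂ _+_ (Δ-ys n k) (Δ-ys n (suc k)))
    (regroup (Δ n xs k) (Δ n xs (suc k)) v (Δ n ys k) (Δ n ys (suc k)))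
    where regroup : ∀ a b v c d → a + v * c + (b + v * d) ≡ a + b + v * (c + d)
          regroup = solve-∀

  module _ {p} (pr : Prime p) where

    -- The determinant of N is -u. Were it a unit modulo p, the vanishing of an iterate could be
    -- pulled back to the start vector (1 , 0).
    det-zero : ∀ n → p ∣ xs n → p ∣ ys n → p ∣ u
    det-zero zero    px py = contradiction px (∤1 pr)
    det-zero (suc n) px py with euclidsLemma u (ys n) pr px
    ... | inj₁ p∣u = p∣u
    ... | inj₂ p∣y = det-zero n (∣m+n∣m⇒∣n (≡.subst (p ∣_) (+-comm (xs n) _) py) (∣n⇒∣m*n v p∣y)) p∣y

    -- Here v is the trace of N. Once u vanishes modulo p, the ordinate after n + 1 steps is vⁿ.
    trace-zero : p ∣ u → ∀ n → p ∣ ys (suc n) → p ∣ v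
    trace-zero p∣u zero    py = contradiction (≡.subst (p ∣_) (≡.cong (1 +_) (*-zeroʳ v)) py) (∤1 pr)
    trace-zero p∣u (suc n) py with euclidsLemma v (ys (suc n)) pr
                                     (∣m+n∣m⇒∣n py (∣m⇒∣m*n (ys n) p∣u))
    ... | inj₁ p∣v = p∣v
    ... | inj₂ p∣y = trace-zero p∣u n p∣y

  module _ {p} (p∣u : p ∣ u) (p∣v : p ∣ v) where

    p∣xs : ∀ n → p ∣ xs (1 + n)
    p∣xs n = ∣m⇒∣m*n (ys n) p∣u

    p∣ys : ∀ n → p ∣ ys (2 + n)
    p∣ys n = ∣m∣n⇒∣m+n (p∣xs n) (∣m⇒∣m*n (ys (1 + n)) p∣v)

    -- One factor p comes from u and another from the earlier ordinate. From the fourth iterate on,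
    -- both coordinates are divisible by p².
    p²∣xs : ∀ n → p * p ∣ xs (3 + n)
    p²∣xs n = *-pres-∣ p∣u (p∣ys n)

    p²∣ys : ∀ n → p * p ∣ ys (4 + n)
    p²∣ys n = ∣m∣n⇒∣m+n (p²∣xs n) (*-pres-∣ p∣v (p∣ys (1 + n)))

  -- Modulo p the p-th power of 1 + N is 1 + Nᵖ, so N is nilpotent there; then, as p ≥ 5,
  -- all terms of (1 + N)ᵖ - 1 - pN vanish modulo p².
  unipotent : ∀ {p} → Prime (suc p) → 4 ≤ p → ∀ e →
    Δ (suc p) xs 0 ≋ 1 mod (suc p ^ suc e) → Δ (suc p) ys 0 ≋ 0 mod (suc p ^ suc e) →
    (suc p ∣ u) × (suc p ∣ v) × e ≡ 0
  unipotent {p} pr 4≤p e hx hy = p∣u , p∣v , e≡0 e hy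
    where
    p∣q : suc p ∣ suc p ^ suc e
    p∣q = m∣m*n (suc p ^ e)
    p∣xₚ : suc p ∣ xs (suc p)
    p∣xₚ = ≋0⇒∣ (≋-+-cancelˡ 1 (≋-trans (≋-sym (frobenius pr xs)) (≋-weaken p∣q hx)))
    p∣yₚ : suc p ∣ ys (suc p)
    p∣yₚ = ≋0⇒∣ (≋-trans (≋-sym (frobenius pr ys)) (≋-weaken p∣q hy))
    p∣u = det-zero pr (suc p) p∣xₚ p∣yₚ
    p∣v = trace-zero pr p∣u p p∣yₚ
    p² = suc p * suc p
    -- Matching on `suc p` makes the prime `2 + p`, so the linear term, which contributes the prime
    -- itself, splits off. The middle terms get one prime factor from the binomial coefficient and
    -- one from the iterate; the last index is rewritten as 4 plus a remainder.
    high-terms : ∀ p → 4 ≤ p → (pr : Prime (suc p)) → suc p ∣ u → suc p ∣ v →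
      Δ (suc p) ys 0 ≋ suc p mod (suc p * suc p)
    high-terms (suc p) 4≤p pr p∣u p∣v = begin
      Δ (2 + p) ys 0
        ≡⟨ Δ-prime (suc p) ys ⟩
      ((2 + p) C 1) * ys 1 + Σ< p (λ i → ((2 + p) C (2 + i)) * ys (2 + i)) + ys (2 + p)
        ≈⟨ ≋-+ (≋-+ (≋-refl {x = ((2 + p) C 1) * ys 1}) (∣⇒≋0 (Σ<-∣ p λ i i<p →
             *-pres-∣ (p∣pC pr (suc i) (s≤s i<p)) (p∣ys p∣u p∣v i))))
             (∣⇒≋0 (≡.subst (λ m → (2 + p) * (2 + p) ∣ ys m) (≡.cong (_+_ 2) (m+[n∸m]≡n {2} (≤-trans (s≤s (s≤s z≤n)) (≤-pred 4≤p)))) (p²∣ys p∣u p∣v (p ∸ 2)))) ⟩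
      ((2 + p) C 1) * (1 + v * 0) + 0 + 0
        ≡⟨ ≡.cong (λ x → x * (1 + v * 0) + 0 + 0) (nC1≡n (2 + p)) ⟩
      (2 + p) * (1 + v * 0) + 0 + 0
        ≡⟨ simplify (2 + p) v ⟩
      2 + p ∎
      where
      open ≋-Reasoning ((2 + p) * (2 + p))
      simplify : ∀ a v → a * (1 + v * 0) + 0 + 0 ≡ a
      simplify = solve-∀
    e≡0 : ∀ e → Δ (suc p) ys 0 ≋ 0 mod (suc p ^ suc e) → e ≡ 0
    e≡0 zero    h = ≡.refl
    -- If P² divided q, the ordinate would be both P and 0 modulo P².
    e≡0 (suc e) h = contradiction (*-cancelˡ-∣ (suc p) p²∣p) (∤1 pr)
      where
      p²∣q : p² ∣ suc p ^ suc (suc e)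
      p²∣q = ≡.subst (p² ∣_) (*-assoc (suc p) (suc p) (suc p ^ e)) (m∣m*n (suc p ^ e))
      p²∣p : p² ∣ suc p * 1
      p²∣p = ≡.subst (p² ∣_) (≡.sym (*-identityʳ (suc p)))
        (≋0⇒∣ (≋-trans (≋-sym (high-terms p 4≤p pr p∣u p∣v)) (≋-weaken p²∣q h)))

-- Inverses and square roots of one modulo n.

abstract
  -- A missed value could be punched out of the codomain, leaving an injection into a smaller set.
  injective⇒surjective : ∀ {n} (f : Fin n → Fin n) → (∀ {i j} → f i ≡ f j → i ≡ j) →
    ∀ y → ∃ λ x → f x ≡ y
  injective⇒surjective {suc n} f inj y with any? (λ x → f x Finₚ.≟ y)
  ... | yes h = h
  ... | no ¬h = contradiction
    (injective⇒≤ {f = λ x → punchOut (y≢f x)} (λ {i} {j} e → inj (punchOut-injective (y≢f i) (y≢f j) e)))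
    (<⇒≱ (n<1+n n))
    where
    y≢f : ∀ x → y ≢ f x
    y≢f x e = ¬h (x , ≡.sym e)

abstract
  inverse-mod : ∀ {j n} → Coprime j n → ∃ λ i → i * j ≋ 1 mod n
  inverse-mod {j} {n} c with coprime-Bézout c
  ... | Bézout.+- x y e = x , shifts 0 y (≡.trans (+-identityʳ _) (≡.sym e))
  -- With this sign the Bézout coefficient satisfies x j ≡ -1, so x (x j) is an inverse of j.
  ... | Bézout.-+ x y e = x * (x * j) , (begin
    x * (x * j) * j               ≡⟨ square x j ⟩
    (x * j) * (x * j)             ≈⟨ ≋-sym one ⟩
    1                             ∎)
    where
    open ≋-Reasoning n
    square : ∀ x j → x * (x * j) * j ≡ (x * j) * (x * j)
    square = solve-∀
    zero′ : 1 + x * j ≋ 0 mod n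
    zero′ = shifts 0 y (≡.trans (+-identityʳ _) e)
    one : 1 ≋ (x * j) * (x * j) mod n
    one = ≋-+-cancelʳ (x * j) (≋-trans zero′ (≋-sym (≋-trans
      (≋-reflexive (factor (x * j))) (≋-trans (≋-* (≋-refl {x = x * j}) zero′) (≋-reflexive (*-zeroʳ (x * j)))))))
      where factor : ∀ a → a * a + a ≡ a * (1 + a)
            factor = solve-∀

square-root-of-one : ∀ {p} → Prime p → ∀ x → x * x ≋ 1 mod p → x ≋ 1 mod p ⊎ 1 + x ≋ 0 mod p
square-root-of-one     pr zero    h = contradiction (≋0⇒∣ (≋-sym h)) (∤1 pr)
square-root-of-one {p} pr (suc x) h = [ (λ d → inj₁ (≋-+ (≋-refl {x = 1}) (∣⇒≋0 d))) , (λ d → inj₂ (∣⇒≋0 d)) ]′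
  (euclidsLemma x (2 + x) pr (≋0⇒∣ (≋-+-cancelˡ 1 (≋-trans (≋-reflexive (square x)) h))))
  where
  square : ∀ x → 1 + x * (2 + x) ≡ suc x * suc x
  square = solve-∀

-- Primitive roots and discrete logarithms.

module PrimitiveRoot {p t : ℕ} (pr : Prime (suc p)) (root : IsPrimitiveRoot (suc p) t) where

  private
    1≤t = proj₁ root
    t<p = proj₁ (proj₂ root)

  instance
    p≢0 : NonZero p
    p≢0 = >-nonZero (≤-trans 1≤t (≤-pred t<p))

  ∤t : ¬ (suc p ∣ t)
  ∤t d = <⇒≱ t<p (∣⇒≤ {{>-nonZero 1≤t}} d)

  t^p : t ^ p ≋ 1 mod suc p
  t^p = fermat′ pr ∤t

  t^p* : ∀ k → t ^ (p * k) ≋ 1 mod suc p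
  t^p* k = ≋-trans (≋-reflexive (≡.sym (^-*-assoc t p k)))
    (≋-trans (≋-^ k t^p) (≋-reflexive (^-zeroˡ k)))

  t^-cong : ∀ {a b} → a ≋ b mod p → t ^ a ≋ t ^ b mod suc p
  t^-cong {a} {b} (shifts l r e) = ≋-trans (≋-sym (drop a l))
    (≋-trans (≋-reflexive (≡.cong (t ^_) e)) (drop b r))
    where
    drop : ∀ a l → t ^ (a + l * p) ≋ t ^ a mod suc p
    drop a l = ≋-trans (≋-reflexive (≡.trans (^-distribˡ-+-* t a (l * p)) (≡.cong (λ x → t ^ a * t ^ x) (*-comm l p))))
      (≋-trans (≋-* (≋-refl {x = t ^ a}) (t^p* l)) (≋-reflexive (*-identityʳ (t ^ a))))

  -- The exponent may be replaced by its remainder modulo p, and a nonzero remainder would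
  -- contradict primitivity.
  t^≋1⇒ : ∀ d → t ^ d ≋ 1 mod suc p → d ≋ 0 mod p
  t^≋1⇒ d h = ≋-trans (≋-sym (≋-% d)) (≋-reflexive (small (d % p) (m%n<n d p) (≋-trans (t^-cong (≋-% d)) h)))
    where
    small : ∀ r → r < p → t ^ r ≋ 1 mod suc p → r ≡ 0
    small zero    _   _ = ≡.refl
    small (suc r) r<p h = contradiction (≋⇒∣∸ (m^n>0 t {{>-nonZero 1≤t}} (suc r)) (≋-sym h))
      (proj₂ (proj₂ root) (suc r) (s≤s z≤n) r<p)

  t^-inj : ∀ {a b} → t ^ a ≋ t ^ b mod suc p → a ≋ b mod p
  t^-inj {a} {b} = ≤-wlog {p} {λ a b → t ^ a ≋ t ^ b mod suc p → a ≋ b mod p} (λ h e → ≋-sym (h (≋-sym e))) go a b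
    where
    go : ∀ a b → a ≤ b → t ^ a ≋ t ^ b mod suc p → a ≋ b mod p
    go a b a≤b e = ≋-trans (≋-+ (≋-sym (t^≋1⇒ (b ∸ a) one)) (≋-refl {x = a})) (≋-reflexive (m∸n+n≡m a≤b))
      where
      one : t ^ (b ∸ a) ≋ 1 mod suc p
      one = ≋-*-cancelˡ (t ^ a) pr (∤^ pr ∤t a) (≋-trans
        (≋-reflexive (≡.trans (≡.sym (^-distribˡ-+-* t a (b ∸ a))) (≡.cong (t ^_) (m+[n∸m]≡n a≤b))))
        (≋-trans (≋-sym e) (≋-reflexive (≡.sym (*-identityʳ (t ^ a))))))

  abstract
    -- Zero and the p powers of t are `suc p` distinct residues, hence all of them; zero is included
    -- only to make domain and codomain equal.
    discrete-log : ∀ s → ¬ (suc p ∣ s) → ∃ λ j → j < p × s ≋ t ^ j mod suc p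
    discrete-log s p∤s with injective⇒surjective f f-inj (fromℕ< (m%n<n s (suc p)))
      where
      f : Fin (suc p) → Fin (suc p)
      f Fin.zero    = Fin.zero
      f (Fin.suc k) = fromℕ< (m%n<n (t ^ toℕ k) (suc p))
      f≢0 : ∀ k → ¬ (f (Fin.suc k) ≡ Fin.zero)
      f≢0 k e = ∤^ pr ∤t (toℕ k) (≋0⇒∣ (≋-trans (≋-sym (≋-% (t ^ toℕ k)))
        (≋-reflexive (≡.trans (≡.sym (toℕ-fromℕ< _)) (≡.cong toℕ e)))))
      f-inj : ∀ {i j} → f i ≡ f j → i ≡ j
      f-inj {Fin.zero}  {Fin.zero}  e = ≡.refl
      f-inj {Fin.zero}  {Fin.suc j} e = contradiction (≡.sym e) (f≢0 j)
      f-inj {Fin.suc i} {Fin.zero}  e = contradiction e (f≢0 i)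
      f-inj {Fin.suc i} {Fin.suc j} e = ≡.cong Fin.suc (toℕ-injective (≋⇒≡ (toℕ<n i) (toℕ<n j) (t^-inj
        (≋-trans (≋-sym (≋-% (t ^ toℕ i))) (≋-trans (≋-reflexive
          (≡.trans (≡.sym (toℕ-fromℕ< _)) (≡.trans (≡.cong toℕ e) (toℕ-fromℕ< _)))) (≋-% (t ^ toℕ j)))))))
    ... | Fin.zero  , e = contradiction (≋0⇒∣ (≋-trans (≋-sym (≋-% s))
            (≋-reflexive (≡.trans (≡.sym (toℕ-fromℕ< _)) (≡.cong toℕ (≡.sym e)))))) p∤s
    ... | Fin.suc k , e = toℕ k , toℕ<n k , ≋-trans (≋-sym (≋-% s)) (≋-trans (≋-reflexive
            (≡.trans (≡.sym (toℕ-fromℕ< _)) (≡.trans (≡.cong toℕ (≡.sym e)) (toℕ-fromℕ< _)))) (≋-% (t ^ toℕ k)))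

  -- The power is a square root of 1, and it is not 1 because M lies strictly between 0 and the
  -- order of t.
  half-power : ∀ M → p ≡ 2 * M → 1 + t ^ M ≋ 0 mod suc p
  half-power zero    e = contradiction e (≢-nonZero⁻¹ p)
  half-power (suc M) e = [ (λ h → contradiction (≋0⇒∣ (t^≋1⇒ (suc M) h))
      (λ p∣M → <⇒≱ (≡.subst (suc M <_) (≡.sym e) (m<m+n (suc M) (s≤s z≤n))) (∣⇒≤ p∣M)))
    , (λ h → h) ]′ (square-root-of-one pr (t ^ suc M) (≋-trans (≋-reflexive (begin
      t ^ suc M * t ^ suc M ≡⟨ ≡.sym (^-distribˡ-+-* t (suc M) (suc M)) ⟩
      t ^ (suc M + suc M)   ≡⟨ ≡.cong (λ x → t ^ (suc M + x)) (≡.sym (+-identityʳ (suc M))) ⟩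
      t ^ (2 * suc M)       ≡⟨ ≡.cong (t ^_) (≡.sym e) ⟩
      t ^ p                 ∎)) t^p))
    where open ≡.≡-Reasoning

-- Periodic sequences

module Orbit {N : ℕ} (F : ℕ → Fin N)
  (fwd : ∀ k l → F k ≡ F l → F (suc k) ≡ F (suc l))
  (bwd : ∀ k l → F (suc k) ≡ F (suc l) → F k ≡ F l) where

  shift : ∀ c {k l} → F k ≡ F l → F (c + k) ≡ F (c + l)
  shift zero    e = e
  shift (suc c) e = fwd _ _ (shift c e)

  unshift : ∀ c {k l} → F (c + k) ≡ F (c + l) → F k ≡ F l
  unshift zero    e = e
  unshift (suc c) e = unshift c (bwd _ _ e)

  periodic : ∀ {d} → F d ≡ F 0 → ∀ m → F (m * d) ≡ F 0
  periodic     e zero    = ≡.refl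
  periodic {d} e (suc m) = ≡.trans (shift d (periodic e m)) (≡.trans (≡.cong F (+-identityʳ d)) e)

  periodic-≋ : ∀ {d} → F d ≡ F 0 → ∀ {k l} → k ≋ l mod d → F k ≡ F l
  periodic-≋ {d} e {k} {l} (shifts a b eq) = ≡.trans (≡.sym (drop k a)) (≡.trans (≡.cong F eq) (drop l b))
    where
    drop : ∀ k a → F (k + a * d) ≡ F k
    drop k a = ≡.trans (shift k (periodic e a)) (≡.cong F (+-identityʳ k))

  -- A sequence with values in `Fin N` always has a period at most N, so this lower bound says that
  -- it runs through one N-cycle.
  Least : Set
  Least = ∀ d → 1 ≤ d → F d ≡ F 0 → N ≤ d

  -- With period d, indices below d already produce every value.
  surjective⇒least : (∀ i → ∃ λ k → F k ≡ i) → Least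
  surjective⇒least surj d@(suc _) _ e = injective⇒≤ {f = λ i → fromℕ< (m%n<n (proj₁ (surj i)) d)} inj
    where
    value : ∀ i → F (proj₁ (surj i) % d) ≡ i
    value i = ≡.trans (periodic-≋ e (≋-% _)) (proj₂ (surj i))
    inj : ∀ {i j} → fromℕ< (m%n<n (proj₁ (surj i)) d) ≡ fromℕ< (m%n<n (proj₁ (surj j)) d) → i ≡ j
    inj {i} {j} eq = ≡.trans (≡.sym (value i)) (≡.trans
      (≡.cong F (≡.trans (≡.sym (toℕ-fromℕ< _)) (≡.trans (≡.cong toℕ eq) (toℕ-fromℕ< _)))) (value j))

  module Full (least : Least) where

    private
      gap : ∀ {k l} → k ≤ l → F k ≡ F l → F (l ∸ k) ≡ F 0
      gap {k} {l} k≤l e = unshift k (≡.trans (≡.cong F (m+[n∸m]≡n k≤l)) (≡.trans (≡.sym e) (≡.cong F (≡.sym (+-identityʳ k)))))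

    abstract
      -- Among the first N + 1 terms two agree; their distance is a period at most N, and the bound
      -- from below makes it equal to N.
      full-period : F N ≡ F 0
      full-period with i , j , i<j , e ← pigeonhole (n<1+n N) (F ∘ toℕ)
        = ≡.subst (λ d → F d ≡ F 0)
            (≤-antisym (≤-trans (m∸n≤m (toℕ j) (toℕ i)) (≤-pred (toℕ<n j)))
                       (least _ (m<n⇒0<n∸m i<j) (gap (<⇒≤ i<j) e)))
            (gap (<⇒≤ i<j) e)

    abstract
      small-injective : ∀ {k l} → k < N → l < N → F k ≡ F l → k ≡ l
      small-injective {k} {l} = ≤-wlog {N} {λ k l → k < N → l < N → F k ≡ F l → k ≡ l}
        (λ h a b e → ≡.sym (h b a (≡.sym e))) go k l
        where
        zero-gap : ∀ d → d < N → F d ≡ F 0 → d ≡ 0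
        zero-gap zero    _   _ = ≡.refl
        zero-gap (suc d) d<N e = contradiction (least (suc d) (s≤s z≤n) e) (<⇒≱ d<N)
        go : ∀ k l → k ≤ l → k < N → l < N → F k ≡ F l → k ≡ l
        go k l k≤l _ l<N e = ≤-antisym k≤l
          (m∸n≡0⇒m≤n (zero-gap (l ∸ k) (≤-<-trans (m∸n≤m l k) l<N) (gap k≤l e)))

    instance
      N≢0 : NonZero N
      N≢0 = >-nonZero (≤-<-trans z≤n (toℕ<n (F 0)))

    ≋⇒F : ∀ {k l} → k ≋ l mod N → F k ≡ F l
    ≋⇒F = periodic-≋ full-period

    F⇒≋ : ∀ {k l} → F k ≡ F l → k ≋ l mod N
    F⇒≋ {k} {l} e = ≋-trans (≋-sym (≋-% k)) (≋-trans (≋-reflexive (small-injective (m%n<n k N) (m%n<n l N)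
      (≡.trans (≋⇒F (≋-% k)) (≡.trans e (≡.sym (≋⇒F (≋-% l))))))) (≋-% l))

    abstract
      hit : ∀ i → ∃ λ k → k < N × F k ≡ i
      hit i with k , e ← injective⇒surjective (F ∘ toℕ) (λ e → toℕ-injective (small-injective (toℕ<n _) (toℕ<n _) e)) i
        = toℕ k , toℕ<n k , e

coprime-* : ∀ {a m n} → Coprime a m → Coprime a n → Coprime a (m * n)
coprime-* {a} {m} {n} cm cn {d} (d∣a , d∣mn) =
  cn (d∣a , coprime-divisor {d} {m} (λ (x , y) → cm (∣-trans x d∣a , y)) d∣mn)

coprime-^ : ∀ {a m} → Coprime a m → ∀ e → Coprime a (m ^ e)
coprime-^ c zero    = λ (_ , d∣1) → ∣1⇒≡1 d∣1
coprime-^ c (suc e) = coprime-* c (coprime-^ c e)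

<prime⇒coprime : ∀ {p} → Prime p → ∀ {d} → 1 ≤ d → d < p → Coprime d p
<prime⇒coprime pr 1≤d d<p = Coprimality.sym (prime⇒coprime pr {{>-nonZero 1≤d}} d<p)

-- A period d < p would be invertible modulo pᵉ; combined with the period pᵉ it would make 1 a
-- period.
prime-power-period : ∀ {p} → Prime p → (F : ℕ → Fin p)
  (fwd : ∀ k l → F k ≡ F l → F (suc k) ≡ F (suc l))
  (bwd : ∀ k l → F (suc k) ≡ F (suc l) → F k ≡ F l) →
  ∀ e → F (p ^ e) ≡ F 0 → F 1 ≢ F 0 → Orbit.Least F fwd bwd
prime-power-period {p} pr F fwd bwd e Fq F1 d 1≤d Fd with p ≤? d
... | yes p≤d = p≤d
... | no  p≰d with i , h ← inverse-mod (coprime-^ (<prime⇒coprime pr 1≤d (≰⇒> p≰d)) e)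
  = contradiction (≡.trans (≡.sym (periodic-≋ Fq h)) (periodic Fd i)) F1
  where open Orbit F fwd bwd

-- The binomial coefficient n(n - 1)/2 without division: it counts the commutators that arise when
-- an n-th power is collected in a group of class two.
triangle : ℕ → ℕ
triangle zero    = 0
triangle (suc n) = n + triangle n

double-triangle : ∀ n → 2 * triangle (suc n) ≡ n * suc n
double-triangle zero    = ≡.refl
double-triangle (suc n) = ≡.trans (expand n (triangle (suc n)))
  (≡.trans (≡.cong (2 * suc n +_) (double-triangle n)) (collect n))
  where
  expand : ∀ n x → 2 * (suc n + x) ≡ 2 * suc n + 2 * x
  expand = solve-∀
  collect : ∀ n → 2 * suc n + n * suc n ≡ suc n * suc (suc n)
  collect = solve-∀

p∣triangle : ∀ {p} → Prime (suc p) → 2 ≤ p → suc p ∣ triangle (suc p)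
p∣triangle {p} pr 2≤p = [ (λ h → contradiction (∣⇒≤ h) (<⇒≱ (s≤s 2≤p))) , (λ h → h) ]′
  (euclidsLemma 2 (triangle (suc p)) pr (≡.subst (suc p ∣_) (≡.sym (double-triangle p)) (n∣m*n p)))

-- Conjugation calculus and Heisenberg groups.

module GroupLemmas (G : Group 0ℓ 0ℓ) where

  open Group G
  open GroupProperties G
  open SetoidReasoning setoid

  infixr 8 _↑_
  _↑_ : Carrier → ℕ → Carrier
  _↑_ = pow G

  ↑-cong : ∀ {x y} n → x ≈ y → x ↑ n ≈ y ↑ n
  ↑-cong zero    e = refl
  ↑-cong (suc n) e = ∙-cong e (↑-cong n e)

  ↑-≡ : ∀ x {m n} → m ≡ n → x ↑ m ≈ x ↑ n
  ↑-≡ x ≡.refl = refl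

  ε-↑ : ∀ n → ε ↑ n ≈ ε
  ε-↑ zero    = refl
  ε-↑ (suc n) = trans (identityˡ _) (ε-↑ n)

  ↑-1 : ∀ x → x ↑ 1 ≈ x
  ↑-1 = identityʳ

  ↑-+ : ∀ x m n → x ↑ (m + n) ≈ x ↑ m ∙ x ↑ n
  ↑-+ x zero    n = sym (identityˡ _)
  ↑-+ x (suc m) n = trans (∙-congˡ (↑-+ x m n)) (sym (assoc _ _ _))

  ↑-* : ∀ x m n → x ↑ (m * n) ≈ (x ↑ n) ↑ m
  ↑-* x zero    n = refl
  ↑-* x (suc m) n = trans (↑-+ x n (m * n)) (∙-congˡ (↑-* x m n))

  ↑-*′ : ∀ x m n → x ↑ (m * n) ≈ (x ↑ m) ↑ n
  ↑-*′ x m n = trans (↑-≡ x (*-comm m n)) (↑-* x n m)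

  ↑-suc : ∀ x n → x ↑ suc n ≈ x ↑ n ∙ x
  ↑-suc x n = trans (↑-≡ x (+-comm 1 n)) (trans (↑-+ x n 1) (∙-congˡ (↑-1 x)))

  ε≈↑ : ∀ {x n} k → x ↑ n ≈ ε → x ↑ (k * n) ≈ ε
  ε≈↑ {x} {n} k e = trans (↑-* x k n) (trans (↑-cong k e) (ε-↑ k))

  ↑-mod : ∀ {x n a b} → x ↑ n ≈ ε → a ≋ b mod n → x ↑ a ≈ x ↑ b
  ↑-mod {x} {n} {a} {b} e (shifts l r eq) = begin
    x ↑ a               ≈⟨ drop a l ⟨
    x ↑ (a + l * n)     ≈⟨ ↑-≡ x eq ⟩
    x ↑ (b + r * n)     ≈⟨ drop b r ⟩
    x ↑ b               ∎
    where
    drop : ∀ a l → x ↑ (a + l * n) ≈ x ↑ a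
    drop a l = trans (↑-+ x a (l * n)) (trans (∙-congˡ (ε≈↑ l e)) (identityʳ _))

  -- A conjugation x^u = x′ is recorded as `x ∙ u ≈ u ∙ x′`, so that such relations compose without
  -- inverses. This is multiplicativity of conjugation in that form.
  slide-∙ : ∀ {x x′ y y′ u} → x ∙ u ≈ u ∙ x′ → y ∙ u ≈ u ∙ y′ → (x ∙ y) ∙ u ≈ u ∙ (x′ ∙ y′)
  slide-∙ {x} {x′} {y} {y′} {u} e f = begin
    (x ∙ y) ∙ u   ≈⟨ assoc x y u ⟩
    x ∙ (y ∙ u)   ≈⟨ ∙-congˡ f ⟩
    x ∙ (u ∙ y′)  ≈⟨ assoc x u y′ ⟨
    (x ∙ u) ∙ y′  ≈⟨ ∙-congʳ e ⟩
    (u ∙ x′) ∙ y′ ≈⟨ assoc u x′ y′ ⟩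
    u ∙ (x′ ∙ y′) ∎

  slide-ε : ∀ {u} → ε ∙ u ≈ u ∙ ε
  slide-ε {u} = trans (identityˡ u) (sym (identityʳ u))

  slide-↑ : ∀ {x x′ u} n → x ∙ u ≈ u ∙ x′ → x ↑ n ∙ u ≈ u ∙ x′ ↑ n
  slide-↑ zero    e = slide-ε
  slide-↑ (suc n) e = slide-∙ e (slide-↑ n e)

  slide-⁻¹ : ∀ {x x′ u} → x ∙ u ≈ u ∙ x′ → x ⁻¹ ∙ u ≈ u ∙ x′ ⁻¹
  slide-⁻¹ {x} {x′} {u} e = begin
    x ⁻¹ ∙ u                         ≈⟨ identityʳ _ ⟨
    (x ⁻¹ ∙ u) ∙ ε                   ≈⟨ ∙-congˡ (inverseʳ x′) ⟨
    (x ⁻¹ ∙ u) ∙ (x′ ∙ x′ ⁻¹)        ≈⟨ solveᴹ monoid ⟩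
    (x ⁻¹ ∙ (u ∙ x′)) ∙ x′ ⁻¹        ≈⟨ ∙-congʳ (∙-congˡ e) ⟨
    (x ⁻¹ ∙ (x ∙ u)) ∙ x′ ⁻¹         ≈⟨ solveᴹ monoid ⟩
    (x ⁻¹ ∙ x) ∙ (u ∙ x′ ⁻¹)         ≈⟨ ∙-congʳ (inverseˡ x) ⟩
    ε ∙ (u ∙ x′ ⁻¹)                  ≈⟨ identityˡ _ ⟩
    u ∙ x′ ⁻¹                        ∎

  slide-trans : ∀ {x x′ x″ u v} → x ∙ u ≈ u ∙ x′ → x′ ∙ v ≈ v ∙ x″ → x ∙ (u ∙ v) ≈ (u ∙ v) ∙ x″
  slide-trans {x} {x′} {x″} {u} {v} e f = begin
    x ∙ (u ∙ v)   ≈⟨ assoc x u v ⟨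
    (x ∙ u) ∙ v   ≈⟨ ∙-congʳ e ⟩
    (u ∙ x′) ∙ v  ≈⟨ assoc u x′ v ⟩
    u ∙ (x′ ∙ v)  ≈⟨ ∙-congˡ f ⟩
    u ∙ (v ∙ x″)  ≈⟨ assoc u v x″ ⟨
    (u ∙ v) ∙ x″  ∎

  -- Two computations of the same conjugate may be equated; most relations in the classification
  -- arise in this way.
  slide-unique : ∀ {x y y′ u} → x ∙ u ≈ u ∙ y → x ∙ u ≈ u ∙ y′ → y ≈ y′
  slide-unique {u = u} e f = ∙-cancelˡ u _ _ (trans (sym e) f)

  comm-↑ : ∀ {x y} m n → x ∙ y ≈ y ∙ x → x ↑ m ∙ y ↑ n ≈ y ↑ n ∙ x ↑ m
  comm-↑ m n e = slide-↑ m (sym (slide-↑ n (sym e)))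

  ∙-↑ : ∀ {x y} n → x ∙ y ≈ y ∙ x → (x ∙ y) ↑ n ≈ x ↑ n ∙ y ↑ n
  ∙-↑ zero e = sym (identityˡ ε)
  ∙-↑ {x} {y} (suc n) e = begin
    (x ∙ y) ∙ (x ∙ y) ↑ n     ≈⟨ ∙-congˡ (∙-↑ n e) ⟩
    (x ∙ y) ∙ (x ↑ n ∙ y ↑ n) ≈⟨ solveᴹ monoid ⟩
    x ∙ ((y ∙ x ↑ n) ∙ y ↑ n) ≈⟨ ∙-congˡ (∙-congʳ (sym (slide-↑ n e))) ⟩
    x ∙ ((x ↑ n ∙ y) ∙ y ↑ n) ≈⟨ solveᴹ monoid ⟩
    (x ∙ x ↑ n) ∙ (y ∙ y ↑ n) ∎

  slide⇒conj : ∀ {x u y} → x ∙ u ≈ u ∙ y → conj G x u ≈ y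
  slide⇒conj {x} {u} {y} e = begin
    (u ⁻¹ ∙ x) ∙ u  ≈⟨ assoc _ _ _ ⟩
    u ⁻¹ ∙ (x ∙ u)  ≈⟨ ∙-congˡ e ⟩
    u ⁻¹ ∙ (u ∙ y)  ≈⟨ assoc _ _ _ ⟨
    (u ⁻¹ ∙ u) ∙ y  ≈⟨ ∙-congʳ (inverseˡ u) ⟩
    ε ∙ y           ≈⟨ identityˡ y ⟩
    y               ∎

  slide-conj : ∀ x u → x ∙ u ≈ u ∙ conj G x u
  slide-conj x u = begin
    x ∙ u                ≈⟨ identityˡ _ ⟨
    ε ∙ (x ∙ u)          ≈⟨ ∙-congʳ (inverseʳ u) ⟨
    (u ∙ u ⁻¹) ∙ (x ∙ u) ≈⟨ solveᴹ monoid ⟩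
    u ∙ ((u ⁻¹ ∙ x) ∙ u) ∎

  conj⇒slide : ∀ {x u y} → conj G x u ≈ y → x ∙ u ≈ u ∙ y
  conj⇒slide {x} {u} e = trans (slide-conj x u) (∙-congˡ e)

  slide-comm : ∀ x u → x ∙ u ≈ u ∙ (x ∙ comm G x u)
  slide-comm x u = begin
    x ∙ u                                        ≈⟨ slide-conj x u ⟩
    u ∙ ((u ⁻¹ ∙ x) ∙ u)                         ≈⟨ ∙-congˡ (identityˡ _) ⟨
    u ∙ (ε ∙ ((u ⁻¹ ∙ x) ∙ u))                   ≈⟨ ∙-congˡ (∙-congʳ (inverseʳ x)) ⟨
    u ∙ ((x ∙ x ⁻¹) ∙ ((u ⁻¹ ∙ x) ∙ u))          ≈⟨ solveᴹ monoid ⟩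
    u ∙ (x ∙ (((x ⁻¹ ∙ u ⁻¹) ∙ x) ∙ u))          ∎

  commute⇒comm : ∀ {x y} → x ∙ y ≈ y ∙ x → comm G x y ≈ ε
  commute⇒comm {x} {y} e = ∙-cancelˡ x _ _ (trans (slide-unique (slide-comm x y) e) (sym (identityʳ x)))

  comm⇒commute : ∀ {x y} → comm G x y ≈ ε → x ∙ y ≈ y ∙ x
  comm⇒commute {x} {y} e = trans (slide-comm x y) (∙-congˡ (trans (∙-congˡ e) (identityʳ x)))

  slide-power : ∀ {x g t} k m → x ∙ g ≈ g ∙ x ↑ t → x ↑ k ∙ g ↑ m ≈ g ↑ m ∙ x ↑ (k * t ^ m)
  slide-power {x} {g} {t} k zero e = trans (sym slide-ε) (∙-congˡ (↑-≡ x (≡.sym (*-identityʳ k))))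
  slide-power {x} {g} {t} k (suc m) e = trans (slide-trans
    (trans (slide-↑ k e) (∙-congˡ (sym (↑-* x k t)))) (slide-power (k * t) m e))
    (∙-congˡ (↑-≡ x (*-assoc k t (t ^ m))))

  record G₂Slides (p t : ℕ) (w z c g : Carrier) : Set where
    field
      w-order : w ↑ suc p ≈ ε
      z-order : z ↑ suc p ≈ ε
      c-order : c ↑ suc p ≈ ε
      g-order : g ↑ p ≈ ε
      wz : w ∙ z ≈ z ∙ w
      cg : c ∙ g ≈ g ∙ c ↑ t
      wc : w ∙ c ≈ c ∙ (w ∙ z)
      zc : z ∙ c ≈ c ∙ z
      wg : w ∙ g ≈ g ∙ w
      zg : z ∙ g ≈ g ∙ z ↑ t

  relations⇒slides : ∀ {p t w z c g} → G₂Relations G (suc p) t w z c g → G₂Slides p t w z c g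
  relations⇒slides (rw , rz , rc , rg , rwz , rcg , rwc , rzc , rwg , rzg) = record
    { w-order = rw ; z-order = rz ; c-order = rc ; g-order = rg ; wz = comm⇒commute rwz
    ; cg = conj⇒slide rcg ; wc = conj⇒slide rwc ; zc = conj⇒slide rzc
    ; wg = conj⇒slide rwg ; zg = conj⇒slide rzg }

  slides⇒relations : ∀ {p t w z c g} → G₂Slides p t w z c g → G₂Relations G (suc p) t w z c g
  slides⇒relations r = w-order , z-order , c-order , g-order , commute⇒comm wz ,
    slide⇒conj cg , slide⇒conj wc , slide⇒conj zc , slide⇒conj wg , slide⇒conj zg
    where open G₂Slides r

  -- The relations make z the commutator of w and c and central in the group they generate, a
  -- quotient of the integral Heisenberg group.
  module Heisenberg {w z c : Carrier} (wz : w ∙ z ≈ z ∙ w) (wc : w ∙ c ≈ c ∙ (w ∙ z)) (zc : z ∙ c ≈ c ∙ z) where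

    w↑c↑ : ∀ i l → w ↑ i ∙ c ↑ l ≈ c ↑ l ∙ (w ↑ i ∙ z ↑ (i * l))
    w↑c↑ i zero = trans (trans (identityʳ _) (sym (identityʳ _))) (trans (∙-congˡ (↑-≡ z (≡.sym (*-zeroʳ i)))) (sym (identityˡ _)))
    w↑c↑ i (suc l) = begin
      w ↑ i ∙ (c ∙ c ↑ l)                     ≈⟨ assoc _ _ _ ⟨
      (w ↑ i ∙ c) ∙ c ↑ l                     ≈⟨ ∙-congʳ (trans (slide-↑ i wc) (∙-congˡ (∙-↑ i wz))) ⟩
      (c ∙ (w ↑ i ∙ z ↑ i)) ∙ c ↑ l           ≈⟨ solveᴹ monoid ⟩
      c ∙ (w ↑ i ∙ (z ↑ i ∙ c ↑ l))           ≈⟨ ∙-congˡ (∙-congˡ (comm-↑ i l zc)) ⟩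
      c ∙ (w ↑ i ∙ (c ↑ l ∙ z ↑ i))           ≈⟨ solveᴹ monoid ⟩
      c ∙ ((w ↑ i ∙ c ↑ l) ∙ z ↑ i)           ≈⟨ ∙-congˡ (∙-congʳ (w↑c↑ i l)) ⟩
      c ∙ ((c ↑ l ∙ (w ↑ i ∙ z ↑ (i * l))) ∙ z ↑ i) ≈⟨ solveᴹ monoid ⟩
      (c ∙ c ↑ l) ∙ (w ↑ i ∙ (z ↑ (i * l) ∙ z ↑ i)) ≈⟨ ∙-congˡ (∙-congˡ (sym (↑-+ z (i * l) i))) ⟩
      c ↑ suc l ∙ (w ↑ i ∙ z ↑ (i * l + i))   ≈⟨ ∙-congˡ (∙-congˡ (↑-≡ z (distr i l))) ⟩
      c ↑ suc l ∙ (w ↑ i ∙ z ↑ (i * suc l))   ∎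
      where
      distr : ∀ i l → i * l + i ≡ i * suc l
      distr = solve-∀

    h : ℕ → ℕ → ℕ → Carrier
    h l i k = c ↑ l ∙ (w ↑ i ∙ z ↑ k)

    h-∙ : ∀ l i k l′ i′ k′ → h l i k ∙ h l′ i′ k′ ≈ h (l + l′) (i + i′) (k + i * l′ + k′)
    h-∙ l i k l′ i′ k′ = begin
      (c ↑ l ∙ (w ↑ i ∙ z ↑ k)) ∙ (c ↑ l′ ∙ (w ↑ i′ ∙ z ↑ k′))
        ≈⟨ solveᴹ monoid ⟩
      (c ↑ l ∙ w ↑ i) ∙ ((z ↑ k ∙ c ↑ l′) ∙ (w ↑ i′ ∙ z ↑ k′))
        ≈⟨ ∙-congˡ (∙-congʳ (comm-↑ k l′ zc)) ⟩
      (c ↑ l ∙ w ↑ i) ∙ ((c ↑ l′ ∙ z ↑ k) ∙ (w ↑ i′ ∙ z ↑ k′))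
        ≈⟨ solveᴹ monoid ⟩
      c ↑ l ∙ ((w ↑ i ∙ c ↑ l′) ∙ (z ↑ k ∙ (w ↑ i′ ∙ z ↑ k′)))
        ≈⟨ ∙-congˡ (∙-congʳ (w↑c↑ i l′)) ⟩
      c ↑ l ∙ ((c ↑ l′ ∙ (w ↑ i ∙ z ↑ (i * l′))) ∙ (z ↑ k ∙ (w ↑ i′ ∙ z ↑ k′)))
        ≈⟨ solveᴹ monoid ⟩
      (c ↑ l ∙ c ↑ l′) ∙ (w ↑ i ∙ (((z ↑ (i * l′) ∙ z ↑ k) ∙ w ↑ i′) ∙ z ↑ k′))
        ≈⟨ ∙-cong (sym (↑-+ c l l′)) (∙-congˡ (∙-congʳ (trans
             (∙-congʳ (sym (↑-+ z (i * l′) k))) (comm-↑ (i * l′ + k) i′ (sym wz))))) ⟩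
      c ↑ (l + l′) ∙ (w ↑ i ∙ ((w ↑ i′ ∙ z ↑ (i * l′ + k)) ∙ z ↑ k′))
        ≈⟨ solveᴹ monoid ⟩
      c ↑ (l + l′) ∙ ((w ↑ i ∙ w ↑ i′) ∙ (z ↑ (i * l′ + k) ∙ z ↑ k′))
        ≈⟨ ∙-congˡ (∙-cong (sym (↑-+ w i i′)) (trans (sym (↑-+ z (i * l′ + k) k′))
             (↑-≡ z (≡.cong (_+ k′) (+-comm (i * l′) k))))) ⟩
      c ↑ (l + l′) ∙ (w ↑ (i + i′) ∙ z ↑ (k + i * l′ + k′)) ∎

    -- Collecting the n factors moves cˡ past wⁱ once for every pair of factors, and each passage
    -- leaves z to the power i l.
    h-↑ : ∀ l i k n → h l i k ↑ n ≈ h (n * l) (n * i) (n * k + triangle n * (i * l))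
    h-↑ l i k zero    = sym (trans (identityˡ _) (identityˡ _))
    h-↑ l i k (suc n) = trans (∙-congˡ (h-↑ l i k n)) (trans (h-∙ l i k (n * l) (n * i) _)
      (∙-congˡ (∙-congˡ (↑-≡ z (collect k i n l (triangle n))))))
      where
      collect : ∀ k i n l T → k + i * (n * l) + (n * k + T * (i * l)) ≡ k + n * k + (n + T) * (i * l)
      collect = solve-∀

-- The group G₂(p)

-- ⟨ m , l , i , k ⟩ stands for gᵐ cˡ wⁱ zᵏ.
record Coord : Set where
  no-eta-equality
  pattern
  constructor ⟨_,_,_,_⟩
  field
    m l i k : ℕ

module Model {p t : ℕ} (pr : Prime (suc p)) (root : IsPrimitiveRoot (suc p) t) where

  open PrimitiveRoot pr root public

  infix 4 _≈ᴷ_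
  record _≈ᴷ_ (x y : Coord) : Set where
    constructor coords
    private
      module x = Coord x
      module y = Coord y
    field
      m≋ : x.m ≋ y.m mod p
      l≋ : x.l ≋ y.l mod suc p
      i≋ : x.i ≋ y.i mod suc p
      k≋ : x.k ≋ y.k mod suc p
  open _≈ᴷ_ public

  infixl 7 _·_
  -- Moving g to the power m′ to the left multiplies the exponents of c and z by its power of t;
  -- moving c to the power l′ past wⁱ then creates z to the power i l′.
  _·_ : Coord → Coord → Coord
  ⟨ m , l , i , k ⟩ · ⟨ m′ , l′ , i′ , k′ ⟩ =
    ⟨ m + m′ , l * t ^ m′ + l′ , i + i′ , k * t ^ m′ + i * l′ + k′ ⟩

  1ᴷ : Coord
  1ᴷ = ⟨ 0 , 0 , 0 , 0 ⟩

  -- Multiplication by p ∸ 1 and by p is negation modulo p and p + 1 respectively.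
  infix 8 _⁻¹ᴷ
  _⁻¹ᴷ : Coord → Coord
  ⟨ m , l , i , k ⟩ ⁻¹ᴷ = ⟨ m′ , l′ , p * i , p * (k * t ^ m′ + i * l′) ⟩
    where
    m′ = (p ∸ 1) * m
    l′ = p * (l * t ^ m′)

  ≈ᴷ-refl : ∀ {x} → x ≈ᴷ x
  ≈ᴷ-refl = coords ≋-refl ≋-refl ≋-refl ≋-refl

  ≈ᴷ-reflexive : ∀ {x y} → x ≡ y → x ≈ᴷ y
  ≈ᴷ-reflexive ≡.refl = ≈ᴷ-refl

  ≈ᴷ-sym : ∀ {x y} → x ≈ᴷ y → y ≈ᴷ x
  ≈ᴷ-sym (coords a b c d) = coords (≋-sym a) (≋-sym b) (≋-sym c) (≋-sym d)

  ≈ᴷ-trans : ∀ {x y z} → x ≈ᴷ y → y ≈ᴷ z → x ≈ᴷ z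
  ≈ᴷ-trans (coords a b c d) (coords a′ b′ c′ d′) =
    coords (≋-trans a a′) (≋-trans b b′) (≋-trans c c′) (≋-trans d d′)

  ·-cong : ∀ {x y u v} → x ≈ᴷ y → u ≈ᴷ v → x · u ≈ᴷ y · v
  ·-cong {⟨ _ , _ , _ , _ ⟩} {⟨ _ , _ , _ , _ ⟩} {⟨ _ , _ , _ , _ ⟩} {⟨ _ , _ , _ , _ ⟩}
    (coords a b c d) (coords a′ b′ c′ d′) =
    coords (≋-+ a a′) (≋-+ (≋-* b (t^-cong a′)) b′) (≋-+ c c′)
           (≋-+ (≋-+ (≋-* d (t^-cong a′)) (≋-* c b′)) d′)

  ·-assoc : ∀ x y z → (x · y) · z ≈ᴷ x · (y · z)
  ·-assoc ⟨ m , l , i , k ⟩ ⟨ m′ , l′ , i′ , k′ ⟩ ⟨ m″ , l″ , i″ , k″ ⟩ = coords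
    (≋-reflexive (+-assoc m m′ m″))
    (≋-reflexive (≡.trans (expand-l l l′ l″ (t ^ m′) (t ^ m″))
      (≡.cong (λ T → l * T + (l′ * t ^ m″ + l″)) (≡.sym (^-distribˡ-+-* t m′ m″)))))
    (≋-reflexive (+-assoc i i′ i″))
    (≋-reflexive (≡.trans (expand-k k k′ k″ i i′ l′ l″ (t ^ m′) (t ^ m″))
      (≡.cong (λ T → k * T + i * (l′ * t ^ m″ + l″) + (k′ * t ^ m″ + i′ * l″ + k″))
        (≡.sym (^-distribˡ-+-* t m′ m″)))))
    where
    expand-l : ∀ l l′ l″ T U → (l * T + l′) * U + l″ ≡ l * (T * U) + (l′ * U + l″)
    expand-l = solve-∀
    expand-k : ∀ k k′ k″ i i′ l′ l″ T U → (k * T + i * l′ + k′) * U + (i + i′) * l″ + k″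
      ≡ k * (T * U) + i * (l′ * U + l″) + (k′ * U + i′ * l″ + k″)
    expand-k = solve-∀

  ·-identityˡ : ∀ x → 1ᴷ · x ≈ᴷ x
  ·-identityˡ ⟨ m , l , i , k ⟩ = ≈ᴷ-refl

  ·-identityʳ : ∀ x → x · 1ᴷ ≈ᴷ x
  ·-identityʳ ⟨ m , l , i , k ⟩ = coords (≋-reflexive (+-identityʳ m)) (≋-reflexive (unit₁ l))
    (≋-reflexive (+-identityʳ i)) (≋-reflexive (unit₂ k i))
    where
    unit₁ : ∀ l → l * 1 + 0 ≡ l
    unit₁ = solve-∀
    unit₂ : ∀ k i → k * 1 + i * 0 + 0 ≡ k
    unit₂ = solve-∀

  private
    negate : ∀ x → x + p * x ≋ 0 mod suc p
    negate x = n*≋0 x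

    suc[p∸1]*m : ∀ m → m + (p ∸ 1) * m ≋ 0 mod p
    suc[p∸1]*m m = ≋-trans (≋-reflexive (≡.cong (_* m) (m+[n∸m]≡n {1} {p} (>-nonZero⁻¹ p)))) (n*≋0 m)

  ⁻¹ᴷ-inverseʳ : ∀ x → x · x ⁻¹ᴷ ≈ᴷ 1ᴷ
  ⁻¹ᴷ-inverseʳ ⟨ m , l , i , k ⟩ = coords (suc[p∸1]*m m) (negate _) (negate i) (negate _)

  ≈ᴷ-setoid : Setoid 0ℓ 0ℓ
  ≈ᴷ-setoid = record { Carrier = Coord ; _≈_ = _≈ᴷ_
    ; isEquivalence = record { refl = ≈ᴷ-refl ; sym = ≈ᴷ-sym ; trans = ≈ᴷ-trans } }

  -- Right inverses and a unit suffice for this in any monoid, which spares a second computation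
  -- with exponents.
  ⁻¹ᴷ-inverseˡ : ∀ x → x ⁻¹ᴷ · x ≈ᴷ 1ᴷ
  ⁻¹ᴷ-inverseˡ x = begin
    x ⁻¹ᴷ · x                            ≈⟨ ·-identityʳ _ ⟨
    (x ⁻¹ᴷ · x) · 1ᴷ                     ≈⟨ ·-cong (≈ᴷ-refl {x ⁻¹ᴷ · x}) (⁻¹ᴷ-inverseʳ (x ⁻¹ᴷ)) ⟨
    (x ⁻¹ᴷ · x) · (x ⁻¹ᴷ · x ⁻¹ᴷ ⁻¹ᴷ)    ≈⟨ ·-assoc (x ⁻¹ᴷ) x _ ⟩
    x ⁻¹ᴷ · (x · (x ⁻¹ᴷ · x ⁻¹ᴷ ⁻¹ᴷ))    ≈⟨ ·-cong (≈ᴷ-refl {x ⁻¹ᴷ}) (·-assoc x (x ⁻¹ᴷ) _) ⟨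
    x ⁻¹ᴷ · ((x · x ⁻¹ᴷ) · x ⁻¹ᴷ ⁻¹ᴷ)    ≈⟨ ·-cong (≈ᴷ-refl {x ⁻¹ᴷ}) (·-cong (⁻¹ᴷ-inverseʳ x) ≈ᴷ-refl) ⟩
    x ⁻¹ᴷ · (1ᴷ · x ⁻¹ᴷ ⁻¹ᴷ)             ≈⟨ ·-cong (≈ᴷ-refl {x ⁻¹ᴷ}) (·-identityˡ _) ⟩
    x ⁻¹ᴷ · x ⁻¹ᴷ ⁻¹ᴷ                    ≈⟨ ⁻¹ᴷ-inverseʳ (x ⁻¹ᴷ) ⟩
    1ᴷ                                   ∎
    where open SetoidReasoning ≈ᴷ-setoid

  ⁻¹ᴷ-cong : ∀ {x y} → x ≈ᴷ y → x ⁻¹ᴷ ≈ᴷ y ⁻¹ᴷ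
  ⁻¹ᴷ-cong {⟨ _ , _ , _ , _ ⟩} {⟨ _ , _ , _ , _ ⟩} (coords a b c d) = coords a′ b′ (≋-* (≋-refl {x = p}) c)
    (≋-* (≋-refl {x = p}) (≋-+ (≋-* d (t^-cong a′)) (≋-* c b′)))
    where
    a′ = ≋-* (≋-refl {x = p ∸ 1}) a
    b′ = ≋-* (≋-refl {x = p}) (≋-* b (t^-cong a′))

  K : Group 0ℓ 0ℓ
  K = record
    { Carrier = Coord ; _≈_ = _≈ᴷ_ ; _∙_ = _·_ ; ε = 1ᴷ ; _⁻¹ = _⁻¹ᴷ
    ; isGroup = record
      { isMonoid = record
        { isSemigroup = record
          { isMagma = record
            { isEquivalence = Setoid.isEquivalence ≈ᴷ-setoid
            ; ∙-cong = ·-cong }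
          ; assoc = ·-assoc }
        ; identity = ·-identityˡ , ·-identityʳ }
      ; inverse = ⁻¹ᴷ-inverseˡ , ⁻¹ᴷ-inverseʳ
      ; ⁻¹-cong = ⁻¹ᴷ-cong } }

  private module Kₗ = GroupLemmas K
  open Kₗ using () renaming (_↑_ to _↑ᴷ_) public

  wᴷ zᴷ cᴷ gᴷ : Coord
  wᴷ = ⟨ 0 , 0 , 1 , 0 ⟩
  zᴷ = ⟨ 0 , 0 , 0 , 1 ⟩
  cᴷ = ⟨ 0 , 1 , 0 , 0 ⟩
  gᴷ = ⟨ 1 , 0 , 0 , 0 ⟩

  wᴷ↑ : ∀ n → wᴷ ↑ᴷ n ≡ ⟨ 0 , 0 , n , 0 ⟩
  wᴷ↑ zero    = ≡.refl
  wᴷ↑ (suc n) = ≡.cong (wᴷ ·_) (wᴷ↑ n)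

  zᴷ↑ : ∀ n → zᴷ ↑ᴷ n ≡ ⟨ 0 , 0 , 0 , n ⟩
  zᴷ↑ zero    = ≡.refl
  zᴷ↑ (suc n) = ≡.cong (zᴷ ·_) (zᴷ↑ n)

  cᴷ↑ : ∀ n → cᴷ ↑ᴷ n ≡ ⟨ 0 , n , 0 , 0 ⟩
  cᴷ↑ zero    = ≡.refl
  cᴷ↑ (suc n) = ≡.cong (cᴷ ·_) (cᴷ↑ n)

  gᴷ↑ : ∀ n → gᴷ ↑ᴷ n ≡ ⟨ n , 0 , 0 , 0 ⟩
  gᴷ↑ zero    = ≡.refl
  gᴷ↑ (suc n) = ≡.cong (gᴷ ·_) (gᴷ↑ n)

  slidesᴷ : Kₗ.G₂Slides p t wᴷ zᴷ cᴷ gᴷ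
  slidesᴷ = record
    { w-order = ≈ᴷ-trans (≈ᴷ-reflexive (wᴷ↑ (suc p))) (coords ≋-refl ≋-refl self ≋-refl)
    ; z-order = ≈ᴷ-trans (≈ᴷ-reflexive (zᴷ↑ (suc p))) (coords ≋-refl ≋-refl ≋-refl self)
    ; c-order = ≈ᴷ-trans (≈ᴷ-reflexive (cᴷ↑ (suc p))) (coords ≋-refl self ≋-refl ≋-refl)
    ; g-order = ≈ᴷ-trans (≈ᴷ-reflexive (gᴷ↑ p)) (coords self ≋-refl ≋-refl ≋-refl)
    ; wz = ≈ᴷ-refl
    ; cg = ≈ᴷ-sym (≈ᴷ-trans (≈ᴷ-reflexive (≡.cong (gᴷ ·_) (cᴷ↑ t)))
             (coords ≋-refl (≋-reflexive (≡.sym (t¹ t))) ≋-refl ≋-refl))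
    ; wc = ≈ᴷ-refl
    ; zc = ≈ᴷ-refl
    ; wg = ≈ᴷ-refl
    ; zg = ≈ᴷ-sym (≈ᴷ-trans (≈ᴷ-reflexive (≡.cong (gᴷ ·_) (zᴷ↑ t)))
             (coords ≋-refl ≋-refl ≋-refl (≋-reflexive (≡.sym (t¹′ t)))))
    }
    where
    self : ∀ {n} → n ≋ 0 mod n
    self = ∣⇒≋0 ∣-refl
    t¹ : ∀ t → 1 * (t * 1) + 0 ≡ t
    t¹ = solve-∀
    t¹′ : ∀ t → 1 * (t * 1) + 0 * 0 + 0 ≡ t
    t¹′ = solve-∀

  -- Evaluation of exponent quadruples in an arbitrary group satisfying the relations; it is a
  -- homomorphism from the model.
  module NormalForm (X : Group 0ℓ 0ℓ) {w z c g} (s : GroupLemmas.G₂Slides X p t w z c g) where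

    open Group X
    open GroupLemmas X
    open G₂Slides s
    open Heisenberg wz wc zc
    open SetoidReasoning setoid

    nf : Coord → Carrier
    nf ⟨ m , l , i , k ⟩ = g ↑ m ∙ h l i k

    nf-cong : ∀ {x y} → x ≈ᴷ y → nf x ≈ nf y
    nf-cong {⟨ _ , _ , _ , _ ⟩} {⟨ _ , _ , _ , _ ⟩} (coords a b c d) = ∙-cong (↑-mod g-order a) (∙-cong (↑-mod c-order b)
      (∙-cong (↑-mod w-order c) (↑-mod z-order d)))

    h-slide : ∀ l i k m → h l i k ∙ g ↑ m ≈ g ↑ m ∙ h (l * t ^ m) i (k * t ^ m)
    h-slide l i k m = slide-∙ (slide-power l m cg) (slide-∙ (comm-↑ i m wg) (slide-power k m zg))

    nf-∙ : ∀ x y → nf (x · y) ≈ nf x ∙ nf y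
    nf-∙ ⟨ m , l , i , k ⟩ ⟨ m′ , l′ , i′ , k′ ⟩ = sym (begin
      (g ↑ m ∙ h l i k) ∙ (g ↑ m′ ∙ h l′ i′ k′)   ≈⟨ solveᴹ monoid ⟩
      g ↑ m ∙ ((h l i k ∙ g ↑ m′) ∙ h l′ i′ k′)   ≈⟨ ∙-congˡ (∙-congʳ (h-slide l i k m′)) ⟩
      g ↑ m ∙ ((g ↑ m′ ∙ h (l * t ^ m′) i (k * t ^ m′)) ∙ h l′ i′ k′)
                                                  ≈⟨ solveᴹ monoid ⟩
      (g ↑ m ∙ g ↑ m′) ∙ (h (l * t ^ m′) i (k * t ^ m′) ∙ h l′ i′ k′)
        ≈⟨ ∙-cong (sym (↑-+ g m m′)) (h-∙ (l * t ^ m′) i (k * t ^ m′) l′ i′ k′) ⟩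
      g ↑ (m + m′) ∙ h (l * t ^ m′ + l′) (i + i′) (k * t ^ m′ + i * l′ + k′) ∎)

    nf-ε : nf 1ᴷ ≈ ε
    nf-ε = trans (identityˡ _) (trans (identityˡ _) (identityˡ _))

    nf-⁻¹ : ∀ x → nf (x ⁻¹ᴷ) ≈ nf x ⁻¹
    nf-⁻¹ x = inverseʳ-unique (nf x) (nf (x ⁻¹ᴷ))
      (trans (sym (nf-∙ x (x ⁻¹ᴷ))) (trans (nf-cong (⁻¹ᴷ-inverseʳ x)) nf-ε))
      where open GroupProperties X

    nf-w : nf wᴷ ≈ w
    nf-w = trans (identityˡ _) (trans (identityˡ _) (trans (identityʳ _) (identityʳ w)))

    nf-z : nf zᴷ ≈ z
    nf-z = trans (identityˡ _) (trans (identityˡ _) (trans (identityˡ _) (identityʳ z)))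

    nf-c : nf cᴷ ≈ c
    nf-c = trans (identityˡ _) (trans (∙-congˡ (identityˡ ε)) (trans (identityʳ _) (identityʳ c)))

    nf-g↑ : ∀ m → nf ⟨ m , 0 , 0 , 0 ⟩ ≈ g ↑ m
    nf-g↑ m = trans (∙-congˡ (trans (identityˡ _) (identityˡ ε))) (identityʳ _)

    nf-g : nf gᴷ ≈ g
    nf-g = trans (nf-g↑ 1) (↑-1 g)

  private module Kₙ = NormalForm K slidesᴷ

  nfᴷ : ∀ x → Kₙ.nf x ≈ᴷ x
  nfᴷ ⟨ m , l , i , k ⟩ = ≈ᴷ-trans (≈ᴷ-reflexive (≡.cong₂ _·_ (gᴷ↑ m) (≡.cong₂ _·_ (cᴷ↑ l)
    (≡.cong₂ _·_ (wᴷ↑ i) (zᴷ↑ k))))) (coords (≋-reflexive (zero₁ m)) (≋-reflexive (zero₂ l))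
    (≋-reflexive (+-identityʳ i)) (≋-reflexive (zero₃ i k)))
    where
    zero₁ : ∀ m → m + 0 ≡ m
    zero₁ = solve-∀
    zero₂ : ∀ l → l * 1 + 0 ≡ l
    zero₂ = solve-∀
    zero₃ : ∀ i k → i * 0 + k ≡ k
    zero₃ = solve-∀

  -- An isomorphism with the model that matches the four generators. Both the presented group and
  -- the group of the given map are brought to this form, and `transfer` then compares them.
  record Coordinatized (X : Group 0ℓ 0ℓ) (w z c g : Group.Carrier X) : Set where
    open Group X
    field
      slides   : GroupLemmas.G₂Slides X p t w z c g
    open NormalForm X slides public
    field
      coord    : Carrier → Coord
      nf-coord : ∀ x → nf (coord x) ≈ x
      nf-inj   : ∀ {x y} → nf x ≈ nf y → x ≈ᴷ y

    coord-nf : ∀ x → coord (nf x) ≈ᴷ x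
    coord-nf x = nf-inj (nf-coord (nf x))

    coord-cong : ∀ {x y} → x ≈ y → coord x ≈ᴷ coord y
    coord-cong {x} {y} e = nf-inj (trans (nf-coord x) (trans e (sym (nf-coord y))))

    coord-inj : ∀ {x y} → coord x ≈ᴷ coord y → x ≈ y
    coord-inj {x} {y} e = trans (sym (nf-coord x)) (trans (nf-cong e) (nf-coord y))

    coord-∙ : ∀ x y → coord (x ∙ y) ≈ᴷ coord x · coord y
    coord-∙ x y = nf-inj (trans (nf-coord _) (trans (∙-cong (sym (nf-coord x)) (sym (nf-coord y)))
      (sym (nf-∙ (coord x) (coord y)))))

    coord-ε : coord ε ≈ᴷ 1ᴷ
    coord-ε = nf-inj (trans (nf-coord ε) (sym nf-ε))

    coord-⁻¹ : ∀ x → coord (x ⁻¹) ≈ᴷ coord x ⁻¹ᴷ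
    coord-⁻¹ x = nf-inj (trans (nf-coord _) (trans (⁻¹-cong (sym (nf-coord x))) (sym (nf-⁻¹ (coord x)))))

    coord-↑ : ∀ x n → coord (pow X x n) ≈ᴷ coord x ↑ᴷ n
    coord-↑ x zero    = coord-ε
    coord-↑ x (suc n) = ≈ᴷ-trans (coord-∙ x (pow X x n)) (·-cong (≈ᴷ-refl {coord x}) (coord-↑ x n))

  module _ {Γ : Group 0ℓ 0ℓ} {w z c g} (pres : IsG₂Presentation (suc p) t Γ w z c g) where

    private
      open Group Γ
      open GroupLemmas Γ
      open IsG₂Presentation pres

      slidesΓ : G₂Slides p t w z c g
      slidesΓ = relations⇒slides relations

      module N = NormalForm Γ slidesΓ

      toK = universal K wᴷ zᴷ cᴷ gᴷ (Kₗ.slides⇒relations slidesᴷ)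
      f   = proj₁ toK
      module F = GroupMorphisms.IsGroupHomomorphism (proj₁ (proj₂ toK))

      fw : f w ≈ᴷ wᴷ
      fw = proj₁ (proj₂ (proj₂ toK))
      fz : f z ≈ᴷ zᴷ
      fz = proj₁ (proj₂ (proj₂ (proj₂ toK)))
      fc : f c ≈ᴷ cᴷ
      fc = proj₁ (proj₂ (proj₂ (proj₂ (proj₂ toK))))
      fg : f g ≈ᴷ gᴷ
      fg = proj₂ (proj₂ (proj₂ (proj₂ (proj₂ toK))))

      f-↑ : ∀ {x y} n → f x ≈ᴷ y → f (x ↑ n) ≈ᴷ y ↑ᴷ n
      f-↑ zero    e = F.ε-homo
      f-↑ {x} (suc n) e = ≈ᴷ-trans (F.homo x (x ↑ n)) (·-cong e (f-↑ n e))

      f-nf : ∀ x → f (N.nf x) ≈ᴷ x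
      f-nf x@(⟨ m , l , i , k ⟩) = ≈ᴷ-trans
        (≈ᴷ-trans (F.homo _ _) (·-cong (f-↑ m fg) (≈ᴷ-trans (F.homo _ _) (·-cong (f-↑ l fc)
          (≈ᴷ-trans (F.homo _ _) (·-cong (f-↑ i fw) (f-↑ k fz)))))))
        (nfᴷ x)

      nf-f : ∀ {x} → InGen Γ (λ y → (y ≈ w) ⊎ ((y ≈ z) ⊎ ((y ≈ c) ⊎ (y ≈ g)))) x → N.nf (f x) ≈ x
      nf-f (gen (inj₁ e)) =
        trans (N.nf-cong (≈ᴷ-trans (F.⟦⟧-cong e) fw)) (trans N.nf-w (sym e))
      nf-f (gen (inj₂ (inj₁ e))) =
        trans (N.nf-cong (≈ᴷ-trans (F.⟦⟧-cong e) fz)) (trans N.nf-z (sym e))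
      nf-f (gen (inj₂ (inj₂ (inj₁ e)))) =
        trans (N.nf-cong (≈ᴷ-trans (F.⟦⟧-cong e) fc)) (trans N.nf-c (sym e))
      nf-f (gen (inj₂ (inj₂ (inj₂ e)))) =
        trans (N.nf-cong (≈ᴷ-trans (F.⟦⟧-cong e) fg)) (trans N.nf-g (sym e))
      nf-f unit       = trans (N.nf-cong F.ε-homo) N.nf-ε
      nf-f (mul {x} {y} a b) = trans (N.nf-cong (F.homo x y)) (trans (N.nf-∙ (f x) (f y)) (∙-cong (nf-f a) (nf-f b)))
      nf-f (inv {x} a) = trans (N.nf-cong (F.⁻¹-homo x)) (trans (N.nf-⁻¹ (f x)) (⁻¹-cong (nf-f a)))
      nf-f (resp e a) = trans (N.nf-cong (F.⟦⟧-cong (sym e))) (trans (nf-f a) e)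

    -- The universal property gives a homomorphism to the model. It undoes evaluation, so the
    -- presented group does not collapse, and evaluation undoes it because this holds on generators.
    presentation⇒coordinatized : Coordinatized Γ w z c g
    presentation⇒coordinatized = record
      { slides   = slidesΓ
      ; coord    = f
      ; nf-coord = λ x → nf-f (generated x)
      ; nf-inj   = λ {x} {y} e → ≈ᴷ-trans (≈ᴷ-sym (f-nf x)) (≈ᴷ-trans (F.⟦⟧-cong e) (f-nf y)) }

  module _ {X Y : Group 0ℓ 0ℓ} {w z c g w′ z′ c′ g′}
           (CX : Coordinatized X w z c g) (CY : Coordinatized Y w′ z′ c′ g′) where

    private
      module X = Group X
      module Y = Group Y
      module CX = Coordinatized CX
      module CY = Coordinatized CY

    transfer : X.Carrier → Y.Carrier
    transfer x = CY.nf (CX.coord x)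

    transfer-nf : ∀ q → transfer (CX.nf q) Y.≈ CY.nf q
    transfer-nf q = CY.nf-cong (CX.coord-nf q)

    transfer-cong : ∀ {x y} → x X.≈ y → transfer x Y.≈ transfer y
    transfer-cong e = CY.nf-cong (CX.coord-cong e)

    transfer-iso : GroupMorphisms.IsGroupIsomorphism X.rawGroup Y.rawGroup transfer
    transfer-iso = record
      { isGroupMonomorphism = record
        { isGroupHomomorphism = record
          { isMonoidHomomorphism = record
            { isMagmaHomomorphism = record
              { isRelHomomorphism = record { cong = transfer-cong }
              ; homo = λ x y → Y.trans (CY.nf-cong (CX.coord-∙ x y)) (CY.nf-∙ (CX.coord x) (CX.coord y)) }
            ; ε-homo = Y.trans (CY.nf-cong CX.coord-ε) CY.nf-ε }
          ; ⁻¹-homo = λ x → Y.trans (CY.nf-cong (CX.coord-⁻¹ x)) (CY.nf-⁻¹ (CX.coord x)) }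
        ; injective = λ e → CX.coord-inj (CY.nf-inj e) }
      ; surjective = λ y → CX.nf (CY.coord y) , λ e → Y.trans (transfer-cong e)
          (Y.trans (transfer-nf (CY.coord y)) (CY.nf-coord y)) }

-- The maps M₂(p , j)

parity : ∀ n → ∃ λ r → n ≡ 2 * r ⊎ n ≡ 1 + 2 * r
parity zero = 0 , inj₁ ≡.refl
parity (suc n) with parity n
... | r , inj₁ e = r , inj₂ (≡.cong suc e)
... | r , inj₂ e = suc r , inj₁ (≡.trans (≡.cong suc e) (≡.sym (≡.cong suc (+-suc r (r + 0)))))

coprime-*-∣ : ∀ {m n k} → Coprime m n → m ∣ k → n ∣ k → m * n ∣ k
coprime-*-∣ {m} {n} c (divides x ≡.refl) n∣k = ≡.subst (m * n ∣_) (*-comm m x)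
  (*-monoʳ-∣ m (coprime-divisor (Coprimality.sym c) (≡.subst (n ∣_) (*-comm x m) n∣k)))

coprime-suc : ∀ n → Coprime (suc n) n
coprime-suc n {d} (d∣1+n , d∣n) = ∣1⇒≡1 (∣m+n∣m⇒∣n (≡.subst (d ∣_) (+-comm 1 n) d∣1+n) d∣n)

coprime-even⇒odd : ∀ {j n} → Coprime j n → 2 ∣ n → ∃ λ r → j ≡ 1 + 2 * r
coprime-even⇒odd {j} c 2∣n with parity j
... | r , inj₁ e = contradiction (c (divides r (≡.trans e (*-comm 2 r)) , 2∣n)) λ ()
... | r , inj₂ e = r , e

-- For g of order n this says that g to the power j M is the involution of ⟨ g ⟩ for every odd j.
odd-*-half : ∀ {j n M} → (∃ λ r → j ≡ 1 + 2 * r) → n ≡ 2 * M → M * j ≋ M mod n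
odd-*-half {M = M} (r , ≡.refl) ≡.refl = shifts 0 r (expand M r)
  where
  expand : ∀ M r → M * (1 + 2 * r) + 0 * (2 * M) ≡ M + r * (2 * M)
  expand = solve-∀

toFin : ∀ {n} → ℕ → Fin (suc n)
toFin {n} x = fromℕ< (m%n<n x (suc n))

toℕ-toFin : ∀ {n} x → toℕ (toFin {n} x) ≋ x mod suc n
toℕ-toFin {n} x = ≋-trans (≋-reflexive (toℕ-fromℕ< (m%n<n x (suc n)))) (≋-% x)

toFin-cong : ∀ {n x y} → x ≋ y mod suc n → toFin {n} x ≡ toFin y
toFin-cong {n} {x} {y} e = toℕ-injective (≋⇒≡ (toℕ<n _) (toℕ<n _)
  (≋-trans (toℕ-toFin x) (≋-trans e (≋-sym (toℕ-toFin y)))))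

toFin-inj : ∀ {n x y} → toFin {n} x ≡ toFin y → x ≋ y mod suc n
toFin-inj {n} {x} {y} e = ≋-trans (≋-sym (toℕ-toFin x)) (≋-trans (≋-reflexive (≡.cong toℕ e)) (toℕ-toFin y))

toFin-toℕ : ∀ {n} (i : Fin (suc n)) → toFin (toℕ i) ≡ i
toFin-toℕ i = toℕ-injective (≋⇒≡ (toℕ<n _) (toℕ<n _) (toℕ-toFin (toℕ i)))

module Maps {p t : ℕ} (pr : Prime (suc p)) (4≤p : 4 ≤ p) (root : IsPrimitiveRoot (suc p) t)
  (p-even : p ≡ 2 * (p / 2)) where

  open Model pr root

  private
    M = p / 2
    P = suc p

  2M≋0 : M + M ≋ 0 mod p
  2M≋0 = ∣⇒≋0 (≡.subst (p ∣_) (≡.trans p-even (≡.cong (M +_) (+-identityʳ M))) ∣-refl)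

  P*≋ : ∀ x → P * x ≋ x mod p
  P*≋ x = ≋-trans (≋-+ (≋-refl {x = x}) (n*≋0 x)) (≋-reflexive (+-identityʳ x))

  p*p≋1 : p * p ≋ 1 mod P
  p*p≋1 = ≋-+-cancelˡ p (≋-trans (≋-reflexive (factor p)) (≋-trans (*n≋0 p)
    (≋-sym (≋-trans (≋-reflexive (+-comm p 1)) (∣⇒≋0 ∣-refl)))))
    where
    factor : ∀ p → p + p * p ≡ p * suc p
    factor = solve-∀

  1+t^M : 1 + t ^ M ≋ 0 mod P
  1+t^M = half-power M p-even

  t^M≋p : t ^ M ≋ p mod P
  t^M≋p = ≋-+-cancelˡ 1 (≋-trans 1+t^M (≋-sym (∣⇒≋0 ∣-refl)))

  0≋suc⇒ : ∀ x y → x + p * y ≋ 0 mod P → x ≋ y mod P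
  0≋suc⇒ x y e = ≋-+-cancelʳ (p * y) (≋-trans e (≋-sym (n*≋0 y)))

  -- Elements ⟨ m , 0 , i , 0 ⟩ are exactly those of ⟨ w , g ⟩ = ⟨ a ⟩.
  rot : ℕ → ℕ → Coord
  rot m i = ⟨ m , 0 , i , 0 ⟩

  rot-· : ∀ m i m′ i′ → rot m i · rot m′ i′ ≡ rot (m + m′) (i + i′)
  rot-· m i m′ i′ = ≡.cong (λ x → ⟨ m + m′ , 0 , i + i′ , x ⟩) (zero₁ i)
    where
    zero₁ : ∀ i → i * 0 + 0 ≡ 0
    zero₁ = solve-∀

  rot-↑ : ∀ m i n → rot m i ↑ᴷ n ≡ rot (n * m) (n * i)
  rot-↑ m i zero    = ≡.refl
  rot-↑ m i (suc n) = ≡.trans (≡.cong (rot m i ·_) (rot-↑ m i n)) (rot-· m i (n * m) (n * i))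

  rot-⁻¹ : ∀ m i → rot m i ⁻¹ᴷ ≈ᴷ rot ((p ∸ 1) * m) (p * i)
  rot-⁻¹ m i = coords ≋-refl (≋-reflexive (*-zeroʳ p)) ≋-refl (≋-reflexive (zero₁ p i))
    where
    zero₁ : ∀ p i → p * (i * (p * 0)) ≡ 0
    zero₁ = solve-∀

  m-↑ : ∀ q n → Coord.m (q ↑ᴷ n) ≡ n * Coord.m q
  m-↑ q zero    = ≡.refl
  m-↑ q (suc n) = ≡.trans (m-· q (q ↑ᴷ n)) (≡.cong (Coord.m q +_) (m-↑ q n))
    where
    m-· : ∀ x y → Coord.m (x · y) ≡ Coord.m x + Coord.m y
    m-· ⟨ _ , _ , _ , _ ⟩ ⟨ _ , _ , _ , _ ⟩ = ≡.refl

  i-↑ : ∀ q n → Coord.i (q ↑ᴷ n) ≡ n * Coord.i q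
  i-↑ q zero    = ≡.refl
  i-↑ q (suc n) = ≡.trans (i-· q (q ↑ᴷ n)) (≡.cong (Coord.i q +_) (i-↑ q n))
    where
    i-· : ∀ x y → Coord.i (x · y) ≡ Coord.i x + Coord.i y
    i-· ⟨ _ , _ , _ , _ ⟩ ⟨ _ , _ , _ , _ ⟩ = ≡.refl

  module _ {Γ : Group 0ℓ 0ℓ} {w z c g} (𝒞 : Coordinatized Γ w z c g) where

    open Group Γ
    open GroupLemmas Γ
    open Coordinatized 𝒞
    open G₂Slides slides

    infix 4 _at_
    _at_ : Carrier → Coord → Set
    x at q = coord x ≈ᴷ q

    ≈nf⇒at : ∀ {x q} → x ≈ nf q → x at q
    ≈nf⇒at {x} {q} e = nf-inj (trans (nf-coord x) e)

    at⇒≈nf : ∀ {x q} → x at q → x ≈ nf q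
    at⇒≈nf {x} e = trans (sym (nf-coord x)) (nf-cong e)

    at-∙ : ∀ {x y q r} → x at q → y at r → x ∙ y at q · r
    at-∙ {x} {y} e f = ≈ᴷ-trans (coord-∙ x y) (·-cong e f)

    at-unique : ∀ {x y q} → x at q → y at q → x ≈ y
    at-unique e f = coord-inj (≈ᴷ-trans e (≈ᴷ-sym f))

    at-resp : ∀ {x y q} → x ≈ y → x at q → y at q
    at-resp e f = ≈ᴷ-trans (coord-cong (sym e)) f

    ↑ᴷ-cong : ∀ {x y} n → x ≈ᴷ y → x ↑ᴷ n ≈ᴷ y ↑ᴷ n
    ↑ᴷ-cong = GroupLemmas.↑-cong K

    at-↑ : ∀ {x q} n → x at q → x ↑ n at q ↑ᴷ n
    at-↑ {x} n e = ≈ᴷ-trans (coord-↑ x n) (↑ᴷ-cong n e)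

    at-rot-↑ : ∀ {x m i} n → x at rot m i → x ↑ n at rot (n * m) (n * i)
    at-rot-↑ {x} {m} {i} n e = ≈ᴷ-trans (at-↑ n e) (≈ᴷ-reflexive (rot-↑ m i n))

    at-rot-⁻¹ : ∀ {x m i} → x at rot m i → x ⁻¹ at rot ((p ∸ 1) * m) (p * i)
    at-rot-⁻¹ {x} {m} {i} e = ≈ᴷ-trans (coord-⁻¹ x) (≈ᴷ-trans (⁻¹ᴷ-cong e) (rot-⁻¹ m i))

    a : ℕ → Carrier
    a = M₂a Γ P w c g

    b : Carrier
    b = M₂b Γ P w c g

    c-at : c at cᴷ
    c-at = ≈nf⇒at {q = cᴷ} (sym nf-c)

    g↑-at : ∀ m → g ↑ m at rot m 0
    g↑-at m = ≈nf⇒at {q = rot m 0} (sym (nf-g↑ m))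

    a-at : ∀ j → a j at rot j 1
    a-at j = ≈ᴷ-trans (at-∙ (≈nf⇒at {q = wᴷ} (sym nf-w)) (g↑-at j)) ≈ᴷ-refl

    b-at : b at ⟨ M , t ^ M , 0 , 0 ⟩
    b-at = ≈ᴷ-trans (at-∙ c-at (g↑-at M)) (coords ≋-refl (≋-reflexive (unit₁ (t ^ M))) ≋-refl ≋-refl)
      where
      unit₁ : ∀ T → 1 * T + 0 ≡ T
      unit₁ = solve-∀

    module _ {x m i} (x-at : x at rot m i) where

      ↑P-at : x ↑ P ≈ g ↑ m
      ↑P-at = at-unique (≈ᴷ-trans (at-rot-↑ P x-at) (coords (P*≋ m) ≋-refl (n*≋0 i) ≋-refl)) (g↑-at m)

      -- The exponent `P * M` kills the w-part of x and turns its g-part into the involution g^M,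
      -- which cancels the factor g^M of b.
      c-recovered : M * m ≋ M mod p → b ∙ x ↑ (P * M) ≈ c
      c-recovered odd = at-unique (≈ᴷ-trans (at-∙ b-at involution) (coords 2M≋0
        (≋-trans (≋-reflexive (≡.trans (+-identityʳ _) (≡.sym (^-distribˡ-+-* t M M)))) (t^-cong 2M≋0))
        ≋-refl ≋-refl)) c-at
        where
        involution : x ↑ (P * M) at rot M 0
        involution = ≈ᴷ-trans (at-rot-↑ (P * M) x-at) (coords
          (≋-trans (≋-reflexive (*-assoc P M m)) (≋-trans (P*≋ (M * m)) odd)) ≋-refl
          (≋-trans (≋-reflexive (*-assoc P M i)) (n*≋0 (M * i))) ≋-refl)

    c↑-inj : ∀ {m n} → c ↑ m ≈ c ↑ n → m ≋ n mod P
    c↑-inj {m} {n} e = l≋ (≈ᴷ-trans (≈ᴷ-sym (at m)) (≈ᴷ-trans (coord-cong e) (at n)))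
      where
      at : ∀ n → c ↑ n at ⟨ 0 , n , 0 , 0 ⟩
      at n = ≈ᴷ-trans (at-↑ n c-at) (≈ᴷ-reflexive (cᴷ↑ n))

    cg↑ : ∀ m → c ∙ g ↑ m ≈ g ↑ m ∙ c ↑ (t ^ m)
    cg↑ m = trans (∙-congʳ (sym (↑-1 c))) (trans (slide-power 1 m cg) (∙-congˡ (↑-≡ c (+-identityʳ (t ^ m)))))

    -- An isomorphism fixing b and sending x to x′ fixes c = b x^(PM) and sends
    -- g ^ m = x ^ P to g ^ m′; compare the actions of these on ⟨ c ⟩.
    rigid : ∀ {x x′ m i m′ i′} → x at rot m i → x′ at rot m′ i′ → M * m ≋ M mod p → M * m′ ≋ M mod p →
      MapIso Γ x b Γ x′ b → m ≋ m′ mod p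
    rigid {x} {x′} {m} {i} {m′} x-at x′-at odd odd′ (f , iso , fx , fb) = t^-inj (c↑-inj (slide-unique
      (begin
        c ∙ g ↑ m′                ≈⟨ ∙-cong fc fg ⟨
        f c ∙ f (g ↑ m)           ≈⟨ F.∙-homo _ _ ⟨
        f (c ∙ g ↑ m)             ≈⟨ F.⟦⟧-cong (cg↑ m) ⟩
        f (g ↑ m ∙ c ↑ (t ^ m))   ≈⟨ F.∙-homo _ _ ⟩
        f (g ↑ m) ∙ f (c ↑ (t ^ m)) ≈⟨ ∙-cong fg (f-↑ (t ^ m) fc) ⟩
        g ↑ m′ ∙ c ↑ (t ^ m)      ∎)
      (cg↑ m′)))
      where
      open SetoidReasoning setoid
      module F = GroupMorphisms.IsGroupIsomorphism iso
      f-↑ : ∀ {y y′} n → f y ≈ y′ → f (y ↑ n) ≈ y′ ↑ n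
      f-↑ zero    e = F.ε-homo
      f-↑ (suc n) e = trans (F.∙-homo _ _) (∙-cong e (f-↑ n e))
      fg : f (g ↑ m) ≈ g ↑ m′
      fg = trans (F.⟦⟧-cong (sym (↑P-at x-at))) (trans (f-↑ P fx) (↑P-at x′-at))
      fc : f c ≈ c
      fc = trans (F.⟦⟧-cong (sym (c-recovered x-at odd))) (trans (F.∙-homo _ _)
        (trans (∙-cong fb (f-↑ (P * M) fx)) (c-recovered x′-at odd′)))

    unit-odd : ∀ {j} → UnitMod p j → ∃ λ r → j ≡ 1 + 2 * r
    unit-odd (_ , cop) = coprime-even⇒odd cop (divides M (≡.trans p-even (*-comm 2 M)))

    unit-half : ∀ {j} → UnitMod p j → M * j ≋ M mod p
    unit-half u = odd-*-half (unit-odd u) p-even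

    non-isomorphic : ∀ {j j′} → UnitMod p j → UnitMod p j′ → j ≢ j′ → ¬ MapIso Γ (a j) b Γ (a j′) b
    non-isomorphic {j} {j′} u u′ j≢j′ iso = j≢j′ (≋⇒≡ (proj₁ u) (proj₁ u′)
      (rigid (a-at j) (a-at j′) (unit-half u) (unit-half u′) iso))

    m+[p∸1]*m : ∀ m → m + (p ∸ 1) * m ≋ 0 mod p
    m+[p∸1]*m m = m≋ (⁻¹ᴷ-inverseʳ (rot m 0))

    -- Inverting a j replaces the g-exponent j by -j, so by `rigid` a reflection would force p to
    -- divide 2 j, hence 2.
    chiral : ∀ {j} → UnitMod p j → Chiral Γ (a j) b
    chiral {j} u iso = <⇒≱ (≤-trans (s≤s (s≤s (s≤s z≤n))) 4≤p) (∣⇒≤ (coprime-divisor (Coprimality.sym (proj₂ u))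
      (≡.subst (p ∣_) (*-comm 2 j) (≋0⇒∣ double))))
      where
      j′ = (p ∸ 1) * j
      half : M * j′ ≋ M mod p
      half = ≋-+-cancelʳ (M * j) (≋-trans (≋-reflexive (≡.trans (+-comm (M * j′) (M * j)) (≡.sym (*-distribˡ-+ M j j′))))
        (≋-trans (≋-* (≋-refl {x = M}) (m+[p∸1]*m j)) (≋-trans (≋-reflexive (*-zeroʳ M))
        (≋-sym (≋-trans (≋-+ (≋-refl {x = M}) (unit-half u)) 2M≋0)))))
      double : 2 * j ≋ 0 mod p
      double = ≋-trans (≋-+ (≋-refl {x = j}) (≋-trans (≋-reflexive (+-identityʳ j))
        (rigid (a-at j) (at-rot-⁻¹ (a-at j)) (unit-half u) half iso))) (m+[p∸1]*m j)

    -- Conjugation by g^M raises c to the power t^M ≡ -1, so the square of c g^M is trivial.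
    b-involution : Involution Γ b
    b-involution = at-unique (≈ᴷ-trans (at-∙ b-at b-at) (coords 2M≋0 l≋0 ≋-refl ≋-refl)) coord-ε
      , λ e → ∤^ pr ∤t M (≋0⇒∣ (l≋ (≈ᴷ-trans (≈ᴷ-sym b-at) (≈ᴷ-trans (coord-cong e) coord-ε))))
      where
      factor : ∀ T → T * T + T ≡ T * (1 + T)
      factor = solve-∀
      l≋0 : t ^ M * t ^ M + t ^ M ≋ 0 mod P
      l≋0 = ≋-trans (≋-reflexive (factor (t ^ M))) (≋-trans (≋-* (≋-refl {x = t ^ M}) 1+t^M) (≋-reflexive (*-zeroʳ (t ^ M))))

    InGen-↑ : ∀ {S x} n → InGen Γ S x → InGen Γ S (x ↑ n)
    InGen-↑ zero    s = unit
    InGen-↑ (suc n) s = mul s (InGen-↑ n s)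

    -- From a and b one recovers c, then g^j as a P-th power, g because j is a unit, w as a
    -- quotient, and z as a commutator.
    generated-by : ∀ {j} → UnitMod p j → GeneratedBy₂ Γ (a j) b
    generated-by {j} u x = resp (nf-coord x) (nf-gen (coord x))
      where
      In = InGen Γ (λ y → (y ≈ a j) ⊎ (y ≈ b))
      a-in : In (a j)
      a-in = gen (inj₁ refl)
      c-in : In c
      c-in = resp (c-recovered (a-at j) (unit-half u)) (mul (gen (inj₂ refl)) (InGen-↑ (P * M) a-in))
      g↑j-in : In (g ↑ j)
      g↑j-in = resp (↑P-at (a-at j)) (InGen-↑ P a-in)
      g-in : In g
      g-in with j⁻¹ , h ← inverse-mod (proj₂ u) =
        resp (trans (sym (↑-* g j⁻¹ j)) (trans (↑-mod g-order h) (↑-1 g))) (InGen-↑ j⁻¹ g↑j-in)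
      w-in : In w
      w-in = resp (trans (assoc _ _ _) (trans (∙-congˡ (inverseʳ (g ↑ j))) (identityʳ w))) (mul a-in (inv g↑j-in))
      z-in : In z
      z-in = resp (∙-cancelˡ w _ _ (slide-unique (slide-comm w c) wc)) (mul (mul (mul (inv w-in) (inv c-in)) w-in) c-in)
        where open GroupProperties Γ using (∙-cancelˡ)
      nf-gen : ∀ q → In (nf q)
      nf-gen ⟨ m , l , i , k ⟩ = mul (InGen-↑ m g-in) (mul (InGen-↑ l c-in) (mul (InGen-↑ i w-in) (InGen-↑ k z-in)))

    cyclic⇒rot : ∀ {j x} → InCyclic Γ (a j) x → ∃₂ λ m i → x at rot m i
    cyclic⇒rot {j} (n , inj₁ e) = _ , _ , at-resp (sym e) (at-rot-↑ n (a-at j))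
    cyclic⇒rot {j} (n , inj₂ e) = _ , _ , at-resp (sym e) (at-rot-⁻¹ (at-rot-↑ n (a-at j)))

    rot⇒cyclic : ∀ {j x m i} → Coprime j p → x at rot m i → InCyclic Γ (a j) x
    rot⇒cyclic {j} {x} {m} {i} cop e with j⁻¹ , h ← inverse-mod cop =
      n , inj₁ (at-unique e (≈ᴷ-trans (at-rot-↑ n (a-at j)) (coords n*j≋m ≋-refl n≋i ≋-refl)))
      where
      -- Chinese remaindering: P ≡ 1 modulo p and p * p ≡ 1 modulo P, so n is m / j modulo p and i
      -- modulo P.
      n = m * j⁻¹ * P + i * p * p
      expand : ∀ m j⁻¹ p i j → (m * j⁻¹ * suc p + i * p * p) * j ≡ m * (j⁻¹ * j) + (m * j⁻¹ * j + i * p * j) * p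
      expand = solve-∀
      n*j≋m : n * j ≋ m mod p
      n*j≋m = ≋-trans (≋-reflexive (expand m j⁻¹ p i j)) (≋-trans (≋-+ (≋-* (≋-refl {x = m}) h) (*n≋0 (m * j⁻¹ * j + i * p * j)))
        (≋-reflexive (≡.trans (+-identityʳ _) (*-identityʳ m))))
      n≋i : n * 1 ≋ i mod P
      n≋i = ≋-trans (≋-reflexive (*-identityʳ n)) (≋-trans (≋-+ (*n≋0 (m * j⁻¹)) (≋-trans (≋-reflexive (*-assoc i p p))
        (≋-* (≋-refl {x = i}) p*p≋1))) (≋-reflexive (*-identityʳ i)))

    -- Let x = gᵐ wⁱ and suppose its conjugate by c also lies in ⟨ w , g ⟩. Comparing exponents of c
    -- in x c = c x^c gives m = 0, and comparing exponents of z gives i = 0.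
    core-free : ∀ j → CoreFree Γ (a j)
    core-free j x h = trivial (cyclic⇒rot {j} (h ε)) (cyclic⇒rot {j} (h c))
      where
      trivial : (∃₂ λ m i → conj Γ x ε at rot m i) → (∃₂ λ m i → conj Γ x c at rot m i) → x ≈ ε
      trivial (m , i , e) (m′ , i′ , e′) = at-unique {q = rot m i} x-at (≈ᴷ-trans coord-ε (coords
          (≋-sym (≋-trans (≋-reflexive (≡.sym (+-identityʳ m))) (≋-trans (m≋ both) m′≋0))) ≋-refl (≋-sym i≋0) ≋-refl))
        where
        x-at : x at rot m i
        x-at = at-resp (trans (assoc _ _ _) (trans (∙-cong GP.ε⁻¹≈ε (identityʳ x)) (identityˡ x))) e
          where module GP = GroupProperties Γ
        both : ⟨ m + 0 , 1 , i + 0 , i * 1 + 0 ⟩ ≈ᴷ ⟨ m′ , 1 * t ^ m′ + 0 , i′ , 0 ⟩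
        both = ≈ᴷ-trans (≈ᴷ-sym (at-∙ x-at c-at)) (≈ᴷ-trans (coord-cong (slide-conj x c)) (at-∙ c-at e′))
        m′≋0 : m′ ≋ 0 mod p
        m′≋0 = ≋-sym (t^-inj {0} {m′} (≋-trans (l≋ both) (≋-reflexive (≡.trans (+-identityʳ _) (+-identityʳ _)))))
        i≋0 : i ≋ 0 mod P
        i≋0 = ≋-trans (≋-reflexive (≡.sym (≡.trans (+-identityʳ _) (*-identityʳ i)))) (k≋ both)

    mapData : ∀ {j} → UnitMod p j → MapData Γ (a j) b
    mapData {j} u = record { generated = generated-by u ; b-inv = b-involution ; core-free = core-free j }

    -- gᵐ cˡ wⁱ zᵏ = gᵐ wⁱ cˡ zᵏ⁻ⁱˡ, so a coset of ⟨ w , g ⟩ is given by l and k - i l.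
    ν₂ : Coord → ℕ
    ν₂ ⟨ m , l , i , k ⟩ = k + p * (i * l)

    νᴷ : Coord → Fin P × Fin P
    νᴷ q = toFin (Coord.l q) , toFin (ν₂ q)

    νᴷ-cong : ∀ {q r} → q ≈ᴷ r → νᴷ q ≡ νᴷ r
    νᴷ-cong {⟨ _ , _ , _ , _ ⟩} {⟨ _ , _ , _ , _ ⟩} (coords _ hl hi hk) =
      ≡.cong₂ _,_ (toFin-cong hl) (toFin-cong (≋-+ hk (≋-* (≋-refl {x = p}) (≋-* hi hl))))

    νᴷ-rot : ∀ m i q → νᴷ (rot m i · q) ≡ νᴷ q
    νᴷ-rot m i ⟨ m′ , l , i′ , k ⟩ = ≡.cong (toFin l ,_) (toFin-cong (begin
      (i * l + k) + p * ((i + i′) * l)         ≡⟨ expand i l k p i′ ⟩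
      k + p * (i′ * l) + i * l * suc p         ≈⟨ ≋-+ (≋-refl {x = k + p * (i′ * l)}) (*n≋0 (i * l)) ⟩
      k + p * (i′ * l) + 0                     ≡⟨ +-identityʳ _ ⟩
      k + p * (i′ * l)                         ∎))
      where
      open ≋-Reasoning P
      expand : ∀ i l k p i′ → (i * l + k) + p * ((i + i′) * l) ≡ k + p * (i′ * l) + i * l * suc p
      expand = solve-∀

    ν : Carrier → Fin P × Fin P
    ν x = νᴷ (coord x)

    ν-at : ∀ {x q} → x at q → ν x ≡ νᴷ q
    ν-at = νᴷ-cong

    same-coset : ∀ q r → νᴷ q ≡ νᴷ r → ∃₂ λ m i → r ≈ᴷ rot m i · q
    same-coset ⟨ m , l , i , k ⟩ ⟨ m′ , l′ , i′ , k′ ⟩ e =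
      m′ + (p ∸ 1) * m , i′ + p * i , coords (≋-sym m-eq) (≋-sym l-eq) (≋-sym i-eq) (≋-sym k-eq)
      where
      l-eq : l ≋ l′ mod P
      l-eq = toFin-inj (≡.cong proj₁ e)
      ν₂-eq : k + p * (i * l) ≋ k′ + p * (i′ * l′) mod P
      ν₂-eq = toFin-inj (≡.cong proj₂ e)
      m-eq : m′ + (p ∸ 1) * m + m ≋ m′ mod p
      m-eq = ≋-trans (≋-reflexive (≡.trans (+-assoc m′ _ m) (≡.cong (m′ +_) (+-comm _ m))))
        (≋-trans (≋-+ (≋-refl {x = m′}) (m+[p∸1]*m m)) (≋-reflexive (+-identityʳ m′)))
      i-eq : i′ + p * i + i ≋ i′ mod P
      i-eq = ≋-trans (≋-reflexive (collect i′ p i)) (≋-trans (≋-+ (≋-refl {x = i′}) (n*≋0 {P} i)) (≋-reflexive (+-identityʳ i′)))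
        where
        collect : ∀ x p i → x + p * i + i ≡ x + suc p * i
        collect = solve-∀
      k-eq : 0 * t ^ m + (i′ + p * i) * l + k ≋ k′ mod P
      k-eq = begin
        (i′ + p * i) * l + k           ≡⟨ collect i′ p i l k ⟩
        i′ * l + (k + p * (i * l))     ≈⟨ ≋-+ (≋-* (≋-refl {x = i′}) l-eq) ν₂-eq ⟩
        i′ * l′ + (k′ + p * (i′ * l′)) ≡⟨ collect′ i′ l′ k′ p ⟩
        k′ + suc p * (i′ * l′)         ≈⟨ ≋-+ (≋-refl {x = k′}) (n*≋0 (i′ * l′)) ⟩
        k′ + 0                         ≡⟨ +-identityʳ k′ ⟩
        k′                             ∎
        where
        open ≋-Reasoning P
        collect : ∀ x p i l k → (x + p * i) * l + k ≡ x * l + (k + p * (i * l))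
        collect = solve-∀
        collect′ : ∀ i l k p → i * l + (k + p * (i * l)) ≡ k + suc p * (i * l)
        collect′ = solve-∀

    ν-coset : ∀ {j} → Coprime j p → ∀ x y → (ν x ≡ ν y) ⇔ InCyclic Γ (a j) (y ∙ x ⁻¹)
    ν-coset {j} cop x y = mk⇔ to from
      where
      to : ν x ≡ ν y → InCyclic Γ (a j) (y ∙ x ⁻¹)
      to e with m , i , h ← same-coset (coord x) (coord y) e = rot⇒cyclic cop (≈nf⇒at {q = rot m i} (begin
        y ∙ x ⁻¹                       ≈⟨ ∙-congʳ (trans (at⇒≈nf h) (trans (nf-∙ (rot m i) (coord x)) (∙-congˡ (nf-coord x)))) ⟩
        (nf (rot m i) ∙ x) ∙ x ⁻¹      ≈⟨ assoc _ _ _ ⟩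
        nf (rot m i) ∙ (x ∙ x ⁻¹)      ≈⟨ ∙-congˡ (inverseʳ x) ⟩
        nf (rot m i) ∙ ε               ≈⟨ identityʳ _ ⟩
        nf (rot m i)                   ∎))
        where open SetoidReasoning setoid
      from : InCyclic Γ (a j) (y ∙ x ⁻¹) → ν x ≡ ν y
      from h with m , i , e ← cyclic⇒rot {j} h = ≡.trans (≡.sym (νᴷ-rot m i (coord x))) (≡.sym (ν-at
        (≈ᴷ-trans (coord-cong (sym (trans (assoc y _ x) (trans (∙-congˡ (inverseˡ x)) (identityʳ y)))))
          (at-∙ e (≈ᴷ-refl {coord x})))))

    -- As t^M ≡ -1, the two ends of an arc differ by -tᵐ in the first coordinate and by i tᵐ in the
    -- second; hence the arc determines m and i.
    νᴷ-b : ∀ m l i k → νᴷ (⟨ M , t ^ M , 0 , 0 ⟩ · ⟨ m , l , i , k ⟩)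
         ≡ (toFin (t ^ M * t ^ m + l) , toFin (ν₂ ⟨ m , l , i , k ⟩ + i * t ^ m))
    νᴷ-b m l i k = ≡.cong (toFin (t ^ M * t ^ m + l) ,_) (toFin-cong (begin
      k + p * (i * (t ^ M * t ^ m + l))              ≡⟨ expand k p i (t ^ M) (t ^ m) l ⟩
      k + p * (i * l) + p * t ^ M * (i * t ^ m)      ≈⟨ ≋-+ (≋-refl {x = k + p * (i * l)}) (≋-* (≋-trans (≋-* (≋-refl {x = p}) t^M≋p) p*p≋1) (≋-refl {x = i * t ^ m})) ⟩
      k + p * (i * l) + 1 * (i * t ^ m)              ≡⟨ ≡.cong (k + p * (i * l) +_) (+-identityʳ _) ⟩
      k + p * (i * l) + i * t ^ m                    ∎))
      where
      open ≋-Reasoning P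
      expand : ∀ k p i T U l → k + p * (i * (T * U + l)) ≡ k + p * (i * l) + p * T * (i * U)
      expand = solve-∀

    ν-b : ∀ x → ν (b ∙ x) ≡ νᴷ (⟨ M , t ^ M , 0 , 0 ⟩ · coord x)
    ν-b x = ν-at {b ∙ x} (at-∙ b-at (≈ᴷ-refl {coord x}))

    arc-okᴷ : ∀ q → toFin {p} (Coord.l q) ≢ proj₁ (νᴷ (⟨ M , t ^ M , 0 , 0 ⟩ · q))
    arc-okᴷ ⟨ m , l , i , k ⟩ e = ∤^ pr ∤t m ([ (λ d → contradiction d (∤^ pr ∤t M)) , (λ d → d) ]′
      (euclidsLemma (t ^ M) (t ^ m) pr (≋0⇒∣ (≋-+-cancelʳ l (≋-sym (toFin-inj {x = l} e))))))

    arc-injᴷ : ∀ q r → νᴷ q ≡ νᴷ r → νᴷ (⟨ M , t ^ M , 0 , 0 ⟩ · q) ≡ νᴷ (⟨ M , t ^ M , 0 , 0 ⟩ · r) → q ≈ᴷ r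
    arc-injᴷ ⟨ m , l , i , k ⟩ ⟨ m′ , l′ , i′ , k′ ⟩ e f = coords m-eq l-eq i-eq k-eq
      where
      f′ = ≡.trans (≡.sym (νᴷ-b m l i k)) (≡.trans f (νᴷ-b m′ l′ i′ k′))
      l-eq : l ≋ l′ mod P
      l-eq = toFin-inj (≡.cong proj₁ e)
      ν₂-eq : k + p * (i * l) ≋ k′ + p * (i′ * l′) mod P
      ν₂-eq = toFin-inj (≡.cong proj₂ e)
      t^m-eq : t ^ m ≋ t ^ m′ mod P
      t^m-eq = ≋-*-cancelˡ (t ^ M) pr (∤^ pr ∤t M) (≋-+-cancelʳ l
        (≋-trans (toFin-inj (≡.cong proj₁ f′)) (≋-+ (≋-refl {x = t ^ M * t ^ m′}) (≋-sym l-eq))))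
      m-eq : m ≋ m′ mod p
      m-eq = t^-inj t^m-eq
      i-eq : i ≋ i′ mod P
      i-eq = ≋-*-cancelˡ (t ^ m) pr (∤^ pr ∤t m) (≋-trans (≋-reflexive (*-comm (t ^ m) i)) (≋-trans
        (≋-+-cancelˡ (k + p * (i * l)) (≋-trans (toFin-inj (≡.cong proj₂ f′)) (≋-+ (≋-sym ν₂-eq) (≋-* (≋-refl {x = i′}) (≋-sym t^m-eq)))))
        (≋-reflexive (*-comm i′ (t ^ m)))))
      k-eq : k ≋ k′ mod P
      k-eq = ≋-+-cancelʳ (p * (i * l)) (≋-trans ν₂-eq (≋-+ (≋-refl {x = k′}) (≋-* (≋-refl {x = p}) (≋-sym (≋-* i-eq l-eq)))))

    arc-surjᴷ : ∀ u v → proj₁ u ≢ proj₁ v → ∃ λ q → (νᴷ q ≡ u) × (νᴷ (⟨ M , t ^ M , 0 , 0 ⟩ · q) ≡ v)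
    arc-surjᴷ (u₁ , u₂) (v₁ , v₂) u₁≢v₁ = q , ≡.cong₂ _,_ (toFin-toℕ u₁) ν₂q
      , ≡.trans (νᴷ-b m x i (y + i * x)) (≡.cong₂ _,_ (≡.trans (toFin-cong {x = t ^ M * t ^ m + x} first) (toFin-toℕ v₁))
          (≡.trans (toFin-cong {x = ν₂ q + i * t ^ m} second) (toFin-toℕ v₂)))
      where
      x = toℕ u₁
      y = toℕ u₂
      x′ = toℕ v₁
      y′ = toℕ v₂
      -- This is x - x′, the value that tᵐ must take for the first coordinate to change from x to
      -- x′.
      s = p * (x′ + p * x)
      s≢0 : ¬ (P ∣ s)
      s≢0 d = [ (λ h → <⇒≱ (n<1+n p) (∣⇒≤ h))
              , (λ h → u₁≢v₁ (toℕ-injective (≋⇒≡ (toℕ<n u₁) (toℕ<n v₁) (≋-sym (0≋suc⇒ x′ x (∣⇒≋0 h)))))) ]′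
        (euclidsLemma p (x′ + p * x) pr d)
      log = discrete-log s s≢0
      m = proj₁ log
      -- The solution of i tᵐ = y′ - y, with the inverse of tᵐ written as a power.
      i = (y′ + p * y) * t ^ ((p ∸ 1) * m)
      q = ⟨ m , x , i , y + i * x ⟩
      ν₂-eq : ν₂ q ≋ y mod P
      ν₂-eq = ≋-trans (≋-reflexive (collect y i x p)) (≋-trans (≋-+ (≋-refl {x = y}) (*n≋0 (i * x))) (≋-reflexive (+-identityʳ y)))
        where
        collect : ∀ y i x p → y + i * x + p * (i * x) ≡ y + i * x * suc p
        collect = solve-∀
      ν₂q : toFin (ν₂ q) ≡ u₂
      ν₂q = ≡.trans (toFin-cong ν₂-eq) (toFin-toℕ u₂)
      first : t ^ M * t ^ m + x ≋ x′ mod P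
      first = begin
        t ^ M * t ^ m + x            ≈⟨ ≋-+ (≋-* t^M≋p (≋-sym (proj₂ (proj₂ log)))) (≋-refl {x = x}) ⟩
        p * (p * (x′ + p * x)) + x   ≡⟨ ≡.cong (_+ x) (≡.sym (*-assoc p p _)) ⟩
        p * p * (x′ + p * x) + x     ≈⟨ ≋-+ (≋-* p*p≋1 (≋-refl {x = x′ + p * x})) (≋-refl {x = x}) ⟩
        1 * (x′ + p * x) + x         ≡⟨ collect x′ p x ⟩
        x′ + x * suc p               ≈⟨ ≋-+ (≋-refl {x = x′}) (*n≋0 x) ⟩
        x′ + 0                       ≡⟨ +-identityʳ x′ ⟩
        x′                           ∎
        where
        open ≋-Reasoning P
        collect : ∀ x′ p x → 1 * (x′ + p * x) + x ≡ x′ + x * suc p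
        collect = solve-∀
      second : ν₂ q + i * t ^ m ≋ y′ mod P
      second = begin
        ν₂ q + i * t ^ m                       ≈⟨ ≋-+ ν₂-eq (≋-reflexive (*-assoc (y′ + p * y) (t ^ ((p ∸ 1) * m)) (t ^ m))) ⟩
        y + (y′ + p * y) * (t ^ ((p ∸ 1) * m) * t ^ m)
          ≡⟨ ≡.cong (λ T → y + (y′ + p * y) * T) (≡.sym (^-distribˡ-+-* t ((p ∸ 1) * m) m)) ⟩
        y + (y′ + p * y) * t ^ ((p ∸ 1) * m + m)
          ≈⟨ ≋-+ (≋-refl {x = y}) (≋-* (≋-refl {x = y′ + p * y}) (t^-cong
               (≋-trans (≋-reflexive (+-comm ((p ∸ 1) * m) m)) (m+[p∸1]*m m)))) ⟩
        y + (y′ + p * y) * 1                   ≡⟨ collect y y′ p ⟩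
        y′ + y * suc p                         ≈⟨ ≋-+ (≋-refl {x = y′}) (*n≋0 y) ⟩
        y′ + 0                                 ≡⟨ +-identityʳ y′ ⟩
        y′                                     ∎
        where
        open ≋-Reasoning P
        collect : ∀ y y′ p → y + (y′ + p * y) * 1 ≡ y′ + y * suc p
        collect = solve-∀

    nf-at : ∀ q → nf q at q
    nf-at q = coord-nf q

    embedding : ∀ {j} → UnitMod p j → EmbeddingOfK Γ (a j) b P P
    embedding {j} u = record
      { ν        = ν
      ; ν-coset  = ν-coset (proj₂ u)
      ; ν-surj   = ν-surj
      ; arc-ok   = λ x e → arc-okᴷ (coord x) (≡.trans e (≡.cong proj₁ (ν-b x)))
      ; arc-inj  = λ x y e f → coord-inj (arc-injᴷ (coord x) (coord y) e
                     (≡.trans (≡.sym (ν-b x)) (≡.trans f (ν-b y))))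
      ; arc-surj = λ u v u≢v → arc-surj u v (arc-surjᴷ u v u≢v)
      }
      where
      ν-surj : ∀ v → ∃ λ x → ν x ≡ v
      ν-surj (v₁ , v₂) = nf q , ≡.trans (ν-at (nf-at q))
        (≡.cong₂ _,_ (toFin-toℕ v₁) (≡.trans (≡.cong toFin zero₁) (toFin-toℕ v₂)))
        where
        q = ⟨ 0 , toℕ v₁ , 0 , toℕ v₂ ⟩
        zero₁ : toℕ v₂ + p * 0 ≡ toℕ v₂
        zero₁ = ≡.trans (≡.cong (toℕ v₂ +_) (*-zeroʳ p)) (+-identityʳ _)
      arc-surj : ∀ u v → (∃ λ q → (νᴷ q ≡ u) × (νᴷ (⟨ M , t ^ M , 0 , 0 ⟩ · q) ≡ v)) →
        ∃ λ x → (ν x ≡ u) × (ν (b ∙ x) ≡ v)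
      arc-surj u v (q , e , f) = nf q , ≡.trans (ν-at (nf-at q)) e ,
        ≡.trans (ν-at {b ∙ nf q} (at-∙ b-at (nf-at q))) f

    -- The w-exponent 1 forces P to divide the order and the g-exponent forces R. Conversely xᴿ has
    -- trivial g-part and so lies in a Heisenberg group of exponent P.
    order-from : ∀ {x J l k R} → x at ⟨ J , l , 1 , k ⟩ → 1 ≤ R → R * J ≋ 0 mod p → Coprime P R →
      (∀ n → p ∣ n * J → R ∣ n) → HasOrder Γ x (P * R)
    order-from {x} {J} {l} {k} {R} x-at 1≤R RJ cop least = positive , annihilated , minimal
      where
      positive : 1 ≤ P * R
      positive = >-nonZero⁻¹ (P * R) {{m*n≢0 P R {{_}} {{>-nonZero 1≤R}}}}
      p-torsion : ∀ q → Coord.m q ≋ 0 mod p → nf q ↑ P ≈ ε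
      p-torsion ⟨ m′ , l′ , i′ , k′ ⟩ m′≋0 = begin
        (g ↑ m′ ∙ h l′ i′ k′) ↑ P     ≈⟨ ↑-cong P (trans (∙-congʳ (↑-mod g-order m′≋0)) (identityˡ _)) ⟩
        h l′ i′ k′ ↑ P                ≈⟨ h-↑ l′ i′ k′ P ⟩
        h (P * l′) (P * i′) (P * k′ + triangle P * (i′ * l′))
          ≈⟨ ∙-cong (↑-mod {c} {P} {P * l′} {0} c-order (n*≋0 l′)) (∙-cong (↑-mod {w} {P} {P * i′} {0} w-order (n*≋0 i′)) (↑-mod {z} {P} {P * k′ + triangle P * (i′ * l′)} {0} z-order
               (≋-+ (n*≋0 k′) (≋-* (∣⇒≋0 (p∣triangle pr (≤-trans (s≤s (s≤s z≤n)) 4≤p))) (≋-refl {x = i′ * l′}))))) ⟩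
        ε ∙ (ε ∙ ε)                   ≈⟨ trans (identityˡ _) (identityˡ ε) ⟩
        ε                             ∎
        where
        open SetoidReasoning setoid
        open Heisenberg wz wc zc
      annihilated : x ↑ (P * R) ≈ ε
      annihilated = trans (↑-* x P R) (trans (↑-cong P (at⇒≈nf (at-↑ R x-at)))
        (p-torsion (⟨ J , l , 1 , k ⟩ ↑ᴷ R) (≋-trans (≋-reflexive (m-↑ ⟨ J , l , 1 , k ⟩ R)) RJ)))
      minimal : ∀ n → 1 ≤ n → x ↑ n ≈ ε → P * R ≤ n
      minimal n 1≤n e = ∣⇒≤ {{>-nonZero 1≤n}} (coprime-*-∣ cop
        (≋0⇒∣ (≋-trans (≋-reflexive (≡.trans (≡.sym (*-identityʳ n)) (≡.sym (i-↑ ⟨ J , l , 1 , k ⟩ n)))) (i≋ trivial)))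
        (least n (≋0⇒∣ (≋-trans (≋-reflexive (≡.sym (m-↑ ⟨ J , l , 1 , k ⟩ n))) (m≋ trivial)))))
        where
        trivial : ⟨ J , l , 1 , k ⟩ ↑ᴷ n ≈ᴷ 1ᴷ
        trivial = ≈ᴷ-trans (≈ᴷ-sym (at-↑ n x-at)) (≈ᴷ-trans (coord-cong e) coord-ε)

    1≤p : 1 ≤ p
    1≤p = ≤-trans (s≤s z≤n) 4≤p

    cancel-coprime : ∀ {J R} → Coprime J R → ∀ n → R ∣ n * J → R ∣ n
    cancel-coprime {J} {R} cop n d = coprime-divisor (Coprimality.sym cop) (≡.subst (R ∣_) (*-comm n J) d)

    order-a : ∀ {j} → UnitMod p j → HasOrder Γ (a j) (P * p)
    order-a {j} u = order-from (a-at j) 1≤p (n*≋0 j) (coprime-suc p) (cancel-coprime (proj₂ u))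

    ab-at : ∀ j → ∃ λ k → a j ∙ b at ⟨ j + M , t ^ M , 1 , k ⟩
    ab-at j = _ , at-∙ (a-at j) b-at

    coprime-+M : ∀ {j} → UnitMod p j → Coprime (j + M) M
    coprime-+M {j} u {d} (d∣j+M , d∣M) = proj₂ u (∣m+n∣m⇒∣n (≡.subst (d ∣_) (+-comm j M) d∣j+M) d∣M
      , ≡.subst (d ∣_) (≡.sym p-even) (∣n⇒∣m*n 2 d∣M))

    M-parity : ∃ λ r → (M ≡ 2 * r × P % 4 ≡ 1) ⊎ (M ≡ 1 + 2 * r × P % 4 ≡ 3)
    M-parity with parity M
    ... | r , inj₁ e = r , inj₁ (e , ≡.trans (≡.cong (_% 4) (≡.trans (≡.cong suc (≡.trans p-even (≡.cong (2 *_) e))) (four r))) ([m+kn]%n≡m%n 1 r 4))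
      where
      four : ∀ r → suc (2 * (2 * r)) ≡ 1 + r * 4
      four = solve-∀
    ... | r , inj₂ e = r , inj₂ (e , ≡.trans (≡.cong (_% 4) (≡.trans (≡.cong suc (≡.trans p-even (≡.cong (2 *_) e))) (four r))) ([m+kn]%n≡m%n 3 r 4))
      where
      four : ∀ r → suc (2 * (1 + 2 * r)) ≡ 3 + r * 4
      four = solve-∀

    -- The g-exponent of a b is j + M with j odd. Here M is even, so j + M is odd and a unit modulo
    -- p.
    order-ab₁ : ∀ {j} → UnitMod p j → P % 4 ≡ 1 → HasOrder Γ (a j ∙ b) (P * p)
    order-ab₁ {j} u h with M-parity
    ... | r , inj₂ (_ , e) = contradiction (≡.trans (≡.sym h) e) λ ()
    ... | r , inj₁ (e , _) = order-from (proj₂ (ab-at j)) 1≤p (n*≋0 (j + M)) (coprime-suc p)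
      (cancel-coprime (≡.subst (Coprime (j + M)) (≡.sym p-even) (coprime-* coprime-2 (coprime-+M u))))
      where
      coprime-2 : Coprime (j + M) 2
      coprime-2 {d} (d∣j+M , d∣2) with s , j≡ ← unit-odd u = ∣1⇒≡1 (∣m+n∣m⇒∣n
        (≡.subst (d ∣_) (≡.trans (≡.cong₂ _+_ j≡ e) (collect s r)) d∣j+M) (∣m⇒∣m*n (s + r) d∣2))
        where
        collect : ∀ s r → (1 + 2 * s) + 2 * r ≡ 2 * (s + r) + 1
        collect = solve-∀

    -- Here M is odd, so j + M is even and M already annihilates it modulo p = 2 M; this halves the
    -- order.
    order-ab₃ : ∀ {j} → UnitMod p j → P % 4 ≡ 3 → HasOrder Γ (a j ∙ b) ((P * p) / 2)
    order-ab₃ {j} u h with M-parity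
    ... | r , inj₁ (_ , e) = contradiction (≡.trans (≡.sym h) e) λ ()
    ... | r , inj₂ (e , _) = ≡.subst (HasOrder Γ (a j ∙ b)) P*M≡ (order-from (proj₂ (ab-at j))
        (≡.subst (1 ≤_) (≡.sym e) (s≤s z≤n)) (annihilates (unit-odd u)) coprime-P-M
        (λ n d → cancel-coprime (coprime-+M u) n (∣-trans (divides 2 p-even) d)))
      where
      P*M≡ : P * M ≡ (P * p) / 2
      P*M≡ = ≡.trans (≡.sym (m*n/n≡m (P * M) 2)) (≡.cong (_/ 2) (≡.trans (*-assoc P M 2)
        (≡.cong (P *_) (≡.trans (*-comm M 2) (≡.sym p-even)))))
      coprime-P-M : Coprime P M
      coprime-P-M (x , y) = coprime-suc p (x , ∣-trans y (divides 2 p-even))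
      annihilates : (∃ λ s → j ≡ 1 + 2 * s) → M * (j + M) ≋ 0 mod p
      annihilates (s , j≡) = ∣⇒≋0 (divides (1 + s + r) (≡.trans (≡.cong (M *_) (≡.cong₂ _+_ j≡ e))
        (≡.trans (collect M s r) (≡.cong ((1 + s + r) *_) (≡.sym p-even)))))
        where
        collect : ∀ M s r → M * ((1 + 2 * s) + (1 + 2 * r)) ≡ (1 + s + r) * (2 * M)
        collect = solve-∀

-- The action of G on the parts

≋-*-cancel-modulus : ∀ {x y n} m .{{_ : NonZero m}} → m * x ≋ m * y mod (m * n) → x ≋ y mod n
≋-*-cancel-modulus {x} {y} {n} m (shifts l r e) = shifts l r (*-cancelˡ-≡ (x + l * n) (y + r * n) m
  (≡.trans (≡.sym (expand m x l n)) (≡.trans e (expand m y r n))))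
  where
  expand : ∀ m x l n → m * x + l * (m * n) ≡ m * (x + l * n)
  expand = solve-∀

module Embedded (G : Group 0ℓ 0ℓ) (a b : Group.Carrier G) {p q : ℕ} {{_ : NonZero p}}
  (emb : EmbeddingOfK G a b (suc p) q) where

  open Group G
  open GroupLemmas G
  open GroupProperties G
  open EmbeddingOfK emb

  private
    P = suc p

  part : Carrier → Fin P
  part x = proj₁ (ν x)

  cancelʳ : ∀ x y → (x ∙ y) ∙ y ⁻¹ ≈ x
  cancelʳ x y = trans (assoc x y (y ⁻¹)) (trans (∙-congˡ (inverseʳ y)) (identityʳ x))

  cancelʳ′ : ∀ x y → (x ∙ y ⁻¹) ∙ y ≈ x
  cancelʳ′ x y = trans (assoc x (y ⁻¹) y) (trans (∙-congˡ (inverseˡ y)) (identityʳ x))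

  InCyclic-resp : ∀ {x y} → x ≈ y → InCyclic G a x → InCyclic G a y
  InCyclic-resp e (k , inj₁ h) = k , inj₁ (trans (sym e) h)
  InCyclic-resp e (k , inj₂ h) = k , inj₂ (trans (sym e) h)

  ν-a↑ : ∀ k x → ν (a ↑ k ∙ x) ≡ ν x
  ν-a↑ k x = ≡.sym (Equivalence.from (ν-coset x (a ↑ k ∙ x)) (k , inj₁ (cancelʳ (a ↑ k) x)))

  ν-cong : ∀ {x y} → x ≈ y → ν x ≡ ν y
  ν-cong {x} {y} e = Equivalence.from (ν-coset x y) (0 , inj₁ (trans (∙-congʳ (sym e)) (inverseʳ x)))

  part-cong : ∀ {x y} → x ≈ y → part x ≡ part y
  part-cong e = ≡.cong proj₁ (ν-cong e)

  ν-∙ : ∀ {x y} u → ν x ≡ ν y → ν (x ∙ u) ≡ ν (y ∙ u)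
  ν-∙ {x} {y} u e = Equivalence.from (ν-coset (x ∙ u) (y ∙ u))
    (InCyclic-resp (sym (trans (∙-congˡ (⁻¹-anti-homo-∙ x u)) (trans (sym (assoc _ _ _)) (∙-congʳ (cancelʳ y u)))))
      (Equivalence.to (ν-coset x y) e))

  ν-∙-cancel : ∀ {x y} u → ν (x ∙ u) ≡ ν (y ∙ u) → ν x ≡ ν y
  ν-∙-cancel {x} {y} u e = ≡.trans (≡.sym (ν-cong (cancelʳ x u))) (≡.trans (ν-∙ (u ⁻¹) e) (ν-cong (cancelʳ y u)))

  abstract
    -- Vertices in different parts are joined by an arc. If translation by u separated x and y, the
    -- inverse translate of that arc would have both ends in one part.
    part-∙ : ∀ {x y} u → part x ≡ part y → part (x ∙ u) ≡ part (y ∙ u)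
    part-∙ {x} {y} u e = decidable-stable (part (x ∙ u) Finₚ.≟ part (y ∙ u)) λ ne →
      let k , k-start , k-end = arc-surj (ν (x ∙ u)) (ν (y ∙ u)) ne
          start = ≡.trans (ν-∙ (u ⁻¹) k-start) (ν-cong (cancelʳ x u))
          end   = ≡.trans (ν-cong (sym (assoc b k (u ⁻¹)))) (≡.trans (ν-∙ (u ⁻¹) k-end) (ν-cong (cancelʳ y u)))
      in arc-ok (k ∙ u ⁻¹) (≡.trans (≡.cong proj₁ start) (≡.trans e (≡.sym (≡.cong proj₁ end))))

  part-∙-cancel : ∀ {x y} u → part (x ∙ u) ≡ part (y ∙ u) → part x ≡ part y
  part-∙-cancel {x} {y} u e = ≡.trans (≡.sym (part-cong (cancelʳ x u)))
    (≡.trans (part-∙ (u ⁻¹) e) (part-cong (cancelʳ y u)))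

  abstract
    -- Vertices in different parts are the ends of an arc, and elements are determined by the image
    -- of an arc.
    ν-faithful : ∀ {x y u v} → part x ≢ part y → ν (x ∙ u) ≡ ν (x ∙ v) → ν (y ∙ u) ≡ ν (y ∙ v) → u ≈ v
    ν-faithful {x} {y} {u} {v} ne e f with k , k-start , k-end ← arc-surj (ν x) (ν y) ne =
      ∙-cancelˡ k u v (arc-inj (k ∙ u) (k ∙ v)
        (≡.trans (ν-∙ u k-start) (≡.trans e (≡.sym (ν-∙ v k-start))))
        (≡.trans (end u) (≡.trans f (≡.sym (end v)))))
      where
      end : ∀ u → ν (b ∙ (k ∙ u)) ≡ ν (y ∙ u)
      end u = ≡.trans (ν-cong (sym (assoc b k u))) (ν-∙ u k-end)

  part-a↑ : ∀ k → part (a ↑ k) ≡ part ε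
  part-a↑ k = ≡.cong proj₁ (≡.trans (ν-cong (sym (identityʳ (a ↑ k)))) (ν-a↑ k ε))

  ν-a↑ε : ∀ k → ν (a ↑ k) ≡ ν ε
  ν-a↑ε k = ≡.trans (ν-cong (sym (identityʳ (a ↑ k)))) (ν-a↑ k ε)

  off : ∀ k → part ε ≢ part (b ∙ a ↑ k)
  off k e = arc-ok (a ↑ k) (≡.trans (part-a↑ k) e)

  part-b : part ε ≢ part b
  part-b e = off 0 (≡.trans e (part-cong (sym (identityʳ b))))

  ∙↑-suc : ∀ x y k → x ∙ y ↑ suc k ≈ (x ∙ y ↑ k) ∙ y
  ∙↑-suc x y k = trans (∙-congˡ (↑-suc y k)) (sym (assoc _ _ _))

  private
    vertex : ℕ → Fin (P * q)
    vertex i = combine (part (b ∙ a ↑ i)) (proj₂ (ν (b ∙ a ↑ i)))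

    vertex-inj : ∀ i j → vertex i ≡ vertex j → a ↑ i ≈ a ↑ j
    vertex-inj i j e = arc-inj _ _ (≡.trans (ν-a↑ε i) (≡.sym (ν-a↑ε j)))
      (≡.cong₂ _,_ (combine-injectiveˡ (part (b ∙ a ↑ i)) _ (part (b ∙ a ↑ j)) _ e)
                   (combine-injectiveʳ (part (b ∙ a ↑ i)) _ (part (b ∙ a ↑ j)) _ e))

    torsion-from : ∀ {m} → (∃₂ λ (i j : Fin m) → i Fin.< j × vertex (toℕ i) ≡ vertex (toℕ j)) →
      ∃ λ n → 1 ≤ n × a ↑ n ≈ ε
    torsion-from (i , j , i<j , e) = toℕ j ∸ toℕ i , m<n⇒0<n∸m i<j , ∙-cancelˡ (a ↑ toℕ i) _ _ (begin
      a ↑ toℕ i ∙ a ↑ (toℕ j ∸ toℕ i)   ≈⟨ ↑-+ a (toℕ i) _ ⟨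
      a ↑ (toℕ i + (toℕ j ∸ toℕ i))     ≈⟨ ↑-≡ a (m+[n∸m]≡n (<⇒≤ i<j)) ⟩
      a ↑ toℕ j                         ≈⟨ vertex-inj (toℕ i) (toℕ j) e ⟨
      a ↑ toℕ i                         ≈⟨ identityʳ _ ⟨
      a ↑ toℕ i ∙ ε                     ∎)
      where open SetoidReasoning setoid

  abstract
    -- The arcs at `ν ε` end in finitely many vertices, and the end determines the power of a, so
    -- two powers coincide.
    a-torsion : ∃ λ n → 1 ≤ n × a ↑ n ≈ ε
    a-torsion = torsion-from (pigeonhole (n<1+n (P * q)) (λ i → vertex (toℕ i)))

  torsion-⁻¹ : ∀ {x n} → 1 ≤ n → x ↑ n ≈ ε → ∀ k → (x ↑ k) ⁻¹ ≈ x ↑ (k * (n ∸ 1))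
  torsion-⁻¹ {x} {n} 1≤n e k = sym (inverseʳ-unique (x ↑ k) _ (trans (sym (↑-+ x k (k * (n ∸ 1))))
    (trans (↑-≡ x (≡.trans (collect k (n ∸ 1)) (≡.cong (k *_) (m+[n∸m]≡n 1≤n)))) (ε≈↑ k e))))
    where
    collect : ∀ k m → k + k * m ≡ k * (1 + m)
    collect = solve-∀

  abstract
    cyclic⇒power : ∀ {x} → InCyclic G a x → ∃ λ n → x ≈ a ↑ n
    cyclic⇒power (k , inj₁ e) = k , e
    cyclic⇒power (k , inj₂ e) with n , 1≤n , t ← a-torsion = k * (n ∸ 1) , trans e (torsion-⁻¹ 1≤n t k)

  abstract
    stabilizer : ∀ {x} → ν x ≡ ν ε → ∃ λ n → x ≈ a ↑ n
    stabilizer {x} e = cyclic⇒power (InCyclic-resp (trans (∙-congˡ ε⁻¹≈ε) (identityʳ x))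
      (Equivalence.to (ν-coset ε x) (≡.sym e)))

  abstract
    neighbour : ∀ v → part ε ≢ proj₁ v → ∃ λ n → ν (b ∙ a ↑ n) ≡ v
    neighbour v ne with k , start , end ← arc-surj (ν ε) v ne with n , e ← stabilizer start =
      n , ≡.trans (ν-cong (∙-congˡ (sym e))) end

  -- The parts met by successive neighbours of `ν ε`, with the base part removed. All p others
  -- occur, so a permutes them in one cycle of length p.
  Fₚ : ℕ → Fin p
  Fₚ k = punchOut (off k)

  private
    Fₚ-inj : ∀ k l → Fₚ k ≡ Fₚ l → part (b ∙ a ↑ k) ≡ part (b ∙ a ↑ l)
    Fₚ-inj k l e = punchOut-injective (off k) (off l) e

    Fₚ-cong : ∀ k l → part (b ∙ a ↑ k) ≡ part (b ∙ a ↑ l) → Fₚ k ≡ Fₚ l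
    Fₚ-cong k l e = Finₚ.punchOut-cong (part ε) e

    step : ∀ k l → part (b ∙ a ↑ k) ≡ part (b ∙ a ↑ l) → part (b ∙ a ↑ suc k) ≡ part (b ∙ a ↑ suc l)
    step k l e = ≡.trans (part-cong (∙↑-suc b a k)) (≡.trans (part-∙ a e) (part-cong (sym (∙↑-suc b a l))))

    unstep : ∀ k l → part (b ∙ a ↑ suc k) ≡ part (b ∙ a ↑ suc l) → part (b ∙ a ↑ k) ≡ part (b ∙ a ↑ l)
    unstep k l e = part-∙-cancel a (≡.trans (part-cong (sym (∙↑-suc b a k))) (≡.trans e (part-cong (∙↑-suc b a l))))

    module Oₚ = Orbit Fₚ
      (λ k l e → Fₚ-cong (suc k) (suc l) (step k l (Fₚ-inj k l e)))
      (λ k l e → Fₚ-cong k l (unstep k l (Fₚ-inj (suc k) (suc l) e)))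

    hits-part : ∀ i n → part (b ∙ a ↑ n) ≡ punchIn (part ε) i → Fₚ n ≡ i
    hits-part i n e = ≡.trans
      (Finₚ.punchOut-cong (part ε) {i≢k = λ e → punchInᵢ≢i (part ε) i (≡.sym e)} e) (punchOut-punchIn (part ε))

    abstract
      Fₚ-surj : ∀ i → ∃ λ k → Fₚ k ≡ i
      Fₚ-surj i with n , e ← neighbour (punchIn (part ε) i , proj₂ (ν ε)) (λ e → punchInᵢ≢i (part ε) i (≡.sym e)) =
        n , hits-part i n (≡.cong proj₁ e)

    module Fullₚ = Oₚ.Full (Oₚ.surjective⇒least Fₚ-surj)

  part-ba↑ : ∀ {k l} → k ≋ l mod p → part (b ∙ a ↑ k) ≡ part (b ∙ a ↑ l)
  part-ba↑ {k} {l} e = Fₚ-inj k l (Fullₚ.≋⇒F e)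

  part-ba↑⁻¹ : ∀ k l → part (b ∙ a ↑ k) ≡ part (b ∙ a ↑ l) → k ≋ l mod p
  part-ba↑⁻¹ k l e = Fullₚ.F⇒≋ (Fₚ-cong k l e)

  abstract
    other-part : ∀ x → part ε ≢ part x → ∃ λ k → part x ≡ part (b ∙ a ↑ k)
    other-part x ne with k , e ← Fₚ-surj (punchOut ne) = k , ≡.sym (punchOut-injective (off k) ne e)

  Fᵥ : ℕ → Fin (p * q)
  Fᵥ k = combine (Fₚ k) (proj₂ (ν (b ∙ a ↑ k)))

  private
    Fᵥ-inj : ∀ k l → Fᵥ k ≡ Fᵥ l → ν (b ∙ a ↑ k) ≡ ν (b ∙ a ↑ l)
    Fᵥ-inj k l e = ≡.cong₂ _,_ (Fₚ-inj k l (combine-injectiveˡ (Fₚ k) _ (Fₚ l) _ e)) (combine-injectiveʳ (Fₚ k) _ (Fₚ l) _ e)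

    Fᵥ-cong : ∀ k l → ν (b ∙ a ↑ k) ≡ ν (b ∙ a ↑ l) → Fᵥ k ≡ Fᵥ l
    Fᵥ-cong k l e = ≡.cong₂ combine (Fₚ-cong k l (≡.cong proj₁ e)) (≡.cong proj₂ e)

    module Oᵥ = Orbit Fᵥ
      (λ k l e → Fᵥ-cong (suc k) (suc l) (≡.trans (ν-cong (∙↑-suc b a k))
        (≡.trans (ν-∙ a (Fᵥ-inj k l e)) (ν-cong (sym (∙↑-suc b a l))))))
      (λ k l e → Fᵥ-cong k l (ν-∙-cancel a (≡.trans (ν-cong (sym (∙↑-suc b a k)))
        (≡.trans (Fᵥ-inj (suc k) (suc l) e) (ν-cong (∙↑-suc b a l))))))

    abstract
      Fᵥ-surj : ∀ i → ∃ λ k → Fᵥ k ≡ i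
      Fᵥ-surj i with i₁ , i₂ , ≡.refl ← combine-surjective {p} {q} i
        with n , e ← neighbour (punchIn (part ε) i₁ , i₂) (λ e → punchInᵢ≢i (part ε) i₁ (≡.sym e)) =
        n , ≡.cong₂ combine (hits-part i₁ n (≡.cong proj₁ e)) (≡.cong proj₂ e)

    module Fullᵥ = Oᵥ.Full (Oᵥ.surjective⇒least Fᵥ-surj)

    same-a↑ : ∀ k l → ν (b ∙ a ↑ k) ≡ ν (b ∙ a ↑ l) → a ↑ k ≈ a ↑ l
    same-a↑ k l e = arc-inj (a ↑ k) (a ↑ l) (≡.trans (ν-a↑ε k) (≡.sym (ν-a↑ε l))) e

  abstract
    -- The neighbours of `ν ε`, as many as `p * q`, form one cycle under a, and a power of a that
    -- fixes one of them fixes an arc.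
    a-order : a ↑ (p * q) ≈ ε
    a-order = same-a↑ (p * q) 0 (Fᵥ-inj (p * q) 0 Fullᵥ.full-period)

  abstract
    a↑-inj : ∀ k l → a ↑ k ≈ a ↑ l → k ≋ l mod (p * q)
    a↑-inj k l e = Fullᵥ.F⇒≋ (Fᵥ-cong k l (ν-cong (∙-congˡ e)))

  infix 4 _~_
  _~_ : Carrier → Carrier → Set
  x ~ y = ∀ g → part (g ∙ x) ≡ part (g ∙ y)

  ≈⇒~ : ∀ {x y} → x ≈ y → x ~ y
  ≈⇒~ e g = part-cong (∙-congˡ e)

  ~-∙ : ∀ {x y u v} → x ~ y → u ~ v → x ∙ u ~ y ∙ v
  ~-∙ {x} {y} {u} {v} e f g = ≡.trans (part-cong (sym (assoc g x u))) (≡.trans (part-∙ u (e g))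
    (≡.trans (f (g ∙ y)) (part-cong (assoc g y v))))

  ~-⁻¹ : ∀ {x y} → x ~ y → x ⁻¹ ~ y ⁻¹
  ~-⁻¹ {x} {y} e g = part-∙-cancel y (≡.trans (≡.sym (e (g ∙ x ⁻¹)))
    (part-cong (trans (cancelʳ′ g x) (sym (cancelʳ′ g y)))))

  -- The carrier is kept and only the equality is coarsened, so every general group lemma applies
  -- verbatim modulo `H`.
  G/H : Group 0ℓ 0ℓ
  G/H = record
    { Carrier = Carrier ; _≈_ = _~_ ; _∙_ = _∙_ ; ε = ε ; _⁻¹ = _⁻¹
    ; isGroup = record
      { isMonoid = record
        { isSemigroup = record
          { isMagma = record
            { isEquivalence = record { refl = λ g → ≡.refl ; sym = λ e g → ≡.sym (e g) ; trans = λ e f g → ≡.trans (e g) (f g) }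
            ; ∙-cong = ~-∙ }
          ; assoc = λ x y z → ≈⇒~ (assoc x y z) }
        ; identity = (λ x → ≈⇒~ (identityˡ x)) , (λ x → ≈⇒~ (identityʳ x)) }
      ; inverse = (λ x → ≈⇒~ (inverseˡ x)) , (λ x → ≈⇒~ (inverseʳ x))
      ; ⁻¹-cong = ~-⁻¹ } }

  module Q = Group G/H
  module Qₗ = GroupLemmas G/H

  ↑/H : ∀ x n → x Qₗ.↑ n ≡ x ↑ n
  ↑/H x zero    = ≡.refl
  ↑/H x (suc n) = ≡.cong (x ∙_) (↑/H x n)

  ~-↑ : ∀ {x y} n → x ~ y → x ↑ n ~ y ↑ n
  ~-↑ {x} {y} n e = ≡.subst₂ _~_ (↑/H x n) (↑/H y n) (Qₗ.↑-cong n e)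

  InH⇒~ : ∀ {x} → InH x → x ~ ε
  InH⇒~ h g = ≡.trans (h g) (part-cong (sym (identityʳ g)))

  ~⇒InH : ∀ {x} → x ~ ε → InH x
  ~⇒InH h g = ≡.trans (h g) (part-cong (identityʳ g))

  InH-≈ : ∀ {x y} → x ≈ y → InH x → InH y
  InH-≈ e h g = ≡.trans (part-cong (∙-congˡ (sym e))) (h g)

  InH-∙ : ∀ {x y} → InH x → InH y → InH (x ∙ y)
  InH-∙ {x} {y} h k g = ≡.trans (part-cong (sym (assoc g x y))) (≡.trans (k (g ∙ x)) (h g))

  InH-ε : InH ε
  InH-ε g = part-cong (identityʳ g)

  InH-⁻¹ : ∀ {x} → InH x → InH (x ⁻¹)
  InH-⁻¹ {x} h g = ≡.trans (≡.sym (h (g ∙ x ⁻¹))) (part-cong (cancelʳ′ g x))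

  InH-↑ : ∀ {x} n → InH x → InH (x ↑ n)
  InH-↑ zero    h = InH-ε
  InH-↑ (suc n) h = InH-∙ h (InH-↑ n h)

  InH-conj : ∀ {x} u → InH x → InH (conj G x u)
  InH-conj {x} u h g = ≡.trans (part-cong (trans (sym (assoc _ _ _)) (∙-congʳ (sym (assoc _ _ _)))))
    (≡.trans (part-∙ u (h (g ∙ u ⁻¹))) (part-cong (cancelʳ′ g u)))

  abstract
    ~⇒∙ : ∀ {x y} → x ~ y → ∃ λ η → InH η × x ≈ y ∙ η
    ~⇒∙ {x} {y} e = y ⁻¹ ∙ x , ~⇒InH (Q.trans (~-∙ {y ⁻¹} Q.refl e) (≈⇒~ (inverseˡ y))) ,
      sym (trans (sym (assoc y (y ⁻¹) x)) (trans (∙-congʳ (inverseʳ y)) (identityˡ x)))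

  abstract
    a↑-InH : ∀ {k} → k ≋ 0 mod p → InH (a ↑ k)
    a↑-InH {k} e x with part ε Finₚ.≟ part x
    ... | yes h = ≡.trans (part-∙ (a ↑ k) (≡.sym h)) (≡.trans (part-cong (identityˡ _)) (≡.trans (part-a↑ k) h))
    ... | no  h with l , f ← other-part x h = ≡.trans (part-∙ (a ↑ k) f) (≡.trans
      (part-cong (trans (assoc _ _ _) (∙-congˡ (sym (↑-+ a l k)))))
      (≡.trans (part-ba↑ (≋-trans (≋-+ (≋-refl {x = l}) e) (≋-reflexive (+-identityʳ l)))) (≡.sym f)))

  abstract
    -- The powers of a act on the p parts other than the base part as the powers of a p-cycle, so
    -- fixing one of them means p ∣ k.
    a↑-fixes⇒ : ∀ k x → part ε ≢ part x → part (x ∙ a ↑ k) ≡ part x → k ≋ 0 mod p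
    a↑-fixes⇒ k x ne e with l , f ← other-part x ne = ≋-+-cancelˡ l (≋-trans (part-ba↑⁻¹ (l + k) l (≡.trans
      (part-cong (trans (∙-congˡ (↑-+ a l k)) (sym (assoc _ _ _)))) (≡.trans (part-∙ (a ↑ k) (≡.sym f)) (≡.trans e f))))
      (≋-reflexive (≡.sym (+-identityʳ l))))

  -- Inverted so that a = w aᴾ, the splitting of a into its part in `H` and a power of g.
  w : Carrier
  w = (a ↑ p) ⁻¹

  ⁻¹-↑ : ∀ x n → (x ⁻¹) ↑ n ≈ (x ↑ n) ⁻¹
  ⁻¹-↑ x n = inverseʳ-unique (x ↑ n) _ (trans (sym (∙-↑ n (trans (inverseʳ x) (sym (inverseˡ x)))))
    (trans (↑-cong n (inverseʳ x)) (ε-↑ n)))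

  w-InH : InH w
  w-InH = InH-⁻¹ (a↑-InH (∣⇒≋0 ∣-refl))

  w↑≈ : ∀ k → w ↑ k ≈ (a ↑ (p * k)) ⁻¹
  w↑≈ k = trans (⁻¹-↑ (a ↑ p) k) (⁻¹-cong (sym (↑-*′ a p k)))

  w-order : w ↑ q ≈ ε
  w-order = trans (w↑≈ q) (trans (⁻¹-cong a-order) ε⁻¹≈ε)

  abstract
    w↑-inj : ∀ k l → w ↑ k ≈ w ↑ l → k ≋ l mod q
    w↑-inj k l e = ≋-*-cancel-modulus p (a↑-inj (p * k) (p * l)
      (⁻¹-injective (trans (sym (w↑≈ k)) (trans e (w↑≈ l)))))

  ν-w↑ : ∀ k → ν (w ↑ k) ≡ ν ε
  ν-w↑ k = ≡.trans (ν-cong (trans (w↑≈ k) (sym (identityˡ _))))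
    (≡.trans (≡.sym (ν-∙ ((a ↑ (p * k)) ⁻¹) (ν-a↑ε (p * k)))) (ν-cong (inverseʳ _)))

-- The kernel of the action and elements acting as full cycles.

module Kernel (G : Group 0ℓ 0ℓ) (a b : Group.Carrier G) {p q : ℕ} {{_ : NonZero p}}
  (emb : EmbeddingOfK G a b (suc p) q) where

  open Group G
  open GroupLemmas G
  open GroupProperties G
  open EmbeddingOfK emb
  open Embedded G a b emb public

  private
    P = suc p

  1≤q : 1 ≤ q
  1≤q = ≤-<-trans z≤n (toℕ<n (proj₂ (ν ε)))

  abstract
    stabilizer-H : ∀ {x} → InH x → ν x ≡ ν ε → ∃ λ k → x ≈ w ↑ k
    stabilizer-H {x} h e =
      let n , x≈ = stabilizer e in from n x≈ (≋0⇒∣ (a↑-fixes⇒ n b part-b (InH-≈ x≈ h b)))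
      where
      from : ∀ n → x ≈ a ↑ n → p ∣ n → ∃ λ k → x ≈ w ↑ k
      from n x≈ (divides m ≡.refl) = m * (q ∸ 1) , (begin
        x                        ≈⟨ x≈ ⟩
        a ↑ (m * p)              ≈⟨ ↑-≡ a (*-comm m p) ⟩
        a ↑ (p * m)              ≈⟨ ⁻¹-involutive _ ⟨
        (a ↑ (p * m)) ⁻¹ ⁻¹      ≈⟨ ⁻¹-cong (w↑≈ m) ⟨
        (w ↑ m) ⁻¹               ≈⟨ torsion-⁻¹ 1≤q w-order m ⟩
        w ↑ (m * (q ∸ 1))        ∎)
        where open SetoidReasoning setoid

  -- w′ generates the stabilizer in H of the vertex ν y.
  module At (y : Carrier) (ne : part ε ≢ part y) where

    w′ : Carrier
    w′ = conj G w y

    w′-InH : InH w′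
    w′-InH = InH-conj y w-InH

    w′-slide : ∀ k → w ↑ k ∙ y ≈ y ∙ w′ ↑ k
    w′-slide k = slide-↑ k (slide-conj w y)

    ν-w′ : ∀ k → ν (y ∙ w′ ↑ k) ≡ ν y
    ν-w′ k = ≡.trans (ν-cong (sym (w′-slide k))) (≡.trans (ν-∙ y (ν-w↑ k)) (ν-cong (identityˡ y)))

    -- Powers of `w′` fix the vertex of y. If two of them also agree at `ν ε`, they agree at two
    -- vertices in different parts and are equal.
    ν-w′-inj : ∀ k l → ν (w′ ↑ k) ≡ ν (w′ ↑ l) → k ≋ l mod q
    ν-w′-inj k l e = w↑-inj k l (∙-cancelʳ y _ _ (trans (w′-slide k) (trans (∙-congˡ same) (sym (w′-slide l)))))
      where
      same : w′ ↑ k ≈ w′ ↑ l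
      same = ν-faithful ne (≡.trans (ν-cong (identityˡ _)) (≡.trans e (ν-cong (sym (identityˡ _)))))
        (≡.trans (ν-w′ k) (≡.sym (ν-w′ l)))

    part-w′ : ∀ k → part (w′ ↑ k) ≡ part ε
    part-w′ k = ≡.trans (part-cong (sym (identityˡ _))) (InH-↑ k w′-InH ε)

    private
      f : Fin q → Fin q
      f i = proj₂ (ν (w′ ↑ toℕ i))

      f-inj : ∀ {i j : Fin q} → f i ≡ f j → i ≡ j
      f-inj {i} {j} e = toℕ-injective (≋⇒≡ (toℕ<n i) (toℕ<n j) (ν-w′-inj (toℕ i) (toℕ j)
        (≡.cong₂ _,_ (≡.trans (part-w′ (toℕ i)) (≡.sym (part-w′ (toℕ j)))) e)))

    abstract
      -- The q powers of `w′` send `ν ε` to distinct vertices of its part, which has just q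
      -- vertices.
      transitive : ∀ x → part x ≡ part ε → ∃ λ k → ν (w′ ↑ k) ≡ ν x
      transitive x h = let i , e = injective⇒surjective f f-inj (proj₂ (ν x)) in
        toℕ i , ≡.cong₂ _,_ (≡.trans (part-w′ (toℕ i)) (≡.sym h)) e

    abstract
      decompose : ∀ x → part x ≡ part ε → ∃₂ λ n k → x ≈ a ↑ n ∙ w′ ↑ k
      decompose x h =
        let k , e = transitive x h
            n , f = cyclic⇒power (Equivalence.to (ν-coset (w′ ↑ k) x) e)
        in n , k , trans (sym (cancelʳ′ x (w′ ↑ k))) (∙-congʳ f)

    abstract
      decompose-H : ∀ {x} → InH x → ∃₂ λ i k → x ≈ w ↑ i ∙ w′ ↑ k
      decompose-H {x} h =
        let n , k , e = decompose x (≡.trans (part-cong (sym (identityˡ x))) (h ε))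
            i , f = stabilizer-H (InH-≈ (trans (∙-congʳ e) (cancelʳ (a ↑ n) (w′ ↑ k)))
                      (InH-∙ h (InH-⁻¹ (InH-↑ k w′-InH)))) (ν-a↑ε n)
        in i , k , trans e (∙-congʳ f)

  abstract
    -- After conjugation one of the fixed parts is the base part, and x is a power of a times an
    -- element of `H`. The power of a then fixes a second part, which puts it in `H`.
    fixes-two-parts : ∀ {x g h} → part g ≢ part h → part (g ∙ x) ≡ part g → part (h ∙ x) ≡ part h → InH x
    fixes-two-parts {x} {g} {h} ne eg eh = InH-≈ unconj (InH-conj g (base (g ∙ (x ∙ g ⁻¹)) (h ∙ g ⁻¹) ne′ eg′ eh′))
      where
      open At b part-b
      base : ∀ x h → part ε ≢ part h → part x ≡ part ε → part (h ∙ x) ≡ part h → InH x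
      base x h ne e f = let n , k , x≈ = decompose x e in InH-≈ (sym x≈) (InH-∙ (a↑-InH (a↑-fixes⇒ n h ne
        (≡.trans (≡.sym (InH-↑ k w′-InH (h ∙ a ↑ n))) (≡.trans (part-cong (trans (assoc h _ _) (∙-congˡ (sym x≈)))) f))))
        (InH-↑ k w′-InH))
      ne′ : part ε ≢ part (h ∙ g ⁻¹)
      ne′ e = ne (part-∙-cancel (g ⁻¹) (≡.trans (part-cong (inverseʳ g)) e))
      eg′ : part (g ∙ (x ∙ g ⁻¹)) ≡ part ε
      eg′ = ≡.trans (part-cong (sym (assoc g x (g ⁻¹)))) (≡.trans (part-∙ (g ⁻¹) eg) (part-cong (inverseʳ g)))
      eh′ : part ((h ∙ g ⁻¹) ∙ (g ∙ (x ∙ g ⁻¹))) ≡ part (h ∙ g ⁻¹)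
      eh′ = ≡.trans (part-cong (trans (sym (assoc _ _ _)) (trans (∙-congʳ (cancelʳ′ h g)) (sym (assoc h x (g ⁻¹))))))
        (part-∙ (g ⁻¹) eh)
      unconj : conj G (g ∙ (x ∙ g ⁻¹)) g ≈ x
      unconj = slide⇒conj (trans (assoc _ _ _) (∙-congˡ (cancelʳ′ x g)))

  InH? : ∀ x → Dec (InH x)
  InH? x with part (ε ∙ x) Finₚ.≟ part ε | part (b ∙ x) Finₚ.≟ part b
  ... | yes e | yes f = yes (fixes-two-parts part-b e f)
  ... | no ne | _     = no λ h → ne (h ε)
  ... | _     | no ne = no λ h → ne (h b)

  -- y acts on the parts as a (p + 1)-cycle.
  Cyclic : Carrier → Set
  Cyclic y = ∀ d → 1 ≤ d → part (y ↑ d) ≡ part ε → P ≤ d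

  module Translates (g y : Carrier) where

    F : ℕ → Fin P
    F k = part (g ∙ y ↑ k)

    fwd : ∀ k l → F k ≡ F l → F (suc k) ≡ F (suc l)
    fwd k l e = ≡.trans (part-cong (∙↑-suc g y k)) (≡.trans (part-∙ y e) (part-cong (sym (∙↑-suc g y l))))

    bwd : ∀ k l → F (suc k) ≡ F (suc l) → F k ≡ F l
    bwd k l e = part-∙-cancel y (≡.trans (part-cong (sym (∙↑-suc g y k))) (≡.trans e (part-cong (∙↑-suc g y l))))

    open Orbit F fwd bwd public

  abstract
    -- A full cycle through the part of g also meets the base part, and a return to the latter is a
    -- period of the whole orbit.
    least⇒cyclic : ∀ g y → Translates.Least g y → Cyclic y
    least⇒cyclic g y least d 1≤d e = let s , _ , f = Translates.Full.hit g y least (part ε) in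
      least d 1≤d (Translates.unshift g y s (≡.trans (part-cong (trans (∙-congˡ (↑-+ y s d)) (sym (assoc _ _ _))))
        (≡.trans (part-∙ (y ↑ d) f) (≡.trans (part-cong (identityˡ _)) (≡.trans e (≡.trans (≡.sym f)
          (part-cong (∙-congˡ (↑-≡ y (≡.sym (+-identityʳ s)))))))))))

  module CyclicLemmas {y : Carrier} (cyc : Cyclic y) where

    private
      least : Translates.Least ε y
      least d 1≤d e = cyc d 1≤d (≡.trans (part-cong (sym (identityˡ _))) (≡.trans e (part-cong (identityˡ ε))))

      module T = Translates ε y
      module Fl = T.Full least

    part-y↑ : ∀ {k l} → k ≋ l mod P → part (y ↑ k) ≡ part (y ↑ l)
    part-y↑ {k} {l} e = ≡.trans (part-cong (sym (identityˡ _))) (≡.trans (Fl.≋⇒F e) (part-cong (identityˡ _)))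

    part-y↑⁻¹ : ∀ k l → part (y ↑ k) ≡ part (y ↑ l) → k ≋ l mod P
    part-y↑⁻¹ k l e = Fl.F⇒≋ (≡.trans (part-cong (identityˡ _)) (≡.trans e (part-cong (sym (identityˡ _)))))

    abstract
      hit : ∀ g → ∃ λ k → k < P × part (y ↑ k) ≡ part g
      hit g = let k , k<P , e = Fl.hit (part g) in k , k<P , ≡.trans (part-cong (sym (identityˡ _))) e

    part-ε≢ : part ε ≢ part y
    part-ε≢ e = <⇒≱ (s≤s (>-nonZero⁻¹ p)) (cyc 1 (s≤s z≤n) (≡.trans (part-cong (↑-1 y)) (≡.sym e)))

    ↑P-InH : InH (y ↑ P)
    ↑P-InH g = let k , _ , e = hit g in ≡.trans (part-∙ (y ↑ P) (≡.sym e)) (≡.trans (part-cong (sym (↑-+ y k P)))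
      (≡.trans (part-y↑ (≋-trans (≋-+ (≋-refl {x = k}) (∣⇒≋0 ∣-refl)) (≋-reflexive (+-identityʳ k)))) e))

    -- x moves the part of yˡ to that of yˡ⁺ᵏ for some k ≠ 0; two of the p + 1 values of l share the
    -- same k, and then x yᵏ⁻¹ fixes two parts.
    abstract
      fixed-point-free⇒power : ∀ x → (∀ g → part (g ∙ x) ≢ part g) → ∃ λ k → ¬ (P ∣ k) × x ~ y ↑ k
      fixed-point-free⇒power x fpf = conclude (pigeonhole (n<1+n p) (λ i → punchOut (jump≢0 i)))
        where
        target : Fin P → ℕ
        target i = proj₁ (hit (y ↑ toℕ i ∙ x))
        jump : Fin P → ℕ
        -- Multiplication by p is negation modulo P, so this is the difference of target and source.
        jump i = (target i + p * toℕ i) % P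
        jump-≋ : ∀ i → toℕ i + jump i ≋ target i mod P
        jump-≋ i = ≋-trans (≋-+ (≋-refl {x = toℕ i}) (≋-% (target i + p * toℕ i)))
          (≋-trans (≋-reflexive (collect (toℕ i) (target i) p)) (≋-trans (≋-+ (≋-refl {x = target i}) (n*≋0 (toℕ i))) (≋-reflexive (+-identityʳ _))))
          where
          collect : ∀ i t p → i + (t + p * i) ≡ t + suc p * i
          collect = solve-∀
        moves : ∀ i → part (y ↑ toℕ i ∙ x) ≡ part (y ↑ toℕ i ∙ y ↑ jump i)
        moves i = ≡.trans (≡.sym (proj₂ (proj₂ (hit (y ↑ toℕ i ∙ x))))) (≡.trans (part-y↑ (≋-sym (jump-≋ i))) (part-cong (↑-+ y (toℕ i) (jump i))))
        P∤jump : ∀ i → ¬ (P ∣ jump i)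
        P∤jump i d = fpf (y ↑ toℕ i) (≡.trans (moves i) (≡.trans (part-cong (sym (↑-+ y (toℕ i) (jump i))))
          (part-y↑ (≋-trans (≋-+ (≋-refl {x = toℕ i}) (∣⇒≋0 d)) (≋-reflexive (+-identityʳ _))))))
        jump<P : ∀ i → jump i < P
        jump<P i = m%n<n (target i + p * toℕ i) P
        jump≢0 : ∀ i → Fin.zero ≢ fromℕ< (jump<P i)
        jump≢0 i e = P∤jump i (≡.subst (P ∣_) (≡.trans (≡.cong toℕ e) (toℕ-fromℕ< (jump<P i))) (P ∣0))
        fixes : ∀ i → part (y ↑ toℕ i ∙ (x ∙ (y ↑ jump i) ⁻¹)) ≡ part (y ↑ toℕ i)
        fixes i = ≡.trans (part-cong (sym (assoc _ _ _))) (≡.trans (part-∙ ((y ↑ jump i) ⁻¹) (moves i)) (part-cong (cancelʳ _ _)))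
        conclude : (∃₂ λ i j → i Fin.< j × punchOut (jump≢0 i) ≡ punchOut (jump≢0 j)) → ∃ λ k → ¬ (P ∣ k) × x ~ y ↑ k
        conclude (i , j , i<j , e) = jump i , P∤jump i , Q.trans (≈⇒~ (sym (cancelʳ′ x (y ↑ jump i))))
          (Q.trans (~-∙ (InH⇒~ (fixes-two-parts distinct (fixes i)
            (≡.trans (part-cong (∙-congˡ (∙-congˡ (⁻¹-cong (↑-≡ y same))))) (fixes j)))) Q.refl) (≈⇒~ (identityˡ _)))
          where
          same : jump i ≡ jump j
          same = ≡.trans (≡.sym (toℕ-fromℕ< (jump<P i))) (≡.trans (≡.cong toℕ (punchOut-injective (jump≢0 i) (jump≢0 j) e)) (toℕ-fromℕ< (jump<P j)))
          distinct : part (y ↑ toℕ i) ≢ part (y ↑ toℕ j)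
          distinct f = Finₚ.<⇒≢ i<j (toℕ-injective (≋⇒≡ (toℕ<n i) (toℕ<n j) (part-y↑⁻¹ (toℕ i) (toℕ j) f)))

-- Linear algebra over an abelian kernel.

module Abelian (G : Group 0ℓ 0ℓ) (a b : Group.Carrier G) {p q : ℕ} {{_ : NonZero p}}
  (emb : EmbeddingOfK G a b (suc p) q)
  (H-abelian : ∀ x y → EmbeddingOfK.InH emb x → EmbeddingOfK.InH emb y →
     Group._≈_ G (Group._∙_ G x y) (Group._∙_ G y x)) where

  open Group G
  open GroupLemmas G
  open GroupProperties G
  open EmbeddingOfK emb using (ν; InH)
  open Kernel G a b emb public

  private
    P = suc p

  module Basis (y : Carrier) (ne : part ε ≢ part y) where

    open At y ne

    z : Carrier
    z = comm G w y

    wy : w ∙ y ≈ y ∙ (w ∙ z)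
    wy = slide-comm w y

    w′≈wz : w′ ≈ w ∙ z
    w′≈wz = slide⇒conj wy

    z-InH : InH z
    z-InH = InH-≈ (trans (∙-congˡ w′≈wz) (trans (sym (assoc _ _ _)) (trans (∙-congʳ (inverseˡ w)) (identityˡ z))))
      (InH-∙ (InH-⁻¹ w-InH) w′-InH)

    wz : w ∙ z ≈ z ∙ w
    wz = H-abelian w z w-InH z-InH

    wz-InH : ∀ i k → InH (w ↑ i ∙ z ↑ k)
    wz-InH i k = InH-∙ (InH-↑ i w-InH) (InH-↑ k z-InH)

    w′↑≈ : ∀ k → w′ ↑ k ≈ w ↑ k ∙ z ↑ k
    w′↑≈ k = trans (↑-cong k w′≈wz) (∙-↑ k wz)

    abstract
      z-order : z ↑ q ≈ ε
      z-order = begin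
        z ↑ q            ≈⟨ identityˡ _ ⟨
        ε ∙ z ↑ q        ≈⟨ ∙-congʳ w-order ⟨
        w ↑ q ∙ z ↑ q    ≈⟨ w′↑≈ q ⟨
        w′ ↑ q           ≈⟨ slide-unique (w′-slide q) (trans (∙-congʳ w-order) (slide-ε {y})) ⟩
        ε                ∎
        where open SetoidReasoning setoid

      coordinates : ∀ {x} → InH x → ∃₂ λ i k → x ≈ w ↑ i ∙ z ↑ k
      coordinates h = let i , k , e = decompose-H h in i + k , k ,
        trans e (trans (∙-congˡ (w′↑≈ k)) (trans (sym (assoc _ _ _)) (∙-congʳ (sym (↑-+ w i k)))))

      -- Multiplied by w^(k + k′) the equation relates powers of w and of w′ = w z, which generate
      -- stabilizers of adjacent vertices.
      independent : ∀ i k i′ k′ → w ↑ i ∙ z ↑ k ≈ w ↑ i′ ∙ z ↑ k′ → (i ≋ i′ mod q) × (k ≋ k′ mod q)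
      independent i k i′ k′ e = i≋ , k≋
        where
        open SetoidReasoning setoid
        side : ∀ i k k′ → w ↑ (k + k′) ∙ (w ↑ i ∙ z ↑ k) ≈ w ↑ (i + k′) ∙ w′ ↑ k
        side i k k′ = begin
          w ↑ (k + k′) ∙ (w ↑ i ∙ z ↑ k)          ≈⟨ assoc _ _ _ ⟨
          (w ↑ (k + k′) ∙ w ↑ i) ∙ z ↑ k          ≈⟨ ∙-congʳ (↑-+ w (k + k′) i) ⟨
          w ↑ (k + k′ + i) ∙ z ↑ k                ≈⟨ ∙-congʳ (↑-≡ w (collect k k′ i)) ⟩
          w ↑ (i + k′ + k) ∙ z ↑ k                ≈⟨ ∙-congʳ (↑-+ w (i + k′) k) ⟩
          (w ↑ (i + k′) ∙ w ↑ k) ∙ z ↑ k          ≈⟨ assoc _ _ _ ⟩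
          w ↑ (i + k′) ∙ (w ↑ k ∙ z ↑ k)          ≈⟨ ∙-congˡ (w′↑≈ k) ⟨
          w ↑ (i + k′) ∙ w′ ↑ k                   ∎
          where
          collect : ∀ k k′ i → k + k′ + i ≡ i + k′ + k
          collect = solve-∀
        both : w ↑ (i + k′) ∙ w′ ↑ k ≈ w ↑ (i′ + k) ∙ w′ ↑ k′
        both = trans (sym (side i k k′)) (trans (∙-cong (↑-≡ w (+-comm k k′)) e) (side i′ k′ k))
        ν-side : ∀ i k → ν (w ↑ i ∙ w′ ↑ k) ≡ ν (w′ ↑ k)
        ν-side i k = ≡.trans (ν-∙ (w′ ↑ k) (ν-w↑ i)) (ν-cong (identityˡ _))
        k≋ : k ≋ k′ mod q
        k≋ = ν-w′-inj k k′ (≡.trans (≡.sym (ν-side (i + k′) k)) (≡.trans (ν-cong both) (ν-side (i′ + k) k′)))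
        w′-order : w′ ↑ q ≈ ε
        w′-order = trans (w′↑≈ q) (trans (∙-cong w-order z-order) (identityˡ ε))
        i+k≋ : i + k′ ≋ i′ + k mod q
        i+k≋ = w↑-inj (i + k′) (i′ + k) (∙-cancelʳ (w′ ↑ k′) _ _ (trans (∙-congˡ (↑-mod w′-order (≋-sym k≋))) both))
        i≋ : i ≋ i′ mod q
        i≋ = ≋-+-cancelʳ k (≋-trans (≋-+ (≋-refl {x = i}) k≋) i+k≋)

    module Action (pr : Prime P) (4≤p : 4 ≤ p) (e : ℕ) (q≡ : q ≡ P ^ suc e) (y↑P : InH (y ↑ P)) where

      private
        -- The image of z under N; its coordinates u and v form the second column of the matrix, the
        -- first being z itself.
        δ : Carrier
        δ = z ⁻¹ ∙ conj G z y

        δ-InH : InH δ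
        δ-InH = InH-∙ (InH-⁻¹ z-InH) (InH-conj y z-InH)

        zy : z ∙ y ≈ y ∙ (z ∙ δ)
        zy = trans (slide-conj z y) (∙-congˡ (sym (trans (sym (assoc _ _ _)) (trans (∙-congʳ (inverseʳ z)) (identityˡ _)))))

        abstract
          δ-coordinates : ∃₂ λ u v → δ ≈ w ↑ u ∙ z ↑ v
          δ-coordinates = coordinates δ-InH

        u v : ℕ
        u = proj₁ δ-coordinates
        v = proj₁ (proj₂ δ-coordinates)

        open Iterates u v

        δ↑ : ∀ Y → δ ↑ Y ≈ w ↑ (u * Y) ∙ z ↑ (v * Y)
        δ↑ Y = trans (↑-cong Y (proj₂ (proj₂ δ-coordinates))) (trans (∙-↑ Y (comm-↑ u v wz))
          (∙-cong (sym (↑-*′ w u Y)) (sym (↑-*′ z v Y))))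

        act : ∀ X Y → (w ↑ X ∙ z ↑ Y) ∙ y ≈ y ∙ (w ↑ (X + u * Y) ∙ z ↑ (Y + (X + v * Y)))
        act X Y = trans (slide-∙ (slide-↑ X wy) (slide-↑ Y zy)) (∙-congˡ (begin
          (w ∙ z) ↑ X ∙ (z ∙ δ) ↑ Y
            ≈⟨ ∙-cong (∙-↑ X wz) (trans (∙-↑ Y (H-abelian z δ z-InH δ-InH)) (∙-congˡ (δ↑ Y))) ⟩
          (w ↑ X ∙ z ↑ X) ∙ (z ↑ Y ∙ (w ↑ (u * Y) ∙ z ↑ (v * Y)))
            ≈⟨ solveᴹ monoid ⟩
          w ↑ X ∙ (((z ↑ X ∙ z ↑ Y) ∙ w ↑ (u * Y)) ∙ z ↑ (v * Y))
            ≈⟨ ∙-congˡ (∙-congʳ (trans (∙-congʳ (sym (↑-+ z X Y))) (comm-↑ (X + Y) (u * Y) (sym wz)))) ⟩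
          w ↑ X ∙ ((w ↑ (u * Y) ∙ z ↑ (X + Y)) ∙ z ↑ (v * Y))
            ≈⟨ solveᴹ monoid ⟩
          (w ↑ X ∙ w ↑ (u * Y)) ∙ (z ↑ (X + Y) ∙ z ↑ (v * Y))
            ≈⟨ ∙-cong (sym (↑-+ w X (u * Y))) (trans (sym (↑-+ z (X + Y) (v * Y))) (↑-≡ z (collect X Y v))) ⟩
          w ↑ (X + u * Y) ∙ z ↑ (Y + (X + v * Y)) ∎))
          where
          open SetoidReasoning setoid
          collect : ∀ X Y v → X + Y + v * Y ≡ Y + (X + v * Y)
          collect = solve-∀

        iterate : ∀ n → w ∙ y ↑ n ≈ y ↑ n ∙ (w ↑ Δ n xs 0 ∙ z ↑ Δ n ys 0)
        iterate zero    = trans (identityʳ w) (sym (trans (identityˡ _) (trans (identityʳ _) (↑-1 w))))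
        iterate (suc n) = begin
          w ∙ y ↑ suc n                             ≈⟨ ∙-congˡ (↑-suc y n) ⟩
          w ∙ (y ↑ n ∙ y)                           ≈⟨ slide-trans (iterate n) (act (Δ n xs 0) (Δ n ys 0)) ⟩
          (y ↑ n ∙ y) ∙ (w ↑ (Δ n xs 0 + u * Δ n ys 0) ∙ z ↑ (Δ n ys 0 + (Δ n xs 0 + v * Δ n ys 0)))
            ≈⟨ ∙-cong (sym (↑-suc y n)) (∙-cong (↑-≡ w (≡.cong (Δ n xs 0 +_) (≡.sym (Δ-xs n 0))))
                 (↑-≡ z (≡.cong (Δ n ys 0 +_) (≡.sym (Δ-ys n 0))))) ⟩
          y ↑ suc n ∙ (w ↑ Δ (suc n) xs 0 ∙ z ↑ Δ (suc n) ys 0) ∎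
          where open SetoidReasoning setoid

        -- As y^P lies in the abelian group `H`, it centralizes w, so (1 + N)^P fixes the first
        -- basis vector.
        fixed : (Δ P xs 0 ≋ 1 mod q) × (Δ P ys 0 ≋ 0 mod q)
        fixed = independent (Δ P xs 0) (Δ P ys 0) 1 0 (slide-unique (iterate P)
          (trans (H-abelian w (y ↑ P) w-InH y↑P) (∙-congˡ (sym (trans (identityʳ _) (↑-1 w))))))

        conclusion : (P ∣ u) × (P ∣ v) × e ≡ 0
        conclusion = unipotent pr 4≤p e (≡.subst (Δ P xs 0 ≋ 1 mod_) q≡ (proj₁ fixed))
          (≡.subst (Δ P ys 0 ≋ 0 mod_) q≡ (proj₂ fixed))

      abstract
        exponent-one : e ≡ 0
        exponent-one = proj₂ (proj₂ conclusion)

        centralizes : z ∙ y ≈ y ∙ z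
        centralizes = trans zy (∙-congˡ (trans (∙-congˡ (trans (proj₂ (proj₂ δ-coordinates)) (trans
          (∙-cong (↑-mod w-order (vanish (proj₁ conclusion))) (↑-mod z-order (vanish (proj₁ (proj₂ conclusion)))))
          (identityˡ ε)))) (identityʳ z)))
          where
          vanish : ∀ {x} → P ∣ x → x ≋ 0 mod q
          vanish {x} d = ≡.subst (x ≋ 0 mod_)
            (≡.trans (≡.sym (*-identityʳ P)) (≡.trans (≡.cong (λ e → P ^ suc e) (≡.sym exponent-one)) (≡.sym q≡))) (∣⇒≋0 d)

  -- By `fixes-two-parts` one of two test parts is moved, and an orbit of an element of prime-power
  -- order on P parts has P members as soon as it is nontrivial.
  outside⇒cyclic : Prime P → ∀ e {x} → x ↑ (P ^ e) ≈ ε → ¬ InH x → Cyclic x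
  outside⇒cyclic pr e {x} x↑q ¬h = from (part (ε ∙ x) Finₚ.≟ part ε) (part (b ∙ x) Finₚ.≟ part b)
    where
    moved : ∀ g → part (g ∙ x) ≢ part g → Cyclic x
    moved g ne = least⇒cyclic g x (prime-power-period pr F fwd bwd e (part-cong (∙-congˡ x↑q))
      (λ f → ne (≡.trans (part-cong (∙-congˡ (sym (↑-1 x)))) (≡.trans f (part-cong (identityʳ g))))))
      where open Translates g x
    from : Dec (part (ε ∙ x) ≡ part ε) → Dec (part (b ∙ x) ≡ part b) → Cyclic x
    from (no ne) _       = moved ε ne
    from (yes _) (no ne) = moved b ne
    from (yes f) (yes g) = contradiction (fixes-two-parts part-b f g) ¬h

  -- Both b and the involution s of ⟨ a ⟩ have order two. If b s fixed a part, either b and s would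
  -- swap two parts, whence b ~ s, or s would fix a part other than that of ε.
  product-of-involutions : ∀ {s} → b ∙ b ≈ ε → s ∙ s ≈ ε → part s ≡ part ε → ¬ InH s →
    ∀ g → part (g ∙ (b ∙ s)) ≢ part g
  product-of-involutions {s} bb ss s-fixes s∉H g e = from (part ε Finₚ.≟ part g) (part (g ∙ b) Finₚ.≟ part g)
    where
    twice : ∀ {s} x → s ∙ s ≈ ε → (x ∙ s) ∙ s ≈ x
    twice {s} x ss = trans (assoc x s s) (trans (∙-congˡ ss) (identityʳ x))
    swapped : part (g ∙ s) ≡ part (g ∙ b)
    swapped = part-∙-cancel s (≡.trans (part-cong (twice g ss)) (≡.trans (≡.sym e) (part-cong (sym (assoc g b s)))))
    from : Dec (part ε ≡ part g) → Dec (part (g ∙ b) ≡ part g) → _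
    from _ (no ne) = part-b (≡.trans (≡.sym s-fixes) (≡.trans (part-cong (sym (identityˡ s)))
        (≡.trans (≡.sym bs∼s) (part-cong (twice b ss)))))
      where
      bs∈H : InH (b ∙ s)
      bs∈H = fixes-two-parts (λ f → ne (≡.sym f)) e (≡.trans
        (part-cong (trans (sym (assoc (g ∙ b) b s)) (∙-congʳ (twice g bb)))) swapped)
      bs∼s : part ((b ∙ s) ∙ s) ≡ part (ε ∙ s)
      bs∼s = part-∙ s (≡.trans (part-cong (sym (identityˡ _))) (bs∈H ε))
    from (no ne) (yes f) = s∉H (fixes-two-parts ne (≡.trans (part-cong (identityˡ s)) s-fixes) (≡.trans swapped f))
    from (yes h) (yes f) = part-b (≡.trans h (≡.trans (≡.sym f) (≡.trans (part-∙ b (≡.sym h)) (part-cong (identityˡ b)))))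

-- Recovering the presentation from the embedding.

module Classification {p t : ℕ} (pr : Prime (suc p)) (4≤p : 4 ≤ p) (root : IsPrimitiveRoot (suc p) t)
  (p-even : p ≡ 2 * (p / 2)) where

  open Maps pr 4≤p root p-even
  open Model pr root

  private
    M = p / 2
    P = suc p

  -- If d divides j and p, then s to the power p / d is 1; as s has order p, this leaves d = 1.
  coprime-exponent : ∀ {s j} → s ≋ t ^ j mod P → (∀ n → s ^ n ≋ 1 mod P → n ≋ 0 mod p) → Coprime j p
  coprime-exponent {s} {j} s≋ order {d} (divides x j≡ , divides r p≡) = *-cancelˡ-≡ d 1 p (≡.trans (*-comm p d)
    (≡.trans (≡.cong (d *_) (≡.sym r≡p)) (≡.trans (≡.trans (*-comm d r) (≡.sym p≡)) (≡.sym (*-identityʳ p)))))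
    where
    s^r : s ^ r ≋ 1 mod P
    s^r = ≋-trans (≋-^ r s≋) (≋-trans (≋-reflexive (≡.trans (^-*-assoc t j r)
      (≡.cong (t ^_) (≡.trans (≡.cong (_* r) j≡) (≡.trans (collect x d r) (≡.cong (_* x) (≡.sym p≡))))))) (t^p* x))
      where
      collect : ∀ x d r → x * d * r ≡ r * d * x
      collect = solve-∀
    r≡p : r ≡ p
    r≡p = ∣-antisym (divides d (≡.trans p≡ (*-comm r d))) (≋0⇒∣ (order r s^r))

  module Construct (G : Group 0ℓ 0ℓ) (a b : Group.Carrier G) (emb : EmbeddingOfK G a b P P)
    (generated : GeneratedBy₂ G a b) (bb : Group._≈_ G (Group._∙_ G b b) (Group.ε G))
    (H-abelian : ∀ x y → EmbeddingOfK.InH emb x → EmbeddingOfK.InH emb y →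
       Group._≈_ G (Group._∙_ G x y) (Group._∙_ G y x))
    {y : Group.Carrier G} (y∉H : ¬ EmbeddingOfK.InH emb y) (y↑P : Group._≈_ G (pow G y P) (Group.ε G)) where

    open Group G
    open GroupLemmas G
    open GroupProperties G
    open EmbeddingOfK emb using (InH)
    open Abelian G a b emb H-abelian

    private
      P≡P^1 : P ≡ P ^ 1
      P≡P^1 = ≡.sym (*-identityʳ P)

      y-cyclic : Cyclic y
      y-cyclic = outside⇒cyclic pr 1 (trans (↑-≡ y (≡.sym P≡P^1)) y↑P) y∉H

      module Yc = CyclicLemmas y-cyclic
      module Y = Basis y Yc.part-ε≢
      module YA = Y.Action pr 4≤p 0 P≡P^1 Yc.↑P-InH
      module HY = Heisenberg Y.wz Y.wy YA.centralizes

      s : Carrier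
      -- The involution of ⟨ a ⟩, whose order is p P = 2 M P.
      s = a ↑ (P * M)

      ss : s ∙ s ≈ ε
      ss = trans (sym (↑-+ a (P * M) (P * M))) (trans (↑-≡ a (≡.trans (double P M) (≡.cong (_* P) (≡.sym p-even)))) a-order)
        where
        double : ∀ P M → P * M + P * M ≡ 2 * M * P
        double = solve-∀

      s∉H : ¬ InH s
      s∉H h = <⇒≱ M<p (∣⇒≤ {{M≢0}} (≋0⇒∣ (≋-trans (≋-sym (P*≋ M)) (a↑-fixes⇒ (P * M) b part-b (h b)))))
        where
        1≤M : ∀ M → p ≡ 2 * M → 1 ≤ M
        1≤M zero    e = contradiction e (≢-nonZero⁻¹ p)
        1≤M (suc M) e = s≤s z≤n
        M≢0 : NonZero M
        M≢0 = >-nonZero (1≤M M p-even)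
        M<p : M < p
        M<p = ≡.subst (M <_) (≡.sym (≡.trans p-even (≡.cong (M +_) (+-identityʳ M)))) (m<m+n M (1≤M M p-even))

    c : Carrier
    c = b ∙ s

    private
      c-moves : ∀ g → part (g ∙ c) ≢ part g
      c-moves = product-of-involutions bb ss (part-a↑ (P * M)) s∉H

      abstract
        c~ : ∃ λ m → ¬ (P ∣ m) × c ~ y ↑ m
        c~ = Yc.fixed-point-free⇒power c c-moves

      m₀ : ℕ
      m₀ = proj₁ c~

      abstract
        c≈ : ∃₂ λ i k → c ≈ HY.h m₀ i k
        c≈ = let η , η∈H , e = ~⇒∙ (proj₂ (proj₂ c~))
                 i , k , f = Y.coordinates η∈H
             in i , k , trans e (∙-congˡ f)

    abstract
      -- Modulo `H` the element c is a power of y, so it lies in the class-two group generated by y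
      -- and `H`. For an odd prime P this group has exponent P, because P divides `triangle P`.
      c-order : c ↑ P ≈ ε
      c-order = let i , k , e = c≈ in begin
        c ↑ P                                ≈⟨ ↑-cong P e ⟩
        HY.h m₀ i k ↑ P                      ≈⟨ HY.h-↑ m₀ i k P ⟩
        HY.h (P * m₀) (P * i) (P * k + triangle P * (i * m₀))
          ≈⟨ ∙-cong (↑-mod {y} {P} {P * m₀} {0} y↑P (n*≋0 m₀)) (∙-cong (↑-mod {w} {P} {P * i} {0} w-order (n*≋0 i))
               (↑-mod {Y.z} {P} {P * k + triangle P * (i * m₀)} {0} Y.z-order
                 (≋-+ (n*≋0 k) (≋-* (∣⇒≋0 (p∣triangle pr (≤-trans (s≤s (s≤s z≤n)) 4≤p))) (≋-refl {x = i * m₀}))))) ⟩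
        ε ∙ (ε ∙ ε)                          ≈⟨ trans (identityˡ _) (identityˡ ε) ⟩
        ε                                    ∎
        where open SetoidReasoning setoid

      c-cyclic : Cyclic c
      c-cyclic d 1≤d e = ∣⇒≤ {{>-nonZero 1≤d}} ([ (λ h → h) , (λ h → contradiction h (proj₁ (proj₂ c~))) ]′
        (euclidsLemma d m₀ pr (≋0⇒∣ (Yc.part-y↑⁻¹ (d * m₀) 0 (≡.trans (part-cong (↑-* y d m₀))
          (≡.trans (≡.trans (part-cong (sym (identityˡ _))) (≡.trans (≡.sym (~-↑ d (proj₂ (proj₂ c~)) ε)) (part-cong (identityˡ _)))) e))))))

    module Cc = CyclicLemmas c-cyclic
    -- The basis is rebuilt with c in place of y: the z of the presentation is the commutator of w
    -- with c.
    open Basis c Cc.part-ε≢ using (z; wz; wz-InH; z-InH; z-order; coordinates; independent) renaming (wy to wc)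
    module CA = Basis.Action c Cc.part-ε≢ pr 4≤p 0 P≡P^1 Cc.↑P-InH

    zc : z ∙ c ≈ c ∙ z
    zc = CA.centralizes

    open Heisenberg wz wc zc

    h-≡ : ∀ {l i k l′ i′ k′} → l ≡ l′ → i ≡ i′ → k ≡ k′ → h l i k ≈ h l′ i′ k′
    h-≡ ≡.refl ≡.refl ≡.refl = refl

    w≈h : w ≈ h 0 1 0
    w≈h = sym (trans (identityˡ _) (trans (identityʳ _) (↑-1 w)))

    w-commutes-a : ∀ n → w ∙ a ↑ n ≈ a ↑ n ∙ w
    w-commutes-a n = slide-⁻¹ (comm-↑ p n refl)

    private
      -- As a product of the involutions b and s, c is inverted by s; with c of order P the inverse
      -- is written as a p-th power.
      cs : c ∙ s ≈ s ∙ c ↑ p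
      cs = trans (trans (assoc b s s) (trans (∙-congˡ ss) (identityʳ b)))
        (∙-cancelʳ c _ _ (trans (trans (sym (assoc b b s)) (trans (∙-congʳ bb) (identityˡ s)))
          (sym (trans (assoc s _ c) (trans (∙-congˡ (trans (sym (↑-suc c p)) c-order)) (identityʳ s))))))

      -- Conjugating the relation between w and c by s, which centralizes w and inverts c, shows
      -- that s inverts their commutator.
      zs : z ∙ s ≈ s ∙ z ↑ p
      zs = trans (slide-conj z s) (∙-congˡ (∙-cancelˡ w _ _ (∙-cancelˡ (c ↑ p) _ _ (trans
        (sym (slide-unique (slide-∙ (w-commutes-a (P * M)) cs)
          (trans (∙-congʳ wc) (slide-∙ cs (slide-∙ (w-commutes-a (P * M)) (slide-conj z s))))))
        (trans (∙-congʳ (sym (↑-1 w))) (trans (w↑c↑ 1 p) (∙-congˡ (∙-cong (↑-1 w) (↑-≡ z (+-identityʳ p))))))))))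

      hs : ∀ l i k → h l i k ∙ s ≈ s ∙ h (l * p) i (k * p)
      hs l i k = slide-∙ (trans (slide-↑ l cs) (∙-congˡ (sym (↑-* c l p))))
        (slide-∙ (slide-↑ i (w-commutes-a (P * M))) (trans (slide-↑ k zs) (∙-congˡ (sym (↑-* z k p)))))

    -- The complement of w in a. Since P ≡ 1 modulo p, it moves the parts as a does, and its p-th
    -- power is trivial.
    g′ : Carrier
    g′ = a ↑ P

    private
      conj-moves : ∀ g → part (g ∙ conj G c g′) ≢ part g
      conj-moves g e = c-moves (g ∙ g′ ⁻¹) (part-∙-cancel g′ (≡.trans
        (part-cong (trans (∙-congʳ (assoc _ _ _)) (assoc _ _ _))) (≡.trans e (part-cong (sym (cancelʳ′ g g′))))))

      abstract
        conj~ : ∃ λ r → ¬ (P ∣ r) × conj G c g′ ~ c ↑ r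
        conj~ = Cc.fixed-point-free⇒power (conj G c g′) conj-moves

      r : ℕ
      r = proj₁ conj~

      cg′ : c ∙ g′ ~ g′ ∙ c ↑ r
      cg′ = Q.trans (≈⇒~ (slide-conj c g′)) (~-∙ (Q.refl {g′}) (proj₂ (proj₂ conj~)))

      cg′↑ : ∀ n → c ∙ g′ ↑ n ~ g′ ↑ n ∙ c ↑ (r ^ n)
      cg′↑ n = Q.trans (≈⇒~ (∙-congʳ (sym (↑-1 c)))) (Q.trans translate (≈⇒~ (∙-congˡ (↑-≡ c (+-identityʳ (r ^ n))))))
        where
        translate : c ↑ 1 ∙ g′ ↑ n ~ g′ ↑ n ∙ c ↑ (1 * r ^ n)
        translate = ≡.subst₂ _~_ (≡.cong₂ _∙_ (↑/H c 1) (↑/H g′ n)) (≡.cong₂ _∙_ (↑/H g′ n) (↑/H c (1 * r ^ n)))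
          (Qₗ.slide-power {c} {g′} {r} 1 n (≡.subst (λ x → c ∙ g′ ~ g′ ∙ x) (≡.sym (↑/H c r)) cg′))

      g′↑≈ : ∀ n → g′ ↑ n ≈ a ↑ (P * n)
      g′↑≈ n = sym (↑-*′ a P n)

      -- If rⁿ ≡ 1, the n-th power of `g′` commutes with c modulo `H`. As it fixes the base part it
      -- also fixes the part of c, whence p ∣ n.
      r-order : ∀ n → r ^ n ≋ 1 mod P → n ≋ 0 mod p
      r-order n e = ≋-trans (≋-sym (P*≋ n)) (a↑-fixes⇒ (P * n) c Cc.part-ε≢ (begin
        part (c ∙ a ↑ (P * n))             ≡⟨ part-cong (trans (∙-congˡ (sym (g′↑≈ n))) (sym (identityˡ _))) ⟩
        part (ε ∙ (c ∙ g′ ↑ n))            ≡⟨ cg′↑ n ε ⟩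
        part (ε ∙ (g′ ↑ n ∙ c ↑ (r ^ n)))  ≡⟨ part-cong (trans (identityˡ _) (∙-congʳ (g′↑≈ n))) ⟩
        part (a ↑ (P * n) ∙ c ↑ (r ^ n))   ≡⟨ part-∙ (c ↑ (r ^ n)) (part-a↑ (P * n)) ⟩
        part (ε ∙ c ↑ (r ^ n))             ≡⟨ part-cong (identityˡ _) ⟩
        part (c ↑ (r ^ n))                 ≡⟨ Cc.part-y↑ e ⟩
        part (c ↑ 1)                       ≡⟨ part-cong (↑-1 c) ⟩
        part c                             ∎))
        where open ≡.≡-Reasoning

      log = discrete-log r (proj₁ (proj₂ conj~))

    j : ℕ
    j = proj₁ log

    j-unit : UnitMod p j
    j-unit = proj₁ (proj₂ log) , coprime-exponent (proj₂ (proj₂ log)) r-order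

    private
      j-inverse = inverse-mod (proj₂ j-unit)

      j⁻¹ : ℕ
      j⁻¹ = proj₁ j-inverse

      j⁻¹*j : j⁻¹ * j ≋ 1 mod p
      j⁻¹*j = proj₂ j-inverse

      g′-order : g′ ↑ p ≈ ε
      g′-order = trans (g′↑≈ p) (trans (↑-≡ a (*-comm P p)) a-order)

    -- With r = tʲ modulo P, the j-th root of `g′` is the element acting on c by t itself; it makes
    -- a = w gʲ.
    g : Carrier
    g = g′ ↑ j⁻¹

    g↑≈ : ∀ n → g ↑ n ≈ a ↑ (P * (j⁻¹ * n))
    g↑≈ n = trans (sym (↑-*′ g′ j⁻¹ n)) (g′↑≈ (j⁻¹ * n))

    g↑j : g ↑ j ≈ g′
    g↑j = trans (sym (↑-*′ g′ j⁻¹ j)) (trans (↑-mod g′-order j⁻¹*j) (↑-1 g′))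

    g-order : g ↑ p ≈ ε
    g-order = trans (sym (↑-*′ g′ j⁻¹ p)) (ε≈↑ j⁻¹ g′-order)

    a≈ : a ≈ w ∙ g ↑ j
    a≈ = sym (trans (∙-congˡ (trans g↑j (↑-suc a p))) (trans (sym (assoc _ _ _)) (trans (∙-congʳ (inverseˡ (a ↑ p))) (identityˡ a))))

    s≈ : g ↑ M ≈ s
    s≈ = trans (↑-mod {g} {p} {M} {j * M} g-order (≋-sym (≋-trans (≋-reflexive (*-comm j M))
        (odd-*-half (coprime-even⇒odd (proj₂ j-unit) (divides M (≡.trans p-even (*-comm 2 M)))) p-even))))
      (trans (↑-*′ g j M) (trans (↑-cong M g↑j) (g′↑≈ M)))

    b≈ : b ≈ c ∙ g ↑ M
    b≈ = sym (trans (∙-congˡ s≈) (trans (assoc b s s) (trans (∙-congˡ ss) (identityʳ b))))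

    wg : w ∙ g ≈ g ∙ w
    wg = trans (∙-congˡ g≈) (trans (w-commutes-a (P * j⁻¹)) (∙-congʳ (sym g≈)))
      where
      g≈ : g ≈ a ↑ (P * j⁻¹)
      g≈ = g′↑≈ j⁻¹

    gs : g ∙ s ≈ s ∙ g
    gs = trans (∙-congʳ (g′↑≈ j⁻¹)) (trans (comm-↑ (P * j⁻¹) (P * M) refl) (∙-congˡ (sym (g′↑≈ j⁻¹))))

    private
      cg~ : c ∙ g ~ g ∙ c ↑ t
      cg~ = Q.trans (cg′↑ j⁻¹) (≈⇒~ (∙-congˡ (↑-mod c-order (≋-trans (≋-^ j⁻¹ (proj₂ (proj₂ log)))
        (≋-trans (≋-reflexive (≡.trans (^-*-assoc t j j⁻¹) (≡.cong (t ^_) (*-comm j j⁻¹))))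
        (≋-trans (t^-cong j⁻¹*j) (≋-reflexive (*-identityʳ t))))))))

      abstract
        cg-coordinates : ∃₂ λ x y → c ∙ g ≈ g ∙ h t x y
        cg-coordinates = let η , η∈H , e = ~⇒∙ cg~
                             x , y , f = coordinates η∈H
                         in x , y , trans e (trans (assoc g _ η) (∙-congˡ (∙-congˡ f)))

      x₀ y₀ : ℕ
      x₀ = proj₁ cg-coordinates
      y₀ = proj₁ (proj₂ cg-coordinates)

      P∤p : ¬ (P ∣ p)
      P∤p d = <⇒≱ (n<1+n p) (∣⇒≤ d)

      -- s inverts c, hence also c^g.
      x₀≋0 : x₀ ≋ 0 mod P
      x₀≋0 = ∣⇒≋0 ([ (λ d → contradiction (∣⇒≤ d) (<⇒≱ (s≤s (≤-trans (s≤s (s≤s z≤n)) 4≤p)))) , (λ d → d) ]′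
        (euclidsLemma 2 x₀ pr (≋0⇒∣ (≋-trans (≋-+ (≋-refl {x = x₀}) (≋-trans (≋-reflexive (+-identityʳ x₀)) x₀≋)) (n*≋0 x₀)))))
        where
        cg = proj₂ (proj₂ cg-coordinates)
        -- Two computations of the conjugate of c by g s = s g: one applies s to c^g, the other
        -- takes the p-th power of c^g. Their w-exponents are x₀ and -x₀.
        commuted : h (t * p) x₀ (y₀ * p) ≈ h (p * t) (p * x₀) (p * y₀ + triangle p * (x₀ * t))
        commuted = trans (slide-unique (slide-trans cg (hs t x₀ y₀))
          (trans (∙-congˡ gs) (trans (slide-trans cs (slide-↑ p cg)) (∙-congʳ (sym gs))))) (h-↑ t x₀ y₀ p)
        x₀≋ : x₀ ≋ p * x₀ mod P
        x₀≋ = proj₁ (independent x₀ (y₀ * p) (p * x₀) (p * y₀ + triangle p * (x₀ * t))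
          (∙-cancelˡ (c ↑ (t * p)) _ _ (trans commuted (∙-congʳ (↑-≡ c (*-comm p t))))))

      cg₀ : c ∙ g ≈ g ∙ h t 0 y₀
      cg₀ = trans (proj₂ (proj₂ cg-coordinates)) (∙-congˡ (∙-congˡ (∙-congʳ (↑-mod {b = 0} w-order x₀≋0))))

    -- The conjugate of z is the commutator of w with c^g. The central factor of c^g does not
    -- contribute, and cᵗ contributes zᵗ.
    zg : z ∙ g ≈ g ∙ z ↑ t
    zg = trans (slide-conj z g) (∙-congˡ (∙-cancelˡ w _ _ (∙-cancelˡ (h t 0 y₀) _ _ (trans
      (sym (slide-unique (slide-∙ wg cg₀) (trans (∙-congʳ wc) (slide-∙ cg₀ (slide-∙ wg (slide-conj z g))))))
      (begin
        w ∙ h t 0 y₀                          ≈⟨ ∙-congʳ w≈h ⟩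
        h 0 1 0 ∙ h t 0 y₀                    ≈⟨ h-∙ 0 1 0 t 0 y₀ ⟩
        h t 1 (1 * t + y₀)                    ≈⟨ h-≡ {i = 1} (≡.sym (+-identityʳ t)) ≡.refl (collect t y₀) ⟩
        h (t + 0) 1 (y₀ + 0 + t)              ≈⟨ h-∙ t 0 y₀ 0 1 t ⟨
        h t 0 y₀ ∙ h 0 1 t                    ≈⟨ ∙-congˡ (trans (identityˡ _) (∙-congʳ (↑-1 w))) ⟩
        h t 0 y₀ ∙ (w ∙ z ↑ t)                ∎)))))
      where
      open SetoidReasoning setoid
      collect : ∀ t y → 1 * t + y ≡ y + 0 + t
      collect = solve-∀

    private
      -- The z-exponent that c acquires under conjugation by gⁿ. Up to one factor t, `drift≡` gives
      -- it the closed form n tⁿ y₀.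
      drift : ℕ → ℕ
      drift zero    = 0
      drift (suc n) = t ^ n * y₀ + drift n * t

      drift≡ : ∀ n → t * drift n ≡ n * (t ^ n * y₀)
      drift≡ zero    = *-zeroʳ t
      drift≡ (suc n) = ≡.trans (expand t (t ^ n) y₀ (drift n)) (≡.trans (≡.cong (λ d → t * t ^ n * y₀ + t * d) (drift≡ n))
        (collect t (t ^ n) y₀ n))
        where
        expand : ∀ t T y d → t * (T * y + d * t) ≡ t * T * y + t * (t * d)
        expand = solve-∀
        collect : ∀ t T y n → t * T * y + t * (n * (T * y)) ≡ suc n * (t * T * y)
        collect = solve-∀

      hg : ∀ l k → h l 0 k ∙ g ≈ g ∙ h (l * t) 0 (l * y₀ + k * t)
      hg l k = trans (slide-∙ (slide-↑ l cg₀) (slide-∙ slide-ε (slide-↑ k zg))) (∙-congˡ (begin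
        h t 0 y₀ ↑ l ∙ (ε ∙ (z ↑ t) ↑ k)
          ≈⟨ ∙-cong (h-↑ t 0 y₀ l) (trans (∙-congˡ (sym (↑-* z k t))) (sym (identityˡ _))) ⟩
        h (l * t) (l * 0) (l * y₀ + triangle l * 0) ∙ h 0 0 (k * t)
          ≈⟨ h-∙ (l * t) (l * 0) (l * y₀ + triangle l * 0) 0 0 (k * t) ⟩
        h (l * t + 0) (l * 0 + 0) (l * y₀ + triangle l * 0 + l * 0 * 0 + k * t)
          ≈⟨ h-≡ {l′ = l * t} (+-identityʳ (l * t)) (zero₁ l) (zero₂ l y₀ (triangle l) (k * t)) ⟩
        h (l * t) 0 (l * y₀ + k * t) ∎))
        where
        open SetoidReasoning setoid
        zero₁ : ∀ l → l * 0 + 0 ≡ 0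
        zero₁ = solve-∀
        zero₂ : ∀ l y T k → l * y + T * 0 + l * 0 * 0 + k ≡ l * y + k
        zero₂ = solve-∀

      cg₀↑ : ∀ n → c ∙ g ↑ n ≈ g ↑ n ∙ h (t ^ n) 0 (drift n)
      cg₀↑ zero    = trans (identityʳ c) (sym (trans (identityˡ _) (trans (∙-cong (↑-1 c) (identityˡ ε)) (identityʳ c))))
      cg₀↑ (suc n) = trans (∙-congˡ (↑-suc g n)) (trans (slide-trans (cg₀↑ n) (hg (t ^ n) (drift n)))
        (∙-cong (sym (↑-suc g n)) (h-≡ {i = 0} {k = drift (suc n)} (*-comm (t ^ n) t) ≡.refl ≡.refl)))

      -- g ^ p = 1 while conjugation by g would move c along z in steps of y₀.
      y₀≋0 : y₀ ≋ 0 mod P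
      y₀≋0 = ∣⇒≋0 (y₀-∣ (≋0⇒∣ (≋-trans (≋-reflexive (≡.sym (drift≡ p))) (≋-trans (≋-* (≋-refl {x = t}) drift≋0) (≋-reflexive (*-zeroʳ t))))))
        where
        y₀-∣ : P ∣ p * (t ^ p * y₀) → P ∣ y₀
        y₀-∣ d = [ (λ e → contradiction e P∤p) , (λ e → [ (λ f → contradiction f (∤^ pr ∤t p)) , (λ f → f) ]′
          (euclidsLemma (t ^ p) y₀ pr e)) ]′ (euclidsLemma p (t ^ p * y₀) pr d)
        drift≋0 : drift p ≋ 0 mod P
        drift≋0 = proj₂ (independent 0 (drift p) 0 0 (∙-cancelˡ c _ _ (begin
          c ∙ (ε ∙ z ↑ drift p)          ≈⟨ ∙-congʳ (trans (sym (↑-1 c)) (↑-mod {c} {P} {1} {t ^ p} c-order (≋-sym t^p))) ⟩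
          h (t ^ p) 0 (drift p)          ≈⟨ identityˡ _ ⟨
          ε ∙ h (t ^ p) 0 (drift p)      ≈⟨ ∙-congʳ g-order ⟨
          g ↑ p ∙ h (t ^ p) 0 (drift p)  ≈⟨ cg₀↑ p ⟨
          c ∙ g ↑ p                      ≈⟨ ∙-congˡ (trans g-order (sym (identityˡ ε))) ⟩
          c ∙ (ε ∙ ε)                    ∎)))
          where open SetoidReasoning setoid

    cg : c ∙ g ≈ g ∙ c ↑ t
    cg = trans cg₀ (∙-congˡ (trans (∙-congˡ (trans (identityˡ _) (↑-mod {b = 0} z-order y₀≋0))) (identityʳ _)))

    slides : G₂Slides p t w z c g
    slides = record { w-order = w-order ; z-order = z-order ; c-order = c-order ; g-order = g-order
      ; wz = wz ; cg = cg ; wc = wc ; zc = zc ; wg = wg ; zg = zg }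

    open NormalForm G slides

    part-g↑ : ∀ m → part (g ↑ m) ≡ part ε
    part-g↑ m = ≡.trans (part-cong (g↑≈ m)) (part-a↑ (P * (j⁻¹ * m)))

    nf-part : ∀ m l i k → nf ⟨ m , l , i , k ⟩ ~ g ↑ m ∙ c ↑ l
    nf-part m l i k = Q.trans (≈⇒~ (sym (assoc _ _ _))) (Q.trans (~-∙ (Q.refl {g ↑ m ∙ c ↑ l}) (InH⇒~ (wz-InH i k))) (≈⇒~ (identityʳ _)))

    part-gc : ∀ m l → part (g ↑ m ∙ c ↑ l) ≡ part (c ↑ l)
    part-gc m l = ≡.trans (part-∙ (c ↑ l) (part-g↑ m)) (part-cong (identityˡ _))

    g↑-inj~ : ∀ m m′ → g ↑ m ~ g ↑ m′ → m ≋ m′ mod p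
    g↑-inj~ m m′ e = ≋-trans (≋-sym (undo m)) (≋-trans (≋-* (≋-refl {x = j}) reduced) (undo m′))
      where
      reduced : j⁻¹ * m ≋ j⁻¹ * m′ mod p
      reduced = ≋-trans (≋-sym (P*≋ (j⁻¹ * m))) (≋-trans (part-ba↑⁻¹ (P * (j⁻¹ * m)) (P * (j⁻¹ * m′))
        (≡.trans (part-cong (∙-congˡ (sym (g↑≈ m)))) (≡.trans (e b) (part-cong (∙-congˡ (g↑≈ m′)))))) (P*≋ (j⁻¹ * m′)))
      undo : ∀ m → j * (j⁻¹ * m) ≋ m mod p
      undo m = ≋-trans (≋-reflexive (collect j j⁻¹ m)) (≋-trans (≋-* j⁻¹*j (≋-refl {x = m})) (≋-reflexive (+-identityʳ m)))
        where
        collect : ∀ j i m → j * (i * m) ≡ i * j * m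
        collect = solve-∀

    -- The image of the base part determines l, the action on the other parts then determines m, and
    -- the remaining factor in `H` determines i and k by independence of the basis.
    nf-injective : ∀ {x y} → nf x ≈ nf y → x ≈ᴷ y
    nf-injective {⟨ m , l , i , k ⟩} {⟨ m′ , l′ , i′ , k′ ⟩} e = coords m-eq l-eq (proj₁ ik-eq) (proj₂ ik-eq)
      where
      open ≡.≡-Reasoning
      same : g ↑ m ∙ c ↑ l ~ g ↑ m′ ∙ c ↑ l′
      same = Q.trans (Q.sym (nf-part m l i k)) (Q.trans (≈⇒~ e) (nf-part m′ l′ i′ k′))
      l-eq : l ≋ l′ mod P
      l-eq = Cc.part-y↑⁻¹ l l′ (begin
        part (c ↑ l)                  ≡⟨ part-gc m l ⟨
        part (g ↑ m ∙ c ↑ l)          ≡⟨ part-cong (identityˡ _) ⟨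
        part (ε ∙ (g ↑ m ∙ c ↑ l))    ≡⟨ same ε ⟩
        part (ε ∙ (g ↑ m′ ∙ c ↑ l′))  ≡⟨ part-cong (identityˡ _) ⟩
        part (g ↑ m′ ∙ c ↑ l′)        ≡⟨ part-gc m′ l′ ⟩
        part (c ↑ l′)                 ∎)
      c≈c : c ↑ l ≈ c ↑ l′
      c≈c = ↑-mod c-order l-eq
      m-eq : m ≋ m′ mod p
      m-eq = g↑-inj~ m m′ (GroupProperties.∙-cancelʳ G/H (c ↑ l) (g ↑ m) (g ↑ m′)
        (Q.trans same (≈⇒~ (∙-congˡ (sym c≈c)))))
      ik-eq : (i ≋ i′ mod P) × (k ≋ k′ mod P)
      ik-eq = independent i k i′ k′ (∙-cancelˡ (c ↑ l) _ _ (∙-cancelˡ (g ↑ m) _ _ (trans e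
        (∙-cong (↑-mod g-order (≋-sym m-eq)) (∙-congʳ (sym c≈c))))))

    in-image : ∀ {x} → InGen G (λ y → (y ≈ a) ⊎ (y ≈ b)) x → ∃ λ q → nf q ≈ x
    in-image (gen (inj₁ e)) = wᴷ · rot j 0 , trans (nf-∙ wᴷ (rot j 0)) (trans (∙-cong nf-w (nf-g↑ j)) (sym (trans e a≈)))
    in-image (gen (inj₂ e)) = cᴷ · rot M 0 , trans (nf-∙ cᴷ (rot M 0)) (trans (∙-cong nf-c (nf-g↑ M)) (sym (trans e b≈)))
    in-image unit           = 1ᴷ , nf-ε
    in-image (mul {x} {y} u v) = let q , e = in-image u ; q′ , e′ = in-image v in q · q′ , trans (nf-∙ q q′) (∙-cong e e′)
    in-image (inv u)        = let q , e = in-image u in q ⁻¹ᴷ , trans (nf-⁻¹ q) (⁻¹-cong e)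
    in-image (resp f u)     = let q , e = in-image u in q , trans e f

    coordinatized : Coordinatized G w z c g
    coordinatized = record
      { slides   = slides
      ; coord    = λ x → proj₁ (in-image (generated x))
      ; nf-coord = λ x → proj₂ (in-image (generated x))
      ; nf-inj   = nf-injective }

    map-isomorphism : ∀ {Γ : Group 0ℓ 0ℓ} {w′ z′ c′ g′} (𝒞 : Coordinatized Γ w′ z′ c′ g′) →
      MapIso G a b Γ (M₂a Γ P w′ c′ g′ j) (M₂b Γ P w′ c′ g′)
    map-isomorphism {Γ} 𝒞 = transfer coordinatized 𝒞 , transfer-iso coordinatized 𝒞
      , Γ.trans (transfer-cong coordinatized 𝒞 a≈) (Γ.trans (nf-cong′ (a-at coordinatized j)) (Γ.sym (at⇒≈nf 𝒞 (a-at 𝒞 j))))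
      , Γ.trans (transfer-cong coordinatized 𝒞 b≈) (Γ.trans (nf-cong′ (b-at coordinatized)) (Γ.sym (at⇒≈nf 𝒞 (b-at 𝒞))))
      where
      module Γ = Group Γ
      nf-cong′ = Coordinatized.nf-cong 𝒞

-- Counting arcs, and Sylow subgroups outside the kernel.

module _ {G : Group 0ℓ 0ℓ} where

  open Group G

  lookup-distinct : ∀ {xs} → AllPairs (λ x y → ¬ (x ≈ y)) xs → ∀ i j → lookup xs i ≈ lookup xs j → i ≡ j
  lookup-distinct (_ ∷ _)  Fin.zero    Fin.zero    e = ≡.refl
  lookup-distinct (d ∷ _)  Fin.zero    (Fin.suc j) e = contradiction e (All.lookup d (∈ₚ.∈-lookup j))
  lookup-distinct (d ∷ _)  (Fin.suc i) Fin.zero    e = contradiction (sym e) (All.lookup d (∈ₚ.∈-lookup i))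
  lookup-distinct (_ ∷ ds) (Fin.suc i) (Fin.suc j) e = ≡.cong Fin.suc (lookup-distinct ds i j e)

  length-≤ : ∀ {N} {R : Carrier → Set} {xs} → AllPairs (λ x y → ¬ (x ≈ y)) xs → All R xs →
    (f : Carrier → Fin N) → (∀ x y → R x → R y → f x ≡ f y → x ≈ y) → length xs ≤ N
  length-≤ {xs = xs} ds rs f inj = Finₚ.injective⇒≤ {f = λ i → f (lookup xs i)} λ {i} {j} e →
    lookup-distinct ds i j (inj _ _ (All.lookup rs (∈ₚ.∈-lookup i)) (All.lookup rs (∈ₚ.∈-lookup j)) e)

  length-≥ : ∀ {N} {xs} → (∀ x → Any (x ≈_) xs) →
    (f : Carrier → Fin N) → (∀ {x y} → x ≈ y → f x ≡ f y) → (∀ i → ∃ λ x → f x ≡ i) → N ≤ length xs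
  length-≥ {xs = xs} complete f f-cong surj = Finₚ.injective⇒≤ {f = λ i → index i} λ {i} {j} e →
    ≡.trans (≡.sym (value i)) (≡.trans (≡.cong (λ k → f (lookup xs k)) e) (value j))
    where
    index = λ i → Any.index (complete (proj₁ (surj i)))
    value : ∀ i → f (lookup xs (index i)) ≡ i
    value i = ≡.trans (≡.sym (f-cong (lookup-index (complete (proj₁ (surj i)))))) (proj₂ (surj i))

module Counting (FG : FiniteGroup) (a b : Group.Carrier (FiniteGroup.group FG)) {p q : ℕ} {{_ : NonZero p}}
  (emb : EmbeddingOfK (FiniteGroup.group FG) a b (suc p) q) where

  open FiniteGroup FG
  open Group group using (Carrier; _≈_; _∙_; ε; refl; sym; trans; ∙-congˡ; identityˡ; identityʳ)
  open EmbeddingOfK emb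
  open Kernel group a b emb using (part; ν-cong; part-cong; InH?; InH-≈)

  private
    P = suc p

  -- An element is numbered by the arc it gives: first the two parts, the second with the first
  -- removed, then the positions within them.
  arc : Carrier → Fin ((P * p) * (q * q))
  arc x = combine (combine (part x) (punchOut (arc-ok x))) (combine (proj₂ (ν x)) (proj₂ (ν (b ∙ x))))

  arc-≡ : ∀ {x} u₁ i u₂ v₂ → ν x ≡ (u₁ , u₂) → ν (b ∙ x) ≡ (punchIn u₁ i , v₂) →
    arc x ≡ combine (combine u₁ i) (combine u₂ v₂)
  arc-≡ {x} u₁ i u₂ v₂ e f = ≡.cong₂ combine (≡.cong₂ combine (≡.cong proj₁ e) (punched (arc-ok x) (≡.cong proj₁ e) (≡.cong proj₁ f)))
    (≡.cong₂ combine (≡.cong proj₂ e) (≡.cong proj₂ f))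
    where
    punched : ∀ {u v : Fin P} (ne : u ≢ v) → u ≡ u₁ → v ≡ punchIn u₁ i → punchOut ne ≡ i
    punched ne ≡.refl ≡.refl = ≡.trans (Finₚ.punchOut-cong u₁ ≡.refl) (Finₚ.punchOut-punchIn u₁)

  arc-cong : ∀ {x y} → x ≈ y → arc x ≡ arc y
  arc-cong {x} {y} e = arc-≡ (part y) (punchOut (arc-ok y)) (proj₂ (ν y)) (proj₂ (ν (b ∙ y))) (ν-cong e)
    (≡.trans (ν-cong (∙-congˡ e)) (≡.cong (_, proj₂ (ν (b ∙ y))) (≡.sym (Finₚ.punchIn-punchOut (arc-ok y)))))

  arc-injective : ∀ x y → arc x ≡ arc y → x ≈ y
  arc-injective x y e = arc-inj x y (≡.cong₂ _,_ parts (proj₁ seconds)) (≡.cong₂ _,_ parts′ (proj₂ seconds))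
    where
    outer = Finₚ.combine-injective (combine (part x) (punchOut (arc-ok x))) (combine (proj₂ (ν x)) (proj₂ (ν (b ∙ x))))
      (combine (part y) (punchOut (arc-ok y))) (combine (proj₂ (ν y)) (proj₂ (ν (b ∙ y)))) e
    firsts = Finₚ.combine-injective (part x) (punchOut (arc-ok x)) (part y) (punchOut (arc-ok y)) (proj₁ outer)
    seconds = Finₚ.combine-injective (proj₂ (ν x)) (proj₂ (ν (b ∙ x))) (proj₂ (ν y)) (proj₂ (ν (b ∙ y))) (proj₂ outer)
    parts : part x ≡ part y
    parts = proj₁ firsts
    parts′ : part (b ∙ x) ≡ part (b ∙ y)
    parts′ = ≡.trans (≡.sym (Finₚ.punchIn-punchOut (arc-ok x))) (≡.trans (≡.cong₂ punchIn parts (proj₂ firsts)) (Finₚ.punchIn-punchOut (arc-ok y)))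

  arc-surjective : ∀ i → ∃ λ x → arc x ≡ i
  arc-surjective i with i₁ , i₂ , ≡.refl ← Finₚ.combine-surjective {P * p} {q * q} i
    with u₁ , v₁ , ≡.refl ← Finₚ.combine-surjective {P} {p} i₁
    with u₂ , v₂ , ≡.refl ← Finₚ.combine-surjective {q} {q} i₂ =
    let x , e , f = arc-surj (u₁ , u₂) (punchIn u₁ v₁ , v₂) (λ e → Finₚ.punchInᵢ≢i u₁ v₁ (≡.sym e)) in x , arc-≡ u₁ v₁ u₂ v₂ e f

  order≡arcs : order ≡ (P * p) * (q * q)
  order≡arcs = ≤-antisym (length-≤ {group} distinct (All.universal (λ _ → ≡.refl {x = 0}) elems) arc (λ x y _ _ → arc-injective x y))
    (length-≥ {group} complete arc arc-cong arc-surjective)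

  -- An element of `H` keeps both ends of the base arc in their parts, so only q positions remain
  -- for each end.
  subset-of-H-≤ : ∀ {S : Carrier → Set} (S? : Relation.Unary.Decidable S) → (∀ x → S x → InH x) → card S S? ≤ q * q
  subset-of-H-≤ S? S⊆H = length-≤ {group} (AllPairsₚ.filter⁺ S? distinct) (Allₚ.all-filter S? elems)
    (λ x → combine (proj₂ (ν x)) (proj₂ (ν (b ∙ x)))) λ x y sx sy e →
      let f , g = Finₚ.combine-injective (proj₂ (ν x)) (proj₂ (ν (b ∙ x))) (proj₂ (ν y)) (proj₂ (ν (b ∙ y))) e in
      arc-inj x y (≡.cong₂ _,_ (≡.trans (at-ε x sx) (≡.sym (at-ε y sy))) f)
                  (≡.cong₂ _,_ (≡.trans (S⊆H x sx b) (≡.sym (S⊆H y sy b))) g)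
    where
    at-ε : ∀ x → _ → part x ≡ part ε
    at-ε x sx = ≡.trans (part-cong (sym (identityˡ x))) (S⊆H x sx ε)

  -- A Sylow subgroup inside `H` has order at most q², itself a power of P. The factor P of |G| = P
  -- p q² would then survive in the index, which is prime to P.
  sylow⊈H : Prime P → ∀ e → q ≡ P ^ e → ∀ {S} → IsSylow P S → ∃ λ x → S x × ¬ InH x
  sylow⊈H pr e q≡ {S} syl with Any.any? (λ x → P? x ×-dec ¬? (InH? x)) elems
    where open IsSylow syl
  ... | yes found = Any.satisfied found
  ... | no ¬found = contradiction P∣m coprime
    where
    open IsSylow syl
    S⊆H : ∀ x → S x → InH x
    S⊆H x sx = decidable-stable (InH? x) λ ¬h → ¬found (Any.map
      (λ x≈y → IsSubgroup.P-resp subgroup x≈y sx , λ h → ¬h (InH-≈ (sym x≈y) h)) (complete x))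
    q*q≡ : q * q ≡ P ^ (e + e)
    q*q≡ = ≡.trans (≡.cong₂ _*_ q≡ q≡) (≡.sym (^-distribˡ-+-* P e e))
    k≤2e : k ≤ e + e
    k≤2e = decidable-stable (k ≤? e + e) λ k≰ → <⇒≱ (^-monoʳ-< P (s≤s (>-nonZero⁻¹ p)) (≰⇒> k≰))
      (≡.subst₂ _≤_ card≡ q*q≡ (subset-of-H-≤ P? S⊆H))
    d = e + e ∸ k
    m≡ : m ≡ P * (P ^ d * p)
    m≡ = *-cancelˡ-≡ m _ (P ^ k) {{m^n≢0 P k}} (≡.trans (≡.sym order≡) (≡.trans order≡arcs
      (≡.trans (≡.cong (P * p *_) (≡.trans q*q≡ (≡.trans (≡.cong (P ^_) (≡.sym (m+[n∸m]≡n k≤2e))) (^-distribˡ-+-* P k d))))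
      (collect P p (P ^ k) (P ^ d)))))
      where
      collect : ∀ P p x y → P * p * (x * y) ≡ x * (P * (y * p))
      collect = solve-∀
    P∣m : P ∣ m
    P∣m = ≡.subst (P ∣_) (≡.sym m≡) (m∣m*n (P ^ d * p))

prime-pred-even : ∀ {p} → Prime (suc p) → 4 ≤ p → p ≡ 2 * (p / 2)
prime-pred-even {p} pr 4≤p with parity p
... | r , inj₁ e = ≡.trans e (≡.cong (2 *_) (≡.sym (≡.trans (≡.cong (_/ 2) (≡.trans e (*-comm 2 r))) (m*n/n≡m r 2))))
... | r , inj₂ e with prime⇒irreducible pr (divides (1 + r) (≡.trans (≡.cong suc e) (double r)))
  where
  double : ∀ r → 2 + 2 * r ≡ (1 + r) * 2
  double = solve-∀
... | inj₁ ()
... | inj₂ ≡.refl = contradiction (≤-pred 4≤p) λ ()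

-- Assembling the classification.

module _ {p t : ℕ} (pr : Prime (suc p)) (4≤p : 4 ≤ p) (root : IsPrimitiveRoot (suc p) t) where

  private
    p-even = prime-pred-even pr 4≤p

  open Model pr root
  open Classification pr 4≤p root p-even

  -- The part size is a variable with an equation so that it can be matched: the type of `emb`
  -- depends on it, and the construction expects exactly `suc p`.
  classify-prime : ∀ {q} → q ≡ suc p → (G : Group 0ℓ 0ℓ) (a b : Group.Carrier G) → MapData G a b →
    (emb : EmbeddingOfK G a b (suc p) q) →
    (∀ x y → EmbeddingOfK.InH emb x → EmbeddingOfK.InH emb y → Group._≈_ G (Group._∙_ G x y) (Group._∙_ G y x)) →
    ∀ {y} → ¬ EmbeddingOfK.InH emb y → Group._≈_ G (pow G y q) (Group.ε G) →
    ∀ {Γ w z c g} → Coordinatized Γ w z c g →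
    ∃ λ j → UnitMod p j × MapIso G a b Γ (M₂a Γ (suc p) w c g j) (M₂b Γ (suc p) w c g)
  classify-prime ≡.refl G a b md emb H-abelian y∉H y↑P 𝒞 = j , j-unit , map-isomorphism 𝒞
    where
    open MapData md
    open Construct G a b emb generated (proj₁ b-inv) H-abelian y∉H y↑P

  classify : (e : ℕ) (FG : FiniteGroup) → let G = FiniteGroup.group FG in
    (a b : Group.Carrier G) → MapData G a b → (emb : EmbeddingOfK G a b (suc p) (suc p ^ suc e)) →
    (∀ x y → EmbeddingOfK.InH emb x → EmbeddingOfK.InH emb y → Group._≈_ G (Group._∙_ G x y) (Group._∙_ G y x)) →
    (S : Group.Carrier G → Set) → FiniteGroup.IsSylow FG (suc p) S → HasExponent G S (suc p ^ suc e) →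
    ∀ {Γ w z c g} → Coordinatized Γ w z c g →
    suc e ≡ 1 × ∃ λ j → UnitMod p j × MapIso G a b Γ (M₂a Γ (suc p) w c g j) (M₂b Γ (suc p) w c g)
  classify e FG a b md emb H-abelian S syl (_ , exponent , _) 𝒞 = from (sylow⊈H pr (suc e) ≡.refl syl)
    where
    G = FiniteGroup.group FG
    open Counting FG a b emb
    open Abelian G a b emb H-abelian
    from : (∃ λ x → S x × ¬ EmbeddingOfK.InH emb x) → _
    -- The same y is used twice: first to force the exponent to be one, then as the element of order
    -- P outside `H` from which c is controlled.
    from (y , y∈S , y∉H) = ≡.cong suc e≡0 , classify-prime q≡P G a b md emb H-abelian y∉H (exponent y y∈S) 𝒞
      where
      y-cyclic : Cyclic y
      y-cyclic = outside⇒cyclic pr (suc e) (exponent y y∈S) y∉H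
      open CyclicLemmas y-cyclic
      e≡0 : e ≡ 0
      e≡0 = Basis.Action.exponent-one y part-ε≢ pr 4≤p e ≡.refl ↑P-InH
      q≡P : suc p ^ suc e ≡ suc p
      q≡P = ≡.trans (≡.cong (λ e → suc p ^ suc e) e≡0) (*-identityʳ (suc p))

theorem3p7 : (p : ℕ) → Prime p → 5 ≤ p → (e : ℕ) → 1 ≤ e →
    (t : ℕ) → IsPrimitiveRoot p t →
    (Γ : Group 0ℓ 0ℓ) (w z c g : Group.Carrier Γ) → IsG₂Presentation p t Γ w z c g →
    ((FG : FiniteGroup) →
    let G = FiniteGroup.group FG in
    (a b : Group.Carrier G) → MapData G a b →
    (emb : EmbeddingOfK G a b p (p ^ e)) →
    (∀ x y → EmbeddingOfK.InH emb x → EmbeddingOfK.InH emb y →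
    Group._≈_ G (Group._∙_ G x y) (Group._∙_ G y x)) →
    (P : Group.Carrier G → Set) → FiniteGroup.IsSylow FG p P →
    HasExponent G P (p ^ e) →
    (e ≡ 1) ×
    ∃ λ j → UnitMod (p ∸ 1) j × MapIso G a b Γ (M₂a Γ p w c g j) (M₂b Γ p w c g))
    × ((j j' : ℕ) → UnitMod (p ∸ 1) j → UnitMod (p ∸ 1) j' → j ≢ j' →
    ¬ MapIso Γ (M₂a Γ p w c g j) (M₂b Γ p w c g) Γ (M₂a Γ p w c g j') (M₂b Γ p w c g))
    × ((j : ℕ) → UnitMod (p ∸ 1) j →
    IsORMapOfK Γ (M₂a Γ p w c g j) (M₂b Γ p w c g) p p
    × Chiral Γ (M₂a Γ p w c g j) (M₂b Γ p w c g)
    × HasOrder Γ (M₂a Γ p w c g j) (p * (p ∸ 1))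
    × (p % 4 ≡ 1 → HasOrder Γ (Group._∙_ Γ (M₂a Γ p w c g j) (M₂b Γ p w c g)) (p * (p ∸ 1)))
    × (p % 4 ≡ 3 → HasOrder Γ (Group._∙_ Γ (M₂a Γ p w c g j) (M₂b Γ p w c g)) ((p * (p ∸ 1)) / 2)))
theorem3p7 (suc p) pr 5≤p (suc e) 1≤e t root Γ w z c g pres =
    (λ FG a b md emb H-abelian S syl exponent → classify pr 4≤p root e FG a b md emb H-abelian S syl exponent 𝒞)
  , (λ j j′ u u′ j≢j′ → non-isomorphic 𝒞 u u′ j≢j′)
  , (λ j u → (mapData 𝒞 u , embedding 𝒞 u) , chiral 𝒞 u , order-a 𝒞 u , order-ab₁ 𝒞 u , order-ab₃ 𝒞 u)
  where
  4≤p = ≤-pred 5≤p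
  open Model pr root
  open Maps pr 4≤p root (prime-pred-even pr 4≤p)
  𝒞 = presentation⇒coordinatized pres
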